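{- Let $p>3$ be a prime and $x\in\mathbb Z_p$. Put $T(x)=\dfrac{B_{p^2(p-1)}(-x)-B_{p^2(p-1)}}{p^2(p-1)}$. Then $$V_p(x)\equiv1-2\binom xp\binom{ -1-x}p+2pT(x)+2p^2T(x)^2\pmod{p^3}.$$ Consequently $V_p\equiv8$, $V_p^{(3)}\equiv15$, $V_p^{(4)}\equiv40$ and $V_p^{(6)}\equiv312\pmod{p^3}$.
   Context: For real $x$ and integer $k\ge0$, $\binom xk=x(x-1)\cdots(x-k+1)/k!$. $V_n(x)=\sum_{k=0}^n\binom nk\binom{n+k}k(-1)^k\binom xk\binom{ -1-x}k$. $\mathbb Z_p$ is the set of rationals with denominator prime to $p$; congruences modulo powers of $p$ are in $\mathbb Z_p$. Bernoulli numbers: $B_0=1$, $\sum_{k=0}^{n-1}\binom nkB_k=0$ ($n\ge2$); $B_n(x)=\sum_{k=0}^n\binom nkB_kx^{n-k}$. $V_n=16^nV_n(-\tfrac12)=\sum_{k=0}^n\binom{2k}k^2\binom{2n-2k}{n-k}^2$, $V_n^{(3)}=27^nV_n(-\tfrac13)=\sum_{k=0}^n\binom nk\binom{n+k}k(-1)^k\binom{2k}k\binom{3k}k27^{n-k}$, $V_n^{(4)}=64^nV_n(-\tfrac14)=\sum_{k=0}^n\binom nk\binom{n+k}k(-1)^k\binom{2k}k\binom{4k}{2k}64^{n-k}$, $V_n^{(6)}=432^nV_n(-\tfrac16)=\sum_{k=0}^n\binom nk\binom{n+k}k(-1)^k\binom{3k}k\binom{6k}{3k}432^{n-k}$. -}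

module Defs where

open import Data.Nat as ℕ using (ℕ; zero; suc; _∸_; _≤ᵇ_; _≡ᵇ_; _!)
open import Data.Nat.Combinatorics using (_C_)
open import Data.Nat.Coprimality using (Coprime)
open import Data.Integer as ℤ using (ℤ; +_)
open import Data.Integer.Divisibility as ℤD using ()
open import Data.Rational as ℚ using (ℚ; _+_; _*_; _-_; -_; 0ℚ; 1ℚ)
open ℚ.ℚ using (denominatorℕ)
open import Data.Bool using (if_then_else_)
open import Data.Product using (Σ; _×_)
open import Relation.Binary.PropositionalEquality using (_≡_)

ℕ→ℚ : ℕ → ℚ
ℕ→ℚ n = + n ℚ./ 1

-- reciprocal 1/n of a positive natural (0 ↦ 0, never used at 0)
recipℕ : ℕ → ℚ
recipℕ zero = 0ℚ
recipℕ (suc n) = + 1 ℚ./ suc n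

sumQ : ℕ → (ℕ → ℚ) → ℚ
sumQ zero f = 0ℚ
sumQ (suc n) f = sumQ n f + f n

sumZ : ℕ → (ℕ → ℤ) → ℤ
sumZ zero f = + 0
sumZ (suc n) f = sumZ n f ℤ.+ f n

powQ : ℚ → ℕ → ℚ
powQ x zero = 1ℚ
powQ x (suc n) = powQ x n * x

signQ : ℕ → ℚ
signQ k = powQ (- 1ℚ) k

fallQ : ℚ → ℕ → ℚ
fallQ x zero = 1ℚ
fallQ x (suc k) = fallQ x k * (x - ℕ→ℚ k)

binomQ : ℚ → ℕ → ℚ
binomQ x k = fallQ x k * recipℕ (k ℕ.!)

Vpoly : ℕ → ℚ → ℚ
Vpoly n x = sumQ (suc n) λ k →
  ℕ→ℚ (n C k) * ℕ→ℚ ((n ℕ.+ k) C k) * signQ k * binomQ x k * binomQ (- 1ℚ - x) k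

-- Bernoulli numbers via B_0 = 1, Σ_{k=0}^{m-1} C(m,k) B_k = 0 (m ≥ 2).
-- bernUpTo n k = B_k for k ≤ n (and 0 for k > n).
bernUpTo : ℕ → ℕ → ℚ
bernUpTo zero k = if k ≡ᵇ 0 then 1ℚ else 0ℚ
bernUpTo (suc n) k =
  if k ≤ᵇ n then bernUpTo n k
  else (if k ≡ᵇ suc n
        then - (recipℕ (suc (suc n)) *
               sumQ (suc n) (λ j → ℕ→ℚ ((suc (suc n)) C j) * bernUpTo n j))
        else 0ℚ)

bernoulli : ℕ → ℚ
bernoulli n = bernUpTo n n

bernoulliPoly : ℕ → ℚ → ℚ
bernoulliPoly n x = sumQ (suc n) λ k → ℕ→ℚ (n C k) * bernoulli k * powQ x (n ∸ k)

InZp : ℕ → ℚ → Set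
InZp p x = Coprime (denominatorℕ x) p

CongQ : ℕ → ℕ → ℚ → ℚ → Set
CongQ p e a b = Σ ℚ λ z → InZp p z × (a - b ≡ ℕ→ℚ (p ℕ.^ e) * z)

Tfun : ℕ → ℚ → ℚ
Tfun p x = (bernoulliPoly N (- x) - bernoulli N) * recipℕ N
  where N = p ℕ.* p ℕ.* (p ∸ 1)

CongZ : ℕ → ℕ → ℤ → ℤ → Set
CongZ p e a b = (+ (p ℕ.^ e)) ℤD.∣ (a ℤ.- b)

ℕ→ℤ : ℕ → ℤ
ℕ→ℤ n = + n

signZ : ℕ → ℤ
signZ k = if k ℕ.% 2 ≡ᵇ 0 then + 1 else ℤ.- (+ 1)

Vseq : ℕ → ℤ
Vseq n = sumZ (suc n) λ k →
  + (((2 ℕ.* k) C k) ℕ.* ((2 ℕ.* k) C k)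
     ℕ.* (((2 ℕ.* n) ∸ (2 ℕ.* k)) C (n ∸ k)) ℕ.* (((2 ℕ.* n) ∸ (2 ℕ.* k)) C (n ∸ k)))

V3seq : ℕ → ℤ
V3seq n = sumZ (suc n) λ k →
  + ((n C k) ℕ.* ((n ℕ.+ k) C k)) ℤ.* signZ k
    ℤ.* + (((2 ℕ.* k) C k) ℕ.* ((3 ℕ.* k) C k) ℕ.* (27 ℕ.^ (n ∸ k)))

V4seq : ℕ → ℤ
V4seq n = sumZ (suc n) λ k →
  + ((n C k) ℕ.* ((n ℕ.+ k) C k)) ℤ.* signZ k
    ℤ.* + (((2 ℕ.* k) C k) ℕ.* ((4 ℕ.* k) C (2 ℕ.* k)) ℕ.* (64 ℕ.^ (n ∸ k)))

V6seq : ℕ → ℤ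
V6seq n = sumZ (suc n) λ k →
  + ((n C k) ℕ.* ((n ℕ.+ k) C k)) ℤ.* signZ k
    ℤ.* + (((3 ℕ.* k) C k) ℕ.* ((6 ℕ.* k) C (3 ℕ.* k)) ℕ.* (432 ℕ.^ (n ∸ k)))

{-# OPTIONS --safe #-}

-- Write t n k = (−1)^k C(n,k) C(n+k,k), so that V_p(−1−n) = Σ_{k ≤ p} t p k · t n k for natural n.  Let Y n be the sum over
-- k < p.  For k < p one has (p−k) t p k ≡ p (mod p³), and (n−p) t n k − (n+p) t (n−1) k = 2(k−p)(−1)^k C(n,k) C(n+k−1,k),
-- whose partial sums over k telescope.  Hence (n−p) Y n ≡ (n+p) Y (n−1) if p ∤ n, while Y n ≡ Y (n−1) if p ∣ n because
-- Σ_{k<p} 1/k² ≡ 0 (mod p).  The quadratic 1 + 2pH + 2p²H² in H = Σ_{j ≤ n} j^(N−1), N = p²(p−1), obeys the same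
-- recursion, and H is exactly T(−1−n).  This settles x = −1−n, and both sides are p-adically continuous in x.
--
-- For d = 3, 4, 6 choose n ≡ −1/d modulo p⁶.  Then p!² C(n,p) C(n+p,p) is a product of 2p consecutive integers, two of them
-- multiples of p, which gives s(s+1) Y n ≡ C(n,p) C(n+p,p) with s = ⌊n/p⌋; the right side reduces to C(2p,p) C(3p,p) and
-- its analogues, known modulo p³ by Wolstenholme's theorem.  In Σ C(2k,k)² C(2p−2k,p−k)² the inner terms are ≡ 4p²/k².
module Submission where

open import Defs
open import Data.Nat as ℕ using (ℕ; zero; suc; _<_; _≤_; _∸_; z≤n; s≤s; _!)
import Data.Nat.Properties as ℕP
import Data.Nat.Divisibility as ℕD
import Data.Nat.DivMod as ℕDM
import Data.Nat.Tactic.RingSolver as ℕSolver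
open import Data.Nat.Combinatorics using (_C_; nCk≡nC[n∸k]; nCk+nC[k+1]≡[n+1]C[k+1]; nCn≡1; k>n⇒nCk≡0)
open import Data.Nat.Coprimality as Coprimality using (Coprime)
open import Data.Nat.Primality using (Prime; euclidsLemma; prime⇒irreducible)
open import Data.Integer as ℤ using (ℤ; +_; _^_; ∣_∣)
import Data.Integer.DivMod as ℤDM
import Data.Integer.Properties as ℤP
import Data.Integer.Divisibility.Signed as ℤS
import Data.Integer.Tactic.RingSolver as ℤSolver
open import Data.Rational as ℚ using (ℚ)
open import Data.Bool using (true; false)
open import Data.Bool.Properties using (T-≡)
open import Data.Empty using (⊥-elim)
open import Data.Product using (Σ-syntax; _×_; _,_; proj₁; proj₂)
open import Data.Sum using (_⊎_; inj₁; inj₂; [_,_]′)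
import Data.Sum as Sum
open import Function using (_∘_)
open import Function.Bundles using (Equivalence)
open import Level using (0ℓ)
open import Relation.Nullary using (¬_; yes; no; Dec)
import Relation.Nullary.Decidable as Dec
open import Relation.Binary.PropositionalEquality

-- The quadratic 1 + 2pH + 2p²H² is exp(2pH) cut off after the square: (n + p)/(n - p) = (1 +
-- p/n)/(1 - p/n) agrees with exp(2p/n) modulo p³, so multiplying these factors adds up the 1/n in
-- the exponent. As N is the order of the unit group modulo p³, j^(N-1) replaces 1/j for j prime to
-- p and is negligible for p ∣ j. This keeps the recursion inside the integers.
--
-- No p-adic numbers occur. Bernoulli numbers, 1/N and 1/k! may bring powers of p into denominators,
-- so continuity is expressed as a Lipschitz estimate for p^M f, and x is replaced by some -1 - n
-- close enough to absorb the loss of p^M.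
--
-- The four special values are not found by evaluating T at -1/d, which would need H modulo p². For
-- d = 3, 4, 6 every prime p > 3 is ±1 modulo d, and the closed form of Y n in binomial coefficients
-- takes the place of T: the truncated sum comes out as 27, 64, 432, and the term k = p subtracts
-- 12, 24, 120.

module IntegerCongruences where

  -- Congruences of integers.

  open import Data.Integer using (_+_; _*_; _-_; -_)
  open import Data.Integer.Tactic.RingSolver using (solve-∀)

  -- The quotient is a field and the equation is solved for `i`, so that matching on `quot q refl`
  -- eliminates `i` and the closure properties become ring identities.
  record Cong (μ i j : ℤ) : Set where
    constructor quot
    field
      q  : ℤ
      eq : i ≡ j + μ * q

  private
    variable
      μ ν i j k₁ k₂ : ℤ

  Cong-reflexive : i ≡ j → Cong μ i j
  Cong-reflexive {i} {μ = μ} refl = quot (+ 0) (lem i μ)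
    where
    lem : ∀ i μ → i ≡ i + μ * + 0
    lem = solve-∀

  Cong-refl : Cong μ i i
  Cong-refl = Cong-reflexive refl

  Cong-sym : Cong μ i j → Cong μ j i
  Cong-sym {μ} {j = j} (quot q refl) = quot (- q) (lem j μ q)
    where
    lem : ∀ j μ q → j ≡ j + μ * q + μ * - q
    lem = solve-∀

  Cong-trans : Cong μ i j → Cong μ j k₁ → Cong μ i k₁
  Cong-trans {μ} {k₁ = k₁} (quot q refl) (quot q′ refl) = quot (q′ + q) (lem k₁ μ q q′)
    where
    lem : ∀ k₁ μ q q′ → k₁ + μ * q′ + μ * q ≡ k₁ + μ * (q′ + q)
    lem = solve-∀

  Cong-+ : Cong μ i j → Cong μ k₁ k₂ → Cong μ (i + k₁) (j + k₂)
  Cong-+ {μ} {j = j} {k₂ = k₂} (quot q refl) (quot q′ refl) = quot (q + q′) (lem j k₂ μ q q′)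
    where
    lem : ∀ j k₂ μ q q′ → j + μ * q + (k₂ + μ * q′) ≡ j + k₂ + μ * (q + q′)
    lem = solve-∀

  Cong-* : Cong μ i j → Cong μ k₁ k₂ → Cong μ (i * k₁) (j * k₂)
  Cong-* {μ} {j = j} {k₂ = k₂} (quot q refl) (quot q′ refl) =
    quot (j * q′ + q * k₂ + μ * q * q′) (lem j k₂ μ q q′)
    where
    lem : ∀ j k₂ μ q q′ → (j + μ * q) * (k₂ + μ * q′) ≡ j * k₂ + μ * (j * q′ + q * k₂ + μ * q * q′)
    lem = solve-∀

  Cong-*ˡ : ∀ k₁ → Cong μ i j → Cong μ (k₁ * i) (k₁ * j)
  Cong-*ˡ k₁ p = Cong-* {i = k₁} {j = k₁} Cong-refl p

  Cong-*ʳ : ∀ k₁ → Cong μ i j → Cong μ (i * k₁) (j * k₁)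
  Cong-*ʳ k₁ p = Cong-* {k₁ = k₁} {k₂ = k₁} p Cong-refl

  Cong-neg : Cong μ i j → Cong μ (- i) (- j)
  Cong-neg {μ} {j = j} (quot q refl) = quot (- q) (lem j μ q)
    where
    lem : ∀ j μ q → - (j + μ * q) ≡ - j + μ * - q
    lem = solve-∀

  Cong-- : Cong μ i j → Cong μ k₁ k₂ → Cong μ (i - k₁) (j - k₂)
  Cong-- p q = Cong-+ p (Cong-neg q)

  Cong-^ : ∀ n → Cong μ i j → Cong μ (i ^ n) (j ^ n)
  Cong-^ zero    p = Cong-refl
  Cong-^ (suc n) p = Cong-* p (Cong-^ n p)

  Cong-scale : ∀ k → Cong μ i j → Cong (k * μ) (k * i) (k * j)
  Cong-scale {μ} {j = j} k (quot q refl) = quot q (lem k j μ q)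
    where
    lem : ∀ k j μ q → k * (j + μ * q) ≡ k * j + k * μ * q
    lem = solve-∀

  Cong-unscale : ∀ k .{{_ : ℤ.NonZero k}} → Cong (k * μ) (k * i) (k * j) → Cong μ i j
  Cong-unscale {μ} {i} {j} k (quot q e) =
    quot q (ℤP.*-cancelˡ-≡ k i (j + μ * q) (trans e (lem k j μ q)))
    where
    lem : ∀ k j μ q → k * j + k * μ * q ≡ k * (j + μ * q)
    lem = solve-∀

  Cong-weaken : ∀ μ ν → Cong (μ * ν) i j → Cong μ i j
  Cong-weaken {j = j} μ ν (quot q refl) = quot (ν * q) (lem j μ ν q)
    where
    lem : ∀ j μ ν q → j + μ * ν * q ≡ j + μ * (ν * q)
    lem = solve-∀

  Cong-**0 : Cong μ i (+ 0) → Cong ν j (+ 0) → Cong (μ * ν) (i * j) (+ 0)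
  Cong-**0 {μ} {ν = ν} (quot q refl) (quot q′ refl) = quot (q * q′) (lem μ ν q q′)
    where
    lem : ∀ μ ν q q′ → (+ 0 + μ * q) * (+ 0 + ν * q′) ≡ + 0 + μ * ν * (q * q′)
    lem = solve-∀

  Cong⇒diff : Cong μ i j → Cong μ (i - j) (+ 0)
  Cong⇒diff {μ} {j = j} (quot q refl) = quot q (lem j μ q)
    where
    lem : ∀ j μ q → j + μ * q - j ≡ + 0 + μ * q
    lem = solve-∀

  diff⇒Cong : Cong μ (i - j) (+ 0) → Cong μ i j
  diff⇒Cong {μ} {i} {j} (quot q e) = quot q (trans (lem i j) (trans (cong (λ z → j + z) e) (lem′ j (μ * q))))
    where
    lem : ∀ i j → i ≡ j + (i - j)
    lem = solve-∀
    lem′ : ∀ j z → j + (+ 0 + z) ≡ j + z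
    lem′ = solve-∀

  Cong-*0ˡ : ∀ k₁ → Cong μ i (+ 0) → Cong μ (k₁ * i) (+ 0)
  Cong-*0ˡ k₁ p = Cong-trans (Cong-*ˡ k₁ p) (Cong-reflexive (ℤP.*-zeroʳ k₁))

  Cong-*0ʳ : ∀ k₁ → Cong μ i (+ 0) → Cong μ (i * k₁) (+ 0)
  Cong-*0ʳ k₁ p = Cong-trans (Cong-*ʳ k₁ p) (Cong-reflexive (ℤP.*-zeroˡ k₁))

  Cong-multiple : ∀ μ k → Cong μ (μ * k) (+ 0)
  Cong-multiple μ k = quot k (sym (ℤP.+-identityˡ (μ * k)))

  -- Finite sums of integers.

  sumZ-cong : ∀ n {f g : ℕ → ℤ} → (∀ k → k < n → f k ≡ g k) → sumZ n f ≡ sumZ n g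
  sumZ-cong zero    e = refl
  sumZ-cong (suc n) e = cong₂ _+_ (sumZ-cong n (λ k k<n → e k (ℕP.m<n⇒m<1+n k<n))) (e n (ℕP.n<1+n n))

  sumZ-Cong : ∀ n {f g : ℕ → ℤ} → (∀ k → k < n → Cong μ (f k) (g k)) → Cong μ (sumZ n f) (sumZ n g)
  sumZ-Cong zero    e = Cong-refl
  sumZ-Cong (suc n) e = Cong-+ (sumZ-Cong n (λ k k<n → e k (ℕP.m<n⇒m<1+n k<n))) (e n (ℕP.n<1+n n))

  sumZ-zero : ∀ n → sumZ n (λ _ → + 0) ≡ + 0
  sumZ-zero zero    = refl
  sumZ-zero (suc n) = trans (ℤP.+-identityʳ _) (sumZ-zero n)

  sumZ-+ : ∀ n (f g : ℕ → ℤ) → sumZ n (λ k → f k + g k) ≡ sumZ n f + sumZ n g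
  sumZ-+ zero    f g = refl
  sumZ-+ (suc n) f g = trans (cong (λ z → z + (f n + g n)) (sumZ-+ n f g)) (lem (sumZ n f) (sumZ n g) (f n) (g n))
    where
    lem : ∀ a b c d → a + b + (c + d) ≡ a + c + (b + d)
    lem = solve-∀

  sumZ-*ˡ : ∀ n c (f : ℕ → ℤ) → sumZ n (λ k → c * f k) ≡ c * sumZ n f
  sumZ-*ˡ zero    c f = sym (ℤP.*-zeroʳ c)
  sumZ-*ˡ (suc n) c f = trans (cong (_+ c * f n) (sumZ-*ˡ n c f)) (sym (ℤP.*-distribˡ-+ c (sumZ n f) (f n)))

  sumZ-lincomb : ∀ n c d (f g : ℕ → ℤ) → sumZ n (λ k → c * f k - d * g k) ≡ c * sumZ n f - d * sumZ n g
  sumZ-lincomb n c d f g = begin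
    sumZ n (λ k → c * f k - d * g k)                     ≡⟨ sumZ-cong n (λ k _ → lem c d (f k) (g k)) ⟩
    sumZ n (λ k → c * f k + (- d) * g k)                 ≡⟨ sumZ-+ n _ _ ⟩
    sumZ n (λ k → c * f k) + sumZ n (λ k → (- d) * g k)  ≡⟨ cong₂ _+_ (sumZ-*ˡ n c f) (sumZ-*ˡ n (- d) g) ⟩
    c * sumZ n f + (- d) * sumZ n g                      ≡⟨ lem c d (sumZ n f) (sumZ n g) ⟨
    c * sumZ n f - d * sumZ n g                          ∎
    where
    open ≡-Reasoning
    lem : ∀ c d x y → c * x - d * y ≡ c * x + (- d) * y
    lem = solve-∀

  sumZ-head : ∀ n (f : ℕ → ℤ) → sumZ (suc n) f ≡ f 0 + sumZ n (f ∘ suc)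
  sumZ-head zero    f = ℤP.+-comm (+ 0) (f 0)
  sumZ-head (suc n) f = trans (cong (_+ f (suc n)) (sumZ-head n f)) (ℤP.+-assoc (f 0) _ _)

  sumZ-telescope : ∀ n (f : ℕ → ℤ) → sumZ n (λ k → f (suc k) - f k) ≡ f n - f 0
  sumZ-telescope zero    f = sym (ℤP.+-inverseʳ (f 0))
  sumZ-telescope (suc n) f = trans (cong (_+ (f (suc n) - f n)) (sumZ-telescope n f)) (lem (f n) (f 0) (f (suc n)))
    where
    lem : ∀ x y z → x - y + (z - x) ≡ z - y
    lem = solve-∀

  -- Binomial coefficients as integers.

  opaque
    -- Integer-valued, because the recursions below have factors such as n - k that may be negative.
    -- Opaque, so that a binomial coefficient stays an atom for the ring solver.
    choose : ℕ → ℕ → ℤ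
    choose n k = + (n C k)

    choose-C : ∀ n k → choose n k ≡ + (n C k)
    choose-C n k = refl

    choose-zeroʳ : ∀ n → choose n 0 ≡ + 1
    choose-zeroʳ zero    = refl
    choose-zeroʳ (suc n) = refl

    choose-n-n : ∀ n → choose n n ≡ + 1
    choose-n-n n = cong +_ (nCn≡1 n)

    choose-> : ∀ {n k} → n < k → choose n k ≡ + 0
    choose-> n<k = cong +_ (k>n⇒nCk≡0 n<k)

    pascal : ∀ n k → choose (suc n) (suc k) ≡ choose n k + choose n (suc k)
    pascal n k = cong +_ (sym (nCk+nC[k+1]≡[n+1]C[k+1] n k))

  -- Joint induction on n: Pascal's rule reduces absorption at n to raising at n, and raising at n +
  -- 1 follows from absorption and raising at n. With the integer factor n - k the identity also
  -- covers k ≥ n, where both sides vanish.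
  choose-raise : ∀ n k → + suc k * choose n (suc k) ≡ (+ n - + k) * choose n k
  choose-absorb : ∀ n k → + suc k * choose (suc n) (suc k) ≡ + suc n * choose n k

  choose-absorb n k rewrite pascal n k = begin
    + suc k * (choose n k + choose n (suc k))              ≡⟨ ℤP.*-distribˡ-+ (+ suc k) (choose n k) (choose n (suc k)) ⟩
    + suc k * choose n k + + suc k * choose n (suc k)      ≡⟨ cong (λ z → + suc k * choose n k + z) (choose-raise n k) ⟩
    + suc k * choose n k + (+ n - + k) * choose n k        ≡⟨ lem (+ n) (+ k) (choose n k) ⟩
    + suc n * choose n k                                   ∎
    where
    open ≡-Reasoning
    lem : ∀ n k c → (+ 1 + k) * c + (n - k) * c ≡ (+ 1 + n) * c
    lem = solve-∀

  choose-raise zero    zero    = trans (cong (+ 1 *_) (choose-> {0} {1} (s≤s z≤n))) (sym (ℤP.*-zeroˡ (choose 0 0)))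
  choose-raise zero    (suc k) = begin
    + suc (suc k) * choose 0 (suc (suc k))  ≡⟨ cong (+ suc (suc k) *_) (choose-> {0} {suc (suc k)} (s≤s z≤n)) ⟩
    + suc (suc k) * + 0                     ≡⟨ ℤP.*-zeroʳ (+ suc (suc k)) ⟩
    + 0                                     ≡⟨ ℤP.*-zeroʳ (+ 0 - + suc k) ⟨
    (+ 0 - + suc k) * + 0                   ≡⟨ cong ((+ 0 - + suc k) *_) (choose-> {0} {suc k} (s≤s z≤n)) ⟨
    (+ 0 - + suc k) * choose 0 (suc k)      ∎
    where open ≡-Reasoning
  choose-raise (suc n) zero    = begin
    + 1 * choose (suc n) 1             ≡⟨ choose-absorb n 0 ⟩
    + suc n * choose n 0               ≡⟨ cong (+ suc n *_) (choose-zeroʳ n) ⟩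
    + suc n * + 1                      ≡⟨ lem (+ suc n) ⟩
    (+ suc n - + 0) * + 1              ≡⟨ cong ((+ suc n - + 0) *_) (choose-zeroʳ (suc n)) ⟨
    (+ suc n - + 0) * choose (suc n) 0 ∎
    where
    open ≡-Reasoning
    lem : ∀ x → x * + 1 ≡ (x - + 0) * + 1
    lem = solve-∀
  choose-raise (suc n) (suc k) = begin
    + suc (suc k) * choose (suc n) (suc (suc k))                              ≡⟨ choose-absorb n (suc k) ⟩
    + suc n * choose n (suc k)                                                ≡⟨ lem (+ n) (+ k) (choose n (suc k)) ⟩
    + suc k * choose n (suc k) + (+ n - + k) * choose n (suc k)               ≡⟨ cong (_+ (+ n - + k) * choose n (suc k)) (choose-raise n k) ⟩
    (+ n - + k) * choose n k + (+ n - + k) * choose n (suc k)                 ≡⟨ lem′ (+ n) (+ k) (choose n k) (choose n (suc k)) ⟩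
    (+ suc n - + suc k) * (choose n k + choose n (suc k))                     ≡⟨ cong ((+ suc n - + suc k) *_) (pascal n k) ⟨
    (+ suc n - + suc k) * choose (suc n) (suc k)                              ∎
    where
    open ≡-Reasoning
    lem : ∀ n k c → (+ 1 + n) * c ≡ (+ 1 + k) * c + (n - k) * c
    lem = solve-∀
    lem′ : ∀ n k c e → (n - k) * c + (n - k) * e ≡ ((+ 1 + n) - (+ 1 + k)) * (c + e)
    lem′ = solve-∀

  choose-lower : ∀ n k → (+ suc n - + k) * choose (suc n) k ≡ + suc n * choose n k
  choose-lower n k = trans (sym (choose-raise (suc n) k)) (choose-absorb n k)

  -- Signed products of two binomial coefficients.

  sgn : ℕ → ℤ
  sgn zero    = + 1
  sgn (suc k) = - sgn k

  sgn² : ∀ k → sgn k * sgn k ≡ + 1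
  sgn² zero    = refl
  sgn² (suc k) = trans (lem (sgn k)) (sgn² k)
    where
    lem : ∀ x → (- x) * (- x) ≡ x * x
    lem = solve-∀

  -- `u m` is the summand on the right of the recursion of `t` in n, at n = m + 1, and `w m` gives
  -- its partial sums. By `w-step`, `w m k` is the product of 1 - (m + 1)²/j² over 1 ≤ j ≤ k, which
  -- makes it easy to control modulo powers of p when p ∣ m + 1.
  t u w : ℕ → ℕ → ℤ
  t n k = sgn k * (choose n k * choose (n ℕ.+ k) k)
  u m k = sgn k * (choose (suc m) k * choose (m ℕ.+ k) k)
  w m k = sgn k * (choose m k * choose (suc m ℕ.+ k) k)

  t-zeroʳ : ∀ n → t n 0 ≡ + 1
  t-zeroʳ n = cong₂ (λ x y → + 1 * (x * y)) (choose-zeroʳ n) (choose-zeroʳ (n ℕ.+ 0))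

  w-zeroʳ : ∀ n → w n 0 ≡ + 1
  w-zeroʳ n = cong₂ (λ x y → + 1 * (x * y)) (choose-zeroʳ n) (choose-zeroʳ (suc n ℕ.+ 0))

  t-zeroˡ : ∀ k → t 0 (suc k) ≡ + 0
  t-zeroˡ k = trans (cong (λ x → sgn (suc k) * (x * choose (suc k) (suc k))) (choose-> {0} {suc k} (s≤s z≤n)))
    (lem (sgn (suc k)) (choose (suc k) (suc k)))
    where
    lem : ∀ x y → x * (+ 0 * y) ≡ + 0
    lem = solve-∀

  choose-lower-+ : ∀ m k → + suc m * choose (suc m ℕ.+ k) k ≡ (+ suc m + + k) * choose (m ℕ.+ k) k
  choose-lower-+ m k = trans (cong (_* choose (suc m ℕ.+ k) k) (lem (+ suc m) (+ k))) (choose-lower (m ℕ.+ k) k)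
    where
    lem : ∀ x y → x ≡ x + y - y
    lem = solve-∀

  choose-absorb-+ : ∀ n k → + suc k * choose (n ℕ.+ suc k) (suc k) ≡ (+ n + + suc k) * choose (n ℕ.+ k) k
  choose-absorb-+ n k = begin
    + suc k * choose (n ℕ.+ suc k) (suc k)    ≡⟨ cong (λ z → + suc k * choose z (suc k)) (ℕP.+-suc n k) ⟩
    + suc k * choose (suc (n ℕ.+ k)) (suc k)  ≡⟨ choose-absorb (n ℕ.+ k) k ⟩
    + suc (n ℕ.+ k) * choose (n ℕ.+ k) k      ≡⟨ cong (λ z → + z * choose (n ℕ.+ k) k) (ℕP.+-suc n k) ⟨
    + (n ℕ.+ suc k) * choose (n ℕ.+ k) k      ∎
    where open ≡-Reasoning

  w-step : ∀ m k → + suc k * + suc k * w m (suc k) ≡ (+ suc k * + suc k - + suc m * + suc m) * w m k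
  w-step m k = begin
    + suc k * + suc k * ((- sgn k) * (choose m (suc k) * choose (suc m ℕ.+ suc k) (suc k)))
      ≡⟨ lem₁ (+ suc k) (sgn k) (choose m (suc k)) (choose (suc m ℕ.+ suc k) (suc k)) ⟩
    (- sgn k) * ((+ suc k * choose m (suc k)) * (+ suc k * choose (suc m ℕ.+ suc k) (suc k)))
      ≡⟨ cong₂ (λ x y → (- sgn k) * (x * y)) (choose-raise m k) (choose-absorb-+ (suc m) k) ⟩
    (- sgn k) * (((+ m - + k) * choose m k) * ((+ suc m + + suc k) * choose (suc m ℕ.+ k) k))
      ≡⟨ lem₂ (+ m) (+ k) (sgn k) (choose m k) (choose (suc m ℕ.+ k) k) ⟩
    (+ suc k * + suc k - + suc m * + suc m) * w m k ∎
    where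
    open ≡-Reasoning
    lem₁ : ∀ k s c e → k * k * ((- s) * (c * e)) ≡ (- s) * ((k * c) * (k * e))
    lem₁ = solve-∀
    lem₂ : ∀ m k s c e → (- s) * (((m - k) * c) * (((+ 1 + m) + (+ 1 + k)) * e)) ≡ ((+ 1 + k) * (+ 1 + k) - (+ 1 + m) * (+ 1 + m)) * (s * (c * e))
    lem₂ = solve-∀

  -- Up to Pascal's rule on one binomial coefficient of each side this says C(m,k) C(m+k+1,k+1) =
  -- C(m+1,k+1) C(m+k+1,k). Multiplied by k + 1, both sides are (m+1) C(m,k) C(m+k+1,k).
  u-step : ∀ m k → u m (suc k) ≡ w m (suc k) - w m k
  u-step m k = trans (cong₂ (λ x y → - sgn k * (x * y)) (pascal m k) refl)
             (trans (ℤP.*-cancelˡ-≡ (+ suc k) _ _ main)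
                    (cong (λ y → (- sgn k) * (choose m (suc k) * y) - w m k) (sym eq₂)))
    where
    open ≡-Reasoning
    a b β γ : ℤ
    a = choose m (suc k)
    b = choose m k
    β = choose (m ℕ.+ suc k) (suc k)
    γ = choose (suc m ℕ.+ k) k
    eq₁ : γ ≡ choose (m ℕ.+ suc k) k
    eq₁ = cong (λ z → choose z k) (sym (ℕP.+-suc m k))
    eq₂ : choose (suc m ℕ.+ suc k) (suc k) ≡ γ + β
    eq₂ = trans (pascal (m ℕ.+ suc k) k) (cong (_+ β) (sym eq₁))
    ka : + suc k * a ≡ (+ m - + k) * b
    ka = choose-raise m k
    kβ : + suc k * β ≡ + suc m * γ
    kβ = begin
      + suc k * β                                                ≡⟨ choose-raise (m ℕ.+ suc k) k ⟩
      (+ (m ℕ.+ suc k) - + k) * choose (m ℕ.+ suc k) k           ≡⟨ cong₂ _*_ (lem (+ m) (+ k)) (sym eq₁) ⟩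
      + suc m * γ ∎
      where
      lem : ∀ m k → m + (+ 1 + k) - k ≡ + 1 + m
      lem = solve-∀
    main : + suc k * ((- sgn k) * ((b + a) * β)) ≡ + suc k * ((- sgn k) * (a * (γ + β)) - sgn k * (b * γ))
    main = begin
      + suc k * ((- sgn k) * ((b + a) * β))
        ≡⟨ l₁ (+ suc k) (sgn k) a b β ⟩
      (- sgn k) * (b * (+ suc k * β)) + + suc k * ((- sgn k) * (a * β))
        ≡⟨ cong (λ z → (- sgn k) * (b * z) + + suc k * ((- sgn k) * (a * β))) kβ ⟩
      (- sgn k) * (b * (+ suc m * γ)) + + suc k * ((- sgn k) * (a * β))
        ≡⟨ l₂ (+ m) (+ k) (sgn k) a b β γ ⟩
      (- sgn k) * ((+ m - + k) * b * γ) + + suc k * ((- sgn k) * (a * β) - sgn k * (b * γ))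
        ≡⟨ cong (λ z → (- sgn k) * (z * γ) + + suc k * ((- sgn k) * (a * β) - sgn k * (b * γ))) (sym ka) ⟩
      (- sgn k) * (+ suc k * a * γ) + + suc k * ((- sgn k) * (a * β) - sgn k * (b * γ))
        ≡⟨ l₃ (+ suc k) (sgn k) a b β γ ⟩
      + suc k * ((- sgn k) * (a * (γ + β)) - sgn k * (b * γ)) ∎
      where
      l₁ : ∀ k s a b β → k * ((- s) * ((b + a) * β)) ≡ (- s) * (b * (k * β)) + k * ((- s) * (a * β))
      l₁ = solve-∀
      l₂ : ∀ m k s a b β γ → (- s) * (b * ((+ 1 + m) * γ)) + (+ 1 + k) * ((- s) * (a * β)) ≡ (- s) * ((m - k) * b * γ) + (+ 1 + k) * ((- s) * (a * β) - s * (b * γ))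
      l₂ = solve-∀
      l₃ : ∀ k s a b β γ → (- s) * (k * a * γ) + k * ((- s) * (a * β) - s * (b * γ)) ≡ k * ((- s) * (a * (γ + β)) - s * (b * γ))
      l₃ = solve-∀

  u-sum : ∀ m K → sumZ (suc K) (u m) ≡ w m K
  u-sum m zero    = begin
    + 0 + + 1 * (choose (suc m) 0 * choose (m ℕ.+ 0) 0)  ≡⟨ cong₂ (λ x y → + 0 + + 1 * (x * y)) (choose-zeroʳ (suc m)) (choose-zeroʳ (m ℕ.+ 0)) ⟩
    + 1                                                  ≡⟨ w-zeroʳ m ⟨
    w m 0                                                ∎
    where open ≡-Reasoning
  u-sum m (suc K) = trans (cong₂ _+_ (u-sum m K) (u-step m K)) (lem (w m K) (w m (suc K)))
    where
    lem : ∀ x y → x + (y - x) ≡ y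
    lem = solve-∀

  -- `P` is any integer. The factor `+ k - P` serves twice: with P = p it meets the weight `t p k`,
  -- whose product with p - k is constant in k modulo p³ for k < p, and at k = P the right side
  -- vanishes, which leaves an exact recursion of `t n p` in n.
  t-rec : ∀ P m k → (+ suc m - P) * t (suc m) k - (+ suc m + P) * t m k ≡ + 2 * (+ k - P) * u m k
  t-rec P m k = ℤP.*-cancelˡ-≡ (+ suc m) _ _ (begin
    n * ((n - P) * (s * (α * γ)) - (n + P) * (s * (δ * β)))     ≡⟨ l₁ n P s α β γ δ ⟩
    s * ((n - P) * (α * (n * γ)) - (n + P) * ((n * δ) * β))     ≡⟨ cong₂ (λ x y → s * ((n - P) * (α * x) - (n + P) * (y * β))) (choose-lower-+ m k) (sym (choose-lower m k)) ⟩
    s * ((n - P) * (α * ((n + + k) * β)) - (n + P) * ((n - + k) * α * β)) ≡⟨ l₂ n P (+ k) s α β ⟩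
    n * (+ 2 * (+ k - P) * (s * (α * β)))                       ∎)
    where
    open ≡-Reasoning
    n s α β γ δ : ℤ
    n = + suc m
    s = sgn k
    α = choose (suc m) k
    β = choose (m ℕ.+ k) k
    γ = choose (suc m ℕ.+ k) k
    δ = choose m k
    l₁ : ∀ n P s α β γ δ → n * ((n - P) * (s * (α * γ)) - (n + P) * (s * (δ * β))) ≡ s * ((n - P) * (α * (n * γ)) - (n + P) * ((n * δ) * β))
    l₁ = solve-∀
    l₂ : ∀ n P k s α β → s * ((n - P) * (α * ((n + k) * β)) - (n + P) * ((n - k) * α * β)) ≡ n * (+ 2 * (k - P) * (s * (α * β)))
    l₂ = solve-∀

  t-lower : ∀ m k → (+ suc m - + k) * t (suc m) k ≡ + suc m * w m k
  t-lower m k = begin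
    (+ suc m - + k) * (sgn k * (choose (suc m) k * c)) ≡⟨ l₁ (+ suc m - + k) (sgn k) (choose (suc m) k) c ⟩
    sgn k * ((+ suc m - + k) * choose (suc m) k * c)   ≡⟨ cong (λ z → sgn k * (z * c)) (choose-lower m k) ⟩
    sgn k * (+ suc m * choose m k * c)                 ≡⟨ l₁ (+ suc m) (sgn k) (choose m k) c ⟨
    + suc m * w m k                                    ∎
    where
    open ≡-Reasoning
    c : ℤ
    c = choose (suc m ℕ.+ k) k
    l₁ : ∀ n s x y → n * (s * (x * y)) ≡ s * (n * x * y)
    l₁ = solve-∀

  -- Meant for p ∣ m + 1, where the coefficients of `t-rec` are divisible by p and the recursion
  -- loses precision; here the factor m + 1 stands openly on the right.
  t-diff : ∀ m k → + suc k * (t (suc m) (suc k) - t m (suc k)) ≡ - + 2 * + suc m * w m k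
  t-diff m k = begin
    + suc k * ((- s) * (choose (suc m) (suc k) * choose (suc m ℕ.+ suc k) (suc k)) - (- s) * (choose m (suc k) * choose (m ℕ.+ suc k) (suc k)))
      ≡⟨ cong₂ (λ x y → + suc k * ((- s) * (choose (suc m) (suc k) * x) - (- s) * (choose m (suc k) * y))) eq₂ eq₃ ⟩
    + suc k * ((- s) * (choose (suc m) (suc k) * (γ + β)) - (- s) * (choose m (suc k) * β))
      ≡⟨ l₁ (+ suc k) s (choose (suc m) (suc k)) (choose m (suc k)) β γ ⟩
    (- s) * ((+ suc k * choose (suc m) (suc k)) * (γ + β)) - (- s) * ((+ suc k * choose m (suc k)) * β)
      ≡⟨ cong₂ (λ x y → (- s) * (x * (γ + β)) - (- s) * (y * β)) (choose-absorb m k) (choose-raise m k) ⟩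
    (- s) * ((+ suc m * b) * (γ + β)) - (- s) * (((+ m - + k) * b) * β)
      ≡⟨ l₂ (+ m) (+ k) s b β γ ⟩
    (- s) * b * (+ suc k * β) + (- s) * (b * (+ suc m * γ))
      ≡⟨ cong (λ z → (- s) * b * z + (- s) * (b * (+ suc m * γ))) kβ ⟩
    (- s) * b * (+ suc m * γ) + (- s) * (b * (+ suc m * γ))
      ≡⟨ l₃ (+ suc m) s b γ ⟩
    - + 2 * + suc m * w m k ∎
    where
    open ≡-Reasoning
    s b β γ : ℤ
    s = sgn k
    b = choose m k
    β = choose (suc m ℕ.+ k) (suc k)
    γ = choose (suc m ℕ.+ k) k
    eq₂ : choose (suc m ℕ.+ suc k) (suc k) ≡ γ + β
    eq₂ = trans (cong (λ z → choose z (suc k)) (ℕP.+-suc (suc m) k)) (pascal (suc m ℕ.+ k) k)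
    eq₃ : choose (m ℕ.+ suc k) (suc k) ≡ β
    eq₃ = cong (λ z → choose z (suc k)) (ℕP.+-suc m k)
    kβ : + suc k * β ≡ + suc m * γ
    kβ = trans (choose-raise (suc m ℕ.+ k) k) (cong (_* γ) (lem (+ suc m) (+ k)))
      where
      lem : ∀ m k → m + k - k ≡ m
      lem = solve-∀
    l₁ : ∀ k s x y β γ → k * ((- s) * (x * (γ + β)) - (- s) * (y * β)) ≡ (- s) * ((k * x) * (γ + β)) - (- s) * ((k * y) * β)
    l₁ = solve-∀
    l₂ : ∀ m k s b β γ → (- s) * (((+ 1 + m) * b) * (γ + β)) - (- s) * (((m - k) * b) * β) ≡ (- s) * b * ((+ 1 + k) * β) + (- s) * (b * ((+ 1 + m) * γ))
    l₂ = solve-∀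
    l₃ : ∀ n s b γ → (- s) * b * (n * γ) + (- s) * (b * (n * γ)) ≡ - + 2 * n * (s * (b * γ))
    l₃ = solve-∀

  -- The binomial theorem, hockey-stick and geometric sums.

  binomial-theorem : ∀ n M a → n < M → (a + + 1) ^ n ≡ sumZ M (λ i → choose n i * a ^ i)
  binomial-theorem zero    (suc M) a n<M = sym (begin
    sumZ (suc M) (λ i → choose 0 i * a ^ i)                        ≡⟨ sumZ-head M (λ i → choose 0 i * a ^ i) ⟩
    choose 0 0 * + 1 + sumZ M (λ i → choose 0 (suc i) * a ^ suc i)  ≡⟨ cong₂ _+_ (cong (_* + 1) (choose-zeroʳ 0))
                                                                           (sumZ-cong M (λ i _ → trans (cong (_* a ^ suc i) (choose-> {0} {suc i} (s≤s z≤n))) (ℤP.*-zeroˡ (a ^ suc i)))) ⟩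
    + 1 + sumZ M (λ _ → + 0)                                       ≡⟨ cong (λ z → + 1 + z) (sumZ-zero M) ⟩
    + 1                                                            ∎)
    where open ≡-Reasoning
  binomial-theorem (suc n) (suc M) a (s≤s n<M) = sym (begin
    sumZ (suc M) (λ i → choose (suc n) i * a ^ i)
      ≡⟨ sumZ-head M (λ i → choose (suc n) i * a ^ i) ⟩
    choose (suc n) 0 * + 1 + sumZ M (λ i → choose (suc n) (suc i) * a ^ suc i)
      ≡⟨ cong₂ (λ x y → x * + 1 + y) (trans (choose-zeroʳ (suc n)) (sym (choose-zeroʳ n)))
           (trans (sumZ-cong M step) (sumZ-+ M (λ i → a * (choose n i * a ^ i)) (λ i → choose n (suc i) * a ^ suc i))) ⟩
    choose n 0 * + 1 + (sumZ M (λ i → a * (choose n i * a ^ i)) + S′)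
      ≡⟨ cong (λ z → choose n 0 * + 1 + (z + S′)) (sumZ-*ˡ M a (λ i → choose n i * a ^ i)) ⟩
    choose n 0 * + 1 + (a * sumZ M (λ i → choose n i * a ^ i) + S′)
      ≡⟨ cong (λ z → choose n 0 * + 1 + (a * z + S′)) (sym (binomial-theorem n M a n<M)) ⟩
    choose n 0 * + 1 + (a * (a + + 1) ^ n + S′)
      ≡⟨ l₁ (choose n 0 * + 1) (a * (a + + 1) ^ n) S′ ⟩
    a * (a + + 1) ^ n + (choose n 0 * + 1 + S′)
      ≡⟨ cong (λ z → a * (a + + 1) ^ n + z) (sumZ-head M (λ i → choose n i * a ^ i)) ⟨
    a * (a + + 1) ^ n + sumZ (suc M) (λ i → choose n i * a ^ i)
      ≡⟨ cong (λ z → a * (a + + 1) ^ n + z) (sym (binomial-theorem n (suc M) a (ℕP.m<n⇒m<1+n n<M))) ⟩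
    a * (a + + 1) ^ n + (a + + 1) ^ n
      ≡⟨ l₂ a ((a + + 1) ^ n) ⟩
    (a + + 1) ^ suc n ∎)
    where
    open ≡-Reasoning
    S′ : ℤ
    S′ = sumZ M (λ i → choose n (suc i) * a ^ suc i)
    step : ∀ i → i < M → choose (suc n) (suc i) * a ^ suc i ≡ a * (choose n i * a ^ i) + choose n (suc i) * a ^ suc i
    step i _ = trans (cong (_* a ^ suc i) (pascal n i)) (lem (choose n i) (choose n (suc i)) a (a ^ i))
      where
      lem : ∀ c e a x → (c + e) * (a * x) ≡ a * (c * x) + e * (a * x)
      lem = solve-∀
    l₁ : ∀ x y z → x + (y + z) ≡ y + (x + z)
    l₁ = solve-∀
    l₂ : ∀ a x → a * x + x ≡ (a + + 1) * x
    l₂ = solve-∀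

  hockey-stick : ∀ n j → sumZ n (λ k → choose k j) ≡ choose n (suc j)
  hockey-stick zero    j = sym (choose-> {0} {suc j} (s≤s z≤n))
  hockey-stick (suc n) j = trans (cong (_+ choose n j) (hockey-stick n j)) (trans (ℤP.+-comm (choose n (suc j)) (choose n j)) (sym (pascal n j)))

  geometric-sum : ∀ a n → (a - + 1) * sumZ n (λ i → a ^ i) ≡ a ^ n - + 1
  geometric-sum a zero    = ℤP.*-zeroʳ (a - + 1)
  geometric-sum a (suc n) = trans (ℤP.*-distribˡ-+ (a - + 1) (sumZ n (λ i → a ^ i)) (a ^ n))
    (trans (cong (_+ (a - + 1) * a ^ n) (geometric-sum a n)) (lem a (a ^ n)))
    where
    lem : ∀ a x → x - + 1 + (a - + 1) * x ≡ a * x - + 1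
    lem = solve-∀

  sumZ-one : ∀ n → sumZ n (λ _ → + 1) ≡ + n
  sumZ-one zero    = refl
  sumZ-one (suc n) = trans (cong (_+ + 1) (sumZ-one n)) (ℤP.+-comm (+ n) (+ 1))

  one-^ : ∀ n → (+ 1) ^ n ≡ + 1
  one-^ zero    = refl
  one-^ (suc n) = trans (ℤP.*-identityˡ ((+ 1) ^ n)) (one-^ n)

  Cong-mod : ∀ {m m′ a b} → m ≡ m′ → Cong m a b → Cong m′ a b
  Cong-mod refl c = c

  sgn-odd : ∀ n → sgn n ≡ + 1 ⊎ 2 ℕD.∣ suc n
  sgn-odd zero          = inj₁ refl
  sgn-odd (suc zero)    = inj₂ ℕD.∣-refl
  sgn-odd (suc (suc n)) = Sum.map (trans (ℤP.neg-involutive (sgn n))) (ℕD.∣m∣n⇒∣m+n ℕD.∣-refl) (sgn-odd n)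

  -- Factorials and multinomial coefficients.

  factorial : ℕ → ℤ
  factorial n = + (n !)

  factorial-suc : ∀ n → factorial (suc n) ≡ + suc n * factorial n
  factorial-suc n = ℤP.pos-* (suc n) (n !)

  factorial-nonZero : ∀ n → ℤ.NonZero (factorial n)
  factorial-nonZero n = n ℕP.!≢0

  choose-factorial : ∀ a b → choose (a ℕ.+ b) a * (factorial a * factorial b) ≡ factorial (a ℕ.+ b)
  choose-factorial zero    b = trans (cong (_* (+ 1 * factorial b)) (choose-zeroʳ b)) (lem (factorial b))
    where
    lem : ∀ x → + 1 * (+ 1 * x) ≡ x
    lem = solve-∀
  choose-factorial (suc a) b = begin
    choose (suc (a ℕ.+ b)) (suc a) * (factorial (suc a) * factorial b)           ≡⟨ cong (λ z → choose (suc (a ℕ.+ b)) (suc a) * (z * factorial b)) (factorial-suc a) ⟩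
    choose (suc (a ℕ.+ b)) (suc a) * (+ suc a * factorial a * factorial b)     ≡⟨ l₁ (choose (suc (a ℕ.+ b)) (suc a)) (+ suc a) (factorial a) (factorial b) ⟩
    + suc a * choose (suc (a ℕ.+ b)) (suc a) * (factorial a * factorial b)     ≡⟨ cong (_* (factorial a * factorial b)) (choose-absorb (a ℕ.+ b) a) ⟩
    + suc (a ℕ.+ b) * choose (a ℕ.+ b) a * (factorial a * factorial b)         ≡⟨ ℤP.*-assoc (+ suc (a ℕ.+ b)) (choose (a ℕ.+ b) a) (factorial a * factorial b) ⟩
    + suc (a ℕ.+ b) * (choose (a ℕ.+ b) a * (factorial a * factorial b))       ≡⟨ cong (+ suc (a ℕ.+ b) *_) (choose-factorial a b) ⟩
    + suc (a ℕ.+ b) * factorial (a ℕ.+ b)                                          ≡⟨ factorial-suc (a ℕ.+ b) ⟨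
    factorial (suc a ℕ.+ b)                                                          ∎
    where
    open ≡-Reasoning
    l₁ : ∀ c k x y → c * (k * x * y) ≡ k * c * (x * y)
    l₁ = solve-∀

  multinomial : ∀ a b c → choose (a ℕ.+ (b ℕ.+ c)) a * choose (b ℕ.+ c) b * (factorial a * factorial b * factorial c) ≡ factorial (a ℕ.+ (b ℕ.+ c))
  multinomial a b c = begin
    x * y * (factorial a * factorial b * factorial c)    ≡⟨ l₁ x y (factorial a) (factorial b) (factorial c) ⟩
    x * (factorial a * (y * (factorial b * factorial c))) ≡⟨ cong (λ z → x * (factorial a * z)) (choose-factorial b c) ⟩
    x * (factorial a * factorial (b ℕ.+ c))                   ≡⟨ choose-factorial a (b ℕ.+ c) ⟩
    factorial (a ℕ.+ (b ℕ.+ c))                                   ∎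
    where
    open ≡-Reasoning
    x y : ℤ
    x = choose (a ℕ.+ (b ℕ.+ c)) a
    y = choose (b ℕ.+ c) b
    l₁ : ∀ x y a b c → x * y * (a * b * c) ≡ x * (a * (y * (b * c)))
    l₁ = solve-∀

  trinomial-symmetric : ∀ a b c → choose (a ℕ.+ (b ℕ.+ c)) a * choose (b ℕ.+ c) b ≡ choose (b ℕ.+ (a ℕ.+ c)) b * choose (a ℕ.+ c) a
  trinomial-symmetric a b c = ℤP.*-cancelʳ-≡ _ _ (factorial a * factorial b * factorial c) {{nz}}
    (trans (multinomial a b c) (trans (cong factorial eq) (trans (sym (multinomial b a c))
      (cong (λ z → choose (b ℕ.+ (a ℕ.+ c)) b * choose (a ℕ.+ c) a * z) (l₁ (factorial a) (factorial b) (factorial c))))))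
    where
    instance
      _ = factorial-nonZero a
      _ = factorial-nonZero b
      _ = factorial-nonZero c
    nz : ℤ.NonZero (factorial a * factorial b * factorial c)
    nz = ℤP.i*j≢0 (factorial a * factorial b) (factorial c) {{ℤP.i*j≢0 (factorial a) (factorial b)}}
    l₁ : ∀ a b c → b * a * c ≡ a * b * c
    l₁ = solve-∀
    eq : a ℕ.+ (b ℕ.+ c) ≡ b ℕ.+ (a ℕ.+ c)
    eq = trans (sym (ℕP.+-assoc a b c)) (trans (cong (ℕ._+ c) (ℕP.+-comm a b)) (ℕP.+-assoc b a c))

  -- Both sides count pairs of disjoint subsets of sizes a and b. The case a + b > n, where both
  -- vanish, occurs in `bernoulliPoly-translate`, whose double sum runs over a full square.
  choose-swap : ∀ n a b → a ≤ n → b ≤ n → choose n a * choose (n ∸ a) b ≡ choose n b * choose (n ∸ b) a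
  choose-swap n a b a≤n b≤n with b ℕP.≤? n ∸ a
  ... | yes b≤n-a = subst (λ m → choose m a * choose (m ∸ a) b ≡ choose m b * choose (m ∸ b) a) n≡
        (subst₂ (λ x y → choose (a ℕ.+ (b ℕ.+ c)) a * choose x b ≡ choose (a ℕ.+ (b ℕ.+ c)) b * choose y a)
          (sym (ℕP.m+n∸m≡n a (b ℕ.+ c))) (sym (trans (cong (_∸ b) eq) (ℕP.m+n∸m≡n b (a ℕ.+ c))))
          (trans (trinomial-symmetric a b c) (cong (λ m → choose m b * choose (a ℕ.+ c) a) (sym eq))))
    where
    c : ℕ
    c = n ∸ a ∸ b
    n≡ : a ℕ.+ (b ℕ.+ c) ≡ n
    n≡ = trans (cong (a ℕ.+_) (ℕP.m+[n∸m]≡n b≤n-a)) (ℕP.m+[n∸m]≡n a≤n)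
    eq : a ℕ.+ (b ℕ.+ c) ≡ b ℕ.+ (a ℕ.+ c)
    eq = trans (sym (ℕP.+-assoc a b c)) (trans (cong (ℕ._+ c) (ℕP.+-comm a b)) (ℕP.+-assoc b a c))
  ... | no ≰ = trans (cong (choose n a *_) (choose-> (ℕP.≰⇒> ≰))) (trans (ℤP.*-zeroʳ (choose n a)) (sym
        (trans (cong (choose n b *_) (choose-> n-b<a)) (ℤP.*-zeroʳ (choose n b)))))
    where
    n<a+b : n < a ℕ.+ b
    n<a+b = subst (_< a ℕ.+ b) (ℕP.m+[n∸m]≡n a≤n) (ℕP.+-monoʳ-< a (ℕP.≰⇒> ≰))
    n-b<a : n ∸ b < a
    n-b<a = ℕP.+-cancelʳ-< b (n ∸ b) a (subst (_< a ℕ.+ b) (sym (ℕP.m∸n+n≡m b≤n)) n<a+b)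

  choose-suc-n : ∀ n → choose (suc n) n ≡ + suc n
  choose-suc-n n = begin
    choose (suc n) n                          ≡⟨ l₁ (+ n) (choose (suc n) n) ⟩
    (+ suc n - + n) * choose (suc n) n    ≡⟨ choose-lower n n ⟩
    + suc n * choose n n                    ≡⟨ cong (+ suc n *_) (choose-n-n n) ⟩
    + suc n * + 1                           ≡⟨ ℤP.*-identityʳ (+ suc n) ⟩
    + suc n                                   ∎
    where
    open ≡-Reasoning
    l₁ : ∀ n c → c ≡ (+ 1 + n - n) * c
    l₁ = solve-∀

  choose-sym : ∀ {n k} → k ≤ n → choose n (n ∸ k) ≡ choose n k
  choose-sym {n} {k} k≤n = trans (choose-C n (n ∸ k)) (trans (cong +_ (sym (nCk≡nC[n∸k] k≤n))) (sym (choose-C n k)))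

  -- Arithmetic modulo powers of a prime p > 3.

  module PrimeModulus (r : ℕ) (pr : Prime (4 ℕ.+ r)) where

    -- Writing p as 4 + r builds in p > 3 and makes p - 1 the term `3 ℕ.+ r` by computation.
    p : ℕ
    p = 4 ℕ.+ r

    opaque
      -- Opaque, so that the ring solver meets p as a variable and not as 4 + r.
      P : ℤ
      P = + p

      P≡+p : P ≡ + p
      P≡+p = refl

      P-nonZero : ℤ.NonZero P
      P-nonZero = _

    Unit : ℤ → Set
    Unit a = ¬ Cong P a (+ 0)

    opaque
      unfolding P

      Cong0⇒∣ : ∀ {a} → Cong P a (+ 0) → p ℕD.∣ ∣ a ∣
      Cong0⇒∣ {a} (quot q e) = ℤS.∣⇒∣ᵤ (ℤS.divides q (trans e (lem P q)))
        where
        lem : ∀ P q → + 0 + P * q ≡ q * P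
        lem = solve-∀

      ∣⇒Cong0 : ∀ {a} → p ℕD.∣ ∣ a ∣ → Cong P a (+ 0)
      ∣⇒Cong0 {a} d with ℤS.∣ᵤ⇒∣ {+ p} {a} d
      ... | ℤS.divides q e = quot q (trans e (lem q P))
        where
        lem : ∀ q P → q * P ≡ + 0 + P * q
        lem = solve-∀

    euclid : ∀ a b → Cong P (a * b) (+ 0) → Cong P a (+ 0) ⊎ Cong P b (+ 0)
    euclid a b d = Sum.map ∣⇒Cong0 ∣⇒Cong0
      (euclidsLemma ∣ a ∣ ∣ b ∣ pr (subst (p ℕD.∣_) (ℤP.abs-* a b) (Cong0⇒∣ d)))

    Unit-* : ∀ {a b} → Unit a → Unit b → Unit (a * b)
    Unit-* {a} {b} ua ub d = [ ua , ub ]′ (euclid a b d)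

    Unit-suc : ∀ {k} → suc k < p → Unit (+ suc k)
    Unit-suc k<p d = ℕP.<⇒≱ k<p (ℕD.∣⇒≤ (Cong0⇒∣ d))

    Unit-resp : ∀ {a b} → Cong P a b → Unit a → Unit b
    Unit-resp c ua d = ua (Cong-trans c d)

    Unit-neg : ∀ {a} → Unit a → Unit (- a)
    Unit-neg {a} ua d = ua (Cong-trans (Cong-reflexive (sym (ℤP.neg-involutive a))) (Cong-neg d))

    -- Induction on e: Euclid's lemma yields one factor p of `a`, which is cancelled from the
    -- congruence before the next step.
    cancel-Unit₀ : ∀ e {k a} → Unit k → Cong (P ^ e) (k * a) (+ 0) → Cong (P ^ e) a (+ 0)
    cancel-Unit₀ zero    {k} {a} uk d = quot a (lem a)
      where
      lem : ∀ a → a ≡ + 0 + + 1 * a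
      lem = solve-∀
    cancel-Unit₀ (suc e) {k} {a} uk d with [ (λ c → ⊥-elim (uk c)) , (λ c → c) ]′ (euclid k a (Cong-weaken P (P ^ e) d))
    ... | quot a′ refl = Cong-trans (Cong-reflexive (lem P a′))
        (Cong-trans (Cong-scale P (cancel-Unit₀ e {k} {a′} uk
          (Cong-unscale P {{P-nonZero}} (Cong-trans (Cong-reflexive (lem′ P k a′)) (Cong-trans d (Cong-reflexive (lem″ P)))))))
          (Cong-reflexive (ℤP.*-zeroʳ P)))
      where
      lem : ∀ P a′ → + 0 + P * a′ ≡ P * a′
      lem = solve-∀
      lem′ : ∀ P k a′ → P * (k * a′) ≡ k * (+ 0 + P * a′)
      lem′ = solve-∀
      lem″ : ∀ P → + 0 ≡ P * + 0
      lem″ = solve-∀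

    cancel-Unit : ∀ e {k a b} → Unit k → Cong (P ^ e) (k * a) (k * b) → Cong (P ^ e) a b
    cancel-Unit e {k} {a} {b} uk d = diff⇒Cong (cancel-Unit₀ e {k} {a - b} uk
      (Cong-trans (Cong-reflexive (lem k a b)) (Cong⇒diff d)))
      where
      lem : ∀ k a b → k * (a - b) ≡ k * a - k * b
      lem = solve-∀

    cancel-Unit¹ : ∀ {k a b} → Unit k → Cong P (k * a) (k * b) → Cong P a b
    cancel-Unit¹ uk d = Cong-mod (ℤP.^-identityʳ P) (cancel-Unit 1 uk (Cong-mod (sym (ℤP.^-identityʳ P)) d))

    -- Fermat's theorem and power sums modulo p.

    choose-p : ∀ k → suc k < p → Cong P (choose p (suc k)) (+ 0)
    choose-p k k<p = cancel-Unit¹ (Unit-suc k<p) (Cong-trans (Cong-reflexive (choose-absorb (3 ℕ.+ r) k))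
      (Cong-trans (Cong-reflexive (cong (_* choose (3 ℕ.+ r) k) (sym P≡+p)))
      (Cong-trans (Cong-multiple P (choose (3 ℕ.+ r) k)) (Cong-reflexive (sym (ℤP.*-zeroʳ (+ suc k)))))))

    fermat : ∀ a → Cong P ((+ a) ^ p) (+ a)
    fermat zero    = Cong-refl
    fermat (suc a) = Cong-trans (Cong-reflexive expand) (Cong-trans (Cong-+ (Cong-+ (Cong-refl {i = + 1}) middle) (fermat a))
                       (Cong-reflexive (lem (+ a))))
      where
      open ≡-Reasoning
      f : ℕ → ℤ
      f i = choose p i * (+ a) ^ i
      lem : ∀ a → + 1 + + 0 + a ≡ + 1 + a
      lem = solve-∀
      expand : (+ suc a) ^ p ≡ + 1 + sumZ (3 ℕ.+ r) (f ∘ suc) + (+ a) ^ p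
      expand = begin
        (+ suc a) ^ p                                       ≡⟨ cong (_^ p) (ℤP.+-comm (+ 1) (+ a)) ⟩
        (+ a + + 1) ^ p                                     ≡⟨ binomial-theorem p (suc p) (+ a) (ℕP.n<1+n p) ⟩
        sumZ p f + f p                                      ≡⟨ cong (_+ f p) (sumZ-head (3 ℕ.+ r) f) ⟩
        choose p 0 * + 1 + sumZ (3 ℕ.+ r) (f ∘ suc) + f p   ≡⟨ cong₂ (λ x y → x * + 1 + sumZ (3 ℕ.+ r) (f ∘ suc) + y) (choose-zeroʳ p)
                                                                (trans (cong (_* (+ a) ^ p) (choose-n-n p)) (ℤP.*-identityˡ ((+ a) ^ p))) ⟩
        + 1 + sumZ (3 ℕ.+ r) (f ∘ suc) + (+ a) ^ p          ∎
      middle : Cong P (sumZ (3 ℕ.+ r) (f ∘ suc)) (+ 0)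
      middle = Cong-trans (sumZ-Cong (3 ℕ.+ r) (λ k k<n → Cong-*0ʳ ((+ a) ^ suc k) (choose-p k (s≤s k<n))))
                 (Cong-reflexive (sumZ-zero (3 ℕ.+ r)))

    fermat-unit : ∀ a → Unit (+ a) → Cong P ((+ a) ^ (3 ℕ.+ r)) (+ 1)
    fermat-unit a ua = cancel-Unit¹ ua (Cong-trans (fermat a) (Cong-reflexive (sym (ℤP.*-identityʳ (+ a)))))

    -- The weight C(k,j) keeps the induction on e closed: k C(k,j) = (j+1) C(k,j+1) + j C(k,j)
    -- lowers the exponent and raises j by at most one. At e = 0 the hockey-stick sum is C(p,j+1),
    -- divisible by p because j + 1 < p.
    power-sum : ∀ e j → e ℕ.+ j < 3 ℕ.+ r → Cong P (sumZ p (λ k → (+ k) ^ e * choose k j)) (+ 0)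
    power-sum zero    j j<n = Cong-trans (Cong-reflexive
      (trans (sumZ-cong p (λ k _ → ℤP.*-identityˡ (choose k j))) (hockey-stick p j))) (choose-p j (s≤s j<n))
    power-sum (suc e) j e<n = Cong-trans (Cong-reflexive expand)
      (Cong-trans (Cong-+ (Cong-*0ˡ (+ suc j) (power-sum e (suc j) (subst (_< 3 ℕ.+ r) (sym (ℕP.+-suc e j)) e<n)))
                          (Cong-*0ˡ (+ j) (power-sum e j (ℕP.<-trans (ℕP.n<1+n (e ℕ.+ j)) e<n))))
                  (Cong-refl {i = + 0}))
      where
      open ≡-Reasoning
      f g : ℕ → ℤ
      f k = (+ k) ^ e * choose k (suc j)
      g k = (+ k) ^ e * choose k j
      step : ∀ k → k < p → (+ k) ^ suc e * choose k j ≡ + suc j * f k + + j * g k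
      step k _ = begin
        + k * (+ k) ^ e * choose k j                                           ≡⟨ l₁ (+ k) (+ j) ((+ k) ^ e) (choose k j) ⟩
        (+ k) ^ e * ((+ k - + j) * choose k j) + + j * ((+ k) ^ e * choose k j) ≡⟨ cong (λ z → (+ k) ^ e * z + + j * g k) (sym (choose-raise k j)) ⟩
        (+ k) ^ e * (+ suc j * choose k (suc j)) + + j * g k                   ≡⟨ cong (_+ + j * g k) (l₂ (+ suc j) ((+ k) ^ e) (choose k (suc j))) ⟩
        + suc j * f k + + j * g k                                              ∎
        where
        l₁ : ∀ k j x c → k * x * c ≡ x * ((k - j) * c) + j * (x * c)
        l₁ = solve-∀
        l₂ : ∀ j x c → x * (j * c) ≡ j * (x * c)
        l₂ = solve-∀
      expand : sumZ p (λ k → (+ k) ^ suc e * choose k j) ≡ + suc j * sumZ p f + + j * sumZ p g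
      expand = begin
        sumZ p (λ k → (+ k) ^ suc e * choose k j)                     ≡⟨ sumZ-cong p step ⟩
        sumZ p (λ k → + suc j * f k + + j * g k)                      ≡⟨ sumZ-+ p (λ k → + suc j * f k) (λ k → + j * g k) ⟩
        sumZ p (λ k → + suc j * f k) + sumZ p (λ k → + j * g k)       ≡⟨ cong₂ _+_ (sumZ-*ˡ p (+ suc j) f) (sumZ-*ˡ p (+ j) g) ⟩
        + suc j * sumZ p f + + j * sumZ p g                           ∎

    P²·P : ∀ {a b} → Cong (P ^ 2) a (+ 0) → Cong P b (+ 0) → Cong (P ^ 3) (a * b) (+ 0)
    P²·P ca cb = Cong-mod (lem P) (Cong-**0 ca cb)
      where
      lem : ∀ P → P * (P * + 1) * P ≡ P * (P * (P * + 1))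
      lem = solve-∀

    P³⇒P² : ∀ {a b} → Cong (P ^ 3) a b → Cong (P ^ 2) a b
    P³⇒P² c = Cong-weaken (P ^ 2) P (Cong-mod (lem P) c)
      where
      lem : ∀ P → P * (P * (P * + 1)) ≡ P * (P * + 1) * P
      lem = solve-∀

    P²⇒P : ∀ {a b} → Cong (P ^ 2) a b → Cong P a b
    P²⇒P = Cong-weaken P (P ^ 1)

    PP : ∀ s → Cong (P ^ 2) (P * P * s) (+ 0)
    PP s = quot s (lem P s)
      where
      lem : ∀ P s → P * P * s ≡ + 0 + P * (P * + 1) * s
      lem = solve-∀

    -- Modulo p the g k / p² are s / (k + 1)² ≡ s (k + 1)^(p − 3), so their sum is a power sum.
    sum-of-inverse-squares : ∀ s (g : ℕ → ℤ) →
      (∀ k → suc k < p → Cong (P ^ 3) (+ suc k * + suc k * g k) (P * P * s)) →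
      Cong (P ^ 3) (sumZ (3 ℕ.+ r) g) (+ 0)
    sum-of-inverse-squares s g hyp = Cong-trans (sumZ-Cong (3 ℕ.+ r) (λ k k<n → step k (s≤s k<n)))
      (Cong-trans (Cong-reflexive (sumZ-*ˡ (3 ℕ.+ r) (P * P * s) (λ k → (+ suc k) ^ (1 ℕ.+ r))))
      (P²·P (PP s) (Cong-trans (Cong-reflexive (sym to-power-sum)) (power-sum (1 ℕ.+ r) 0 (s≤s (subst (_< 2 ℕ.+ r) (sym (ℕP.+-identityʳ r)) (ℕP.n≤1+n (suc r))))))))
      where
      open ≡-Reasoning
      to-power-sum : sumZ p (λ k → (+ k) ^ (1 ℕ.+ r) * choose k 0) ≡ sumZ (3 ℕ.+ r) (λ k → (+ suc k) ^ (1 ℕ.+ r))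
      to-power-sum = begin
        sumZ p (λ k → (+ k) ^ (1 ℕ.+ r) * choose k 0)  ≡⟨ sumZ-cong p (λ k _ → trans (cong ((+ k) ^ (1 ℕ.+ r) *_) (choose-zeroʳ k)) (ℤP.*-identityʳ ((+ k) ^ (1 ℕ.+ r)))) ⟩
        sumZ p (λ k → (+ k) ^ (1 ℕ.+ r))               ≡⟨ sumZ-head (3 ℕ.+ r) (λ k → (+ k) ^ (1 ℕ.+ r)) ⟩
        + 0 + sumZ (3 ℕ.+ r) (λ k → (+ suc k) ^ (1 ℕ.+ r))  ≡⟨ ℤP.+-identityˡ (sumZ (3 ℕ.+ r) (λ k → (+ suc k) ^ (1 ℕ.+ r))) ⟩
        sumZ (3 ℕ.+ r) (λ k → (+ suc k) ^ (1 ℕ.+ r))   ∎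
      step : ∀ k → suc k < p → Cong (P ^ 3) (g k) (P * P * s * (+ suc k) ^ (1 ℕ.+ r))
      step k k<p = Cong-trans (Cong-sym one) (Cong-*ʳ x (hyp k k<p))
        where
        k′ x : ℤ
        k′ = + suc k
        x = k′ ^ (1 ℕ.+ r)
        g≡0 : Cong (P ^ 2) (g k) (+ 0)
        g≡0 = cancel-Unit₀ 2 (Unit-* (Unit-suc k<p) (Unit-suc k<p)) (Cong-trans (P³⇒P² (hyp k k<p)) (PP s))
        lem : ∀ k′ x g → k′ * k′ * g * x - g ≡ g * (k′ * (k′ * x) - + 1)
        lem = solve-∀
        one : Cong (P ^ 3) (k′ * k′ * g k * x) (g k)
        one = diff⇒Cong (Cong-trans (Cong-reflexive (lem k′ x (g k))) (P²·P g≡0 (Cong⇒diff (fermat-unit (suc k) (Unit-suc k<p)))))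

    -- Wolstenholme's theorem.

    w-mod-P² : ∀ m k → Cong P (+ suc m) (+ 0) → k < p → Cong (P ^ 2) (w m k) (+ 1)
    w-mod-P² m zero    d k<p = Cong-reflexive (w-zeroʳ m)
    w-mod-P² m (suc k) d k<p = cancel-Unit 2 (Unit-* (Unit-suc k<p) (Unit-suc k<p))
      (Cong-trans (Cong-reflexive (w-step m k))
        (Cong-* (Cong-trans (Cong-- (Cong-refl {i = + suc k * + suc k}) n²) (Cong-reflexive (lem (+ suc k * + suc k))))
                (w-mod-P² m k d (ℕP.<-trans (ℕP.n<1+n k) k<p))))
      where
      n² : Cong (P ^ 2) (+ suc m * + suc m) (+ 0)
      n² = Cong-mod (cong (P *_) (sym (ℤP.^-identityʳ P))) (Cong-**0 d d)
      lem : ∀ x → x - + 0 ≡ x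
      lem = solve-∀

    -- For m + 1 = p s the increment of `w m` from k to k + 1 is -(p s)²/(k + 1)² times `w m k`,
    -- hence ≡ -p² s²/(k + 1)² modulo p³, and these increments add up to zero.
    w-last : ∀ m → Cong P (+ suc m) (+ 0) → Cong (P ^ 3) (w m (3 ℕ.+ r)) (+ 1)
    w-last m d@(quot s e) = Cong-trans (diff⇒Cong (Cong-trans (Cong-reflexive (sym (sumZ-telescope (3 ℕ.+ r) (w m))))
        (sum-of-inverse-squares (- (s * s)) (λ k → w m (suc k) - w m k) step))) (Cong-reflexive (w-zeroʳ m))
      where
      open ≡-Reasoning
      step : ∀ k → suc k < p → Cong (P ^ 3) (+ suc k * + suc k * (w m (suc k) - w m k)) (P * P * (- (s * s)))
      step k k<p = Cong-trans (Cong-reflexive (begin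
        k′ * k′ * (w m (suc k) - w m k)                                  ≡⟨ l₁ k′ (w m (suc k)) (w m k) ⟩
        k′ * k′ * w m (suc k) - k′ * k′ * w m k                          ≡⟨ cong (_- k′ * k′ * w m k) (w-step m k) ⟩
        (k′ * k′ - + suc m * + suc m) * w m k - k′ * k′ * w m k          ≡⟨ cong (λ n → (k′ * k′ - n * n) * w m k - k′ * k′ * w m k) e ⟩
        (k′ * k′ - (+ 0 + P * s) * (+ 0 + P * s)) * w m k - k′ * k′ * w m k ≡⟨ l₂ k′ P s (w m k) ⟩
        P * P * (- (s * s)) + P * P * (- (s * s)) * (w m k - + 1)        ∎))
        (Cong-trans (Cong-+ (Cong-refl {i = P * P * (- (s * s))})
          (P²·P (PP (- (s * s))) (Cong⇒diff (P²⇒P (w-mod-P² m k d (ℕP.<-trans (ℕP.n<1+n k) k<p))))))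
          (Cong-reflexive (ℤP.+-identityʳ (P * P * (- (s * s))))))
        where
        k′ : ℤ
        k′ = + suc k
        l₁ : ∀ k x y → k * k * (x - y) ≡ k * k * x - k * k * y
        l₁ = solve-∀
        l₂ : ∀ k P s w → (k * k - (+ 0 + P * s) * (+ 0 + P * s)) * w - k * k * w ≡ P * P * (- (s * s)) + P * P * (- (s * s)) * (w - + 1)
        l₂ = solve-∀

    sgn-p-1 : sgn (3 ℕ.+ r) ≡ + 1
    sgn-p-1 with sgn-odd (3 ℕ.+ r)
    ... | inj₁ e = e
    ... | inj₂ d with prime⇒irreducible pr d
    ...   | inj₁ ()
    ...   | inj₂ ()

    multiple-of-p : ∀ s → Cong P (+ (s ℕ.* p)) (+ 0)
    multiple-of-p s = Cong-trans (Cong-reflexive (trans (ℤP.pos-* s p) (trans (ℤP.*-comm (+ s) (+ p)) (cong (_* + s) (sym P≡+p))))) (Cong-multiple P (+ s))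

    -- Neighbouring cases are tied together: for m = p - 1 + s p, the product of the coefficients
    -- for s and s + 1 is `w m (3 ℕ.+ r)`, its sign being (-1)^(p-1) = 1, and this is ≡ 1 by
    -- `w-last`.
    wolstenholme : ∀ s → Cong (P ^ 3) (choose (3 ℕ.+ r ℕ.+ s ℕ.* p) (3 ℕ.+ r)) (+ 1)
    wolstenholme zero    = Cong-reflexive (trans (cong (λ z → choose z (3 ℕ.+ r)) (ℕP.+-identityʳ (3 ℕ.+ r))) (choose-n-n (3 ℕ.+ r)))
    wolstenholme (suc s) = Cong-trans (Cong-reflexive (sym (ℤP.*-identityˡ a′))) (Cong-trans (Cong-*ʳ a′ (Cong-sym (wolstenholme s)))
      (Cong-trans (Cong-reflexive eq) (w-last m (multiple-of-p (suc s)))))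
      where
      m : ℕ
      m = 3 ℕ.+ r ℕ.+ s ℕ.* p
      a′ : ℤ
      a′ = choose (3 ℕ.+ r ℕ.+ suc s ℕ.* p) (3 ℕ.+ r)
      eq : choose m (3 ℕ.+ r) * a′ ≡ w m (3 ℕ.+ r)
      eq = trans (cong (λ z → choose m (3 ℕ.+ r) * choose z (3 ℕ.+ r)) (ℕP.+-comm (3 ℕ.+ r) (suc s ℕ.* p)))
        (trans (sym (ℤP.*-identityˡ (choose m (3 ℕ.+ r) * choose (suc m ℕ.+ (3 ℕ.+ r)) (3 ℕ.+ r))))
               (cong (_* (choose m (3 ℕ.+ r) * choose (suc m ℕ.+ (3 ℕ.+ r)) (3 ℕ.+ r))) (sym sgn-p-1)))

    choose-sp-p : ∀ s → Cong (P ^ 3) (choose (s ℕ.* p) p) (+ s)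
    choose-sp-p zero    = Cong-reflexive (choose-> {0} {p} (s≤s z≤n))
    choose-sp-p (suc s) = Cong-trans (Cong-reflexive eq) (Cong-trans (Cong-*ˡ (+ suc s) (wolstenholme s)) (Cong-reflexive (ℤP.*-identityʳ (+ suc s))))
      where
      open ≡-Reasoning
      a : ℤ
      a = choose (3 ℕ.+ r ℕ.+ s ℕ.* p) (3 ℕ.+ r)
      eq : choose (suc s ℕ.* p) p ≡ + suc s * a
      eq = ℤP.*-cancelˡ-≡ (+ p) (choose (suc s ℕ.* p) p) (+ suc s * a) (begin
        + p * choose (suc s ℕ.* p) p   ≡⟨ choose-absorb (3 ℕ.+ r ℕ.+ s ℕ.* p) (3 ℕ.+ r) ⟩
        + (suc s ℕ.* p) * a            ≡⟨ cong (_* a) (ℤP.pos-* (suc s) p) ⟩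
        + suc s * + p * a              ≡⟨ lem (+ suc s) (+ p) a ⟩
        + p * (+ suc s * a)            ∎)
        where
        lem : ∀ s p a → s * p * a ≡ p * (s * a)
        lem = solve-∀

    P^ : ∀ e → P ^ e ≡ + (p ℕ.^ e)
    P^ zero    = refl
    P^ (suc e) = trans (cong₂ _*_ P≡+p (P^ e)) (sym (ℤP.pos-* p (p ℕ.^ e)))

    Unit-1 : Unit (+ 1)
    Unit-1 = Unit-suc (s≤s (s≤s z≤n))

    -- The errors 1 - b c multiply: combining c with Fermat's inverse c₁ = b^(p-2) into c₁ + c - b
    -- c₁ c gives the error (1 - b c₁)(1 - b c), which has one more factor p.
    inverse-mod-P^ : ∀ b → Unit (+ b) → ∀ K → Σ[ c ∈ ℤ ] Cong (P ^ K) (+ 1 - + b * c) (+ 0)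
    inverse-mod-P^ b ub zero    = + 0 , quot (+ 1 - + b * + 0) (lem (+ b))
      where
      lem : ∀ b → + 1 - b * + 0 ≡ + 0 + + 1 * (+ 1 - b * + 0)
      lem = solve-∀
    inverse-mod-P^ b ub (suc K) with inverse-mod-P^ b ub K
    ... | c , e = c₁ + c - + b * c₁ * c , Cong-trans (Cong-reflexive (lem (+ b) c₁ c))
        (Cong-**0 (Cong-trans (Cong-- (Cong-refl {i = + 1}) (fermat-unit b ub)) Cong-refl) e)
      where
      c₁ : ℤ
      c₁ = (+ b) ^ (2 ℕ.+ r)
      lem : ∀ b c₁ c → + 1 - b * (c₁ + c - b * c₁ * c) ≡ (+ 1 - b * c₁) * (+ 1 - b * c)
      lem = solve-∀

    natural-residue : ∀ K v → Σ[ n ∈ ℕ ] Cong (P ^ K) (+ n) v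
    natural-residue K v = v ℤDM.%ℕ p ℕ.^ K , Cong-sym (quot (v ℤDM./ℕ p ℕ.^ K)
      (trans (ℤDM.a≡a%ℕn+[a/ℕn]*n v (p ℕ.^ K)) (cong (λ z → + (v ℤDM.%ℕ p ℕ.^ K) + z)
        (trans (ℤP.*-comm (v ℤDM./ℕ p ℕ.^ K) (+ (p ℕ.^ K))) (cong (_* (v ℤDM./ℕ p ℕ.^ K)) (sym (P^ K)))))))
      where
      instance
        _ = ℕP.m^n≢0 p K

  t-square : ∀ m k → + suc k * + suc k * t (suc m) (suc k) ≡ - (+ suc m * (+ suc m + + suc k)) * w m k
  t-square m k = begin
    k′ * k′ * ((- s) * (choose (suc m) (suc k) * choose (suc m ℕ.+ suc k) (suc k)))
      ≡⟨ l₁ k′ s (choose (suc m) (suc k)) (choose (suc m ℕ.+ suc k) (suc k)) ⟩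
    (- s) * ((k′ * choose (suc m) (suc k)) * (k′ * choose (suc m ℕ.+ suc k) (suc k)))
      ≡⟨ cong₂ (λ x y → (- s) * (x * y)) (choose-absorb m k) (choose-absorb-+ (suc m) k) ⟩
    (- s) * ((n * choose m k) * ((n + k′) * choose (suc m ℕ.+ k) k))
      ≡⟨ l₂ n k′ s (choose m k) (choose (suc m ℕ.+ k) k) ⟩
    - (n * (n + k′)) * w m k ∎
    where
    open ≡-Reasoning
    k′ n s : ℤ
    k′ = + suc k
    n = + suc m
    s = sgn k
    l₁ : ∀ k s x y → k * k * ((- s) * (x * y)) ≡ (- s) * ((k * x) * (k * y))
    l₁ = solve-∀
    l₂ : ∀ n k s x y → (- s) * ((n * x) * ((n + k) * y)) ≡ - (n * (n + k)) * (s * (x * y))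
    l₂ = solve-∀

  -- The truncated sum `Y` modulo p³ and its recursion in n.

  module TruncatedSum (r : ℕ) (pr : Prime (4 ℕ.+ r)) where
    open PrimeModulus r pr

    P-Cong-0 : Cong P P (+ 0)
    P-Cong-0 = quot (+ 1) (lem P)
      where
      lem : ∀ P → P ≡ + 0 + P * + 1
      lem = solve-∀

    p-Cong-0 : Cong P (+ p) (+ 0)
    p-Cong-0 = Cong-trans (Cong-reflexive (sym P≡+p)) P-Cong-0

    Unit-P- : ∀ {k} → suc k < p → Unit (P - + suc k)
    Unit-P- {k} k<p = Unit-resp (Cong-sym (Cong-trans (Cong-- P-Cong-0 (Cong-refl {i = + suc k})) (Cong-reflexive (ℤP.+-identityˡ (- + suc k)))))
      (Unit-neg (Unit-suc k<p))

    -- The left side equals p times `w (3 ℕ.+ r) k` exactly. There m + 1 = p, so `w` is ≡ 1 modulo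
    -- p², and the factor p supplies the third power.
    t-p : ∀ k → k < p → Cong (P ^ 3) ((P - + k) * t p k) P
    t-p k k<p = Cong-trans (Cong-reflexive (trans (cong (λ z → (z - + k) * t p k) P≡+p) (trans (t-lower (3 ℕ.+ r) k) (cong (_* w (3 ℕ.+ r) k) (sym P≡+p)))))
      (Cong-trans (Cong-scale P (w-mod-P² (3 ℕ.+ r) k p-Cong-0 k<p)) (Cong-reflexive (ℤP.*-identityʳ P)))

    Y : ℕ → ℤ
    Y n = sumZ p (λ k → t p k * t n k)

    -- This is the end term of the telescoping sum in `Y-step-unit`, where a further factor p stands
    -- in front. Each of its binomial coefficients is divisible by p: multiplied by the unit m + 1,
    -- they become p C(m+1,p) and p C(m+p,p).
    w-last-unit : ∀ m → Unit (+ suc m) → Cong (P ^ 2) (w m (3 ℕ.+ r)) (+ 0)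
    w-last-unit m un = Cong-*0ˡ (sgn (3 ℕ.+ r)) (Cong-mod (cong (P *_) (sym (ℤP.^-identityʳ P))) (Cong-**0 c₁ c₂))
      where
      cancel : ∀ {x y} → + suc m * x ≡ + p * y → Cong P x (+ 0)
      cancel {x} {y} e = cancel-Unit¹ un (Cong-trans (Cong-reflexive e) (Cong-trans (Cong-*0ʳ y p-Cong-0) (Cong-reflexive (sym (ℤP.*-zeroʳ (+ suc m))))))
      c₁ : Cong P (choose m (3 ℕ.+ r)) (+ 0)
      c₁ = cancel {y = choose (suc m) p} (sym (choose-absorb m (3 ℕ.+ r)))
      c₂ : Cong P (choose (suc m ℕ.+ (3 ℕ.+ r)) (3 ℕ.+ r)) (+ 0)
      c₂ = cancel {y = choose (suc m ℕ.+ (3 ℕ.+ r)) p}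
        (trans (cong (_* choose (suc m ℕ.+ (3 ℕ.+ r)) (3 ℕ.+ r)) (lem (+ suc m) (+ (3 ℕ.+ r)))) (sym (choose-raise (suc m ℕ.+ (3 ℕ.+ r)) (3 ℕ.+ r))))
        where
        lem : ∀ m k → m ≡ m + k - k
        lem = solve-∀

    Y-step-unit : ∀ m → Unit (+ suc m) → Cong (P ^ 3) ((+ suc m - P) * Y (suc m)) ((+ suc m + P) * Y m)
    Y-step-unit m un = diff⇒Cong (Cong-trans (Cong-reflexive (begin
        (n - P) * Y (suc m) - (n + P) * Y m
          ≡⟨ sumZ-lincomb p (n - P) (n + P) (λ k → t p k * t (suc m) k) (λ k → t p k * t m k) ⟨
        sumZ p (λ k → (n - P) * (t p k * t (suc m) k) - (n + P) * (t p k * t m k))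
          ≡⟨ sumZ-cong p (λ k _ → step k) ⟩
        sumZ p (λ k → - + 2 * ((P - + k) * t p k * u m k)) ∎))
      (Cong-trans (sumZ-Cong p (λ k k<p → Cong-*ˡ (- + 2) (Cong-*ʳ (u m k) (t-p k k<p))))
      (Cong-trans (Cong-reflexive (begin
        sumZ p (λ k → - + 2 * (P * u m k))   ≡⟨ sumZ-*ˡ p (- + 2) (λ k → P * u m k) ⟩
        - + 2 * sumZ p (λ k → P * u m k)     ≡⟨ cong (- + 2 *_) (sumZ-*ˡ p P (u m)) ⟩
        - + 2 * (P * sumZ p (u m))           ≡⟨ cong (λ z → - + 2 * (P * z)) (u-sum m (3 ℕ.+ r)) ⟩
        - + 2 * (P * w m (3 ℕ.+ r))          ∎))
      (Cong-*0ˡ (- + 2) (Cong-trans (Cong-scale P (w-last-unit m un)) (Cong-reflexive (ℤP.*-zeroʳ P)))))))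
      where
      open ≡-Reasoning
      n : ℤ
      n = + suc m
      step : ∀ k → (n - P) * (t p k * t (suc m) k) - (n + P) * (t p k * t m k) ≡ - + 2 * ((P - + k) * t p k * u m k)
      step k = begin
        (n - P) * (t p k * t (suc m) k) - (n + P) * (t p k * t m k)  ≡⟨ l₁ (n - P) (n + P) (t p k) (t (suc m) k) (t m k) ⟩
        t p k * ((n - P) * t (suc m) k - (n + P) * t m k)            ≡⟨ cong (t p k *_) (t-rec P m k) ⟩
        t p k * (+ 2 * (+ k - P) * u m k)                            ≡⟨ l₂ P (+ k) (t p k) (u m k) ⟩
        - + 2 * ((P - + k) * t p k * u m k)                          ∎
        where
        l₁ : ∀ a b c x y → a * (c * x) - b * (c * y) ≡ c * (a * x - b * y)
        l₁ = solve-∀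
        l₂ : ∀ P k c u → c * (+ 2 * (k - P) * u) ≡ - + 2 * ((P - k) * c * u)
        l₂ = solve-∀

    -- If (p − k) y ≡ − p² s k modulo p³ then p² divides y, and the term p y drops out.
    solve-inverse-square : ∀ {k} → suc k < p → ∀ s y →
      Cong (P ^ 3) ((P - + suc k) * y) (- (P * P * s)) → Cong (P ^ 3) (+ suc k * y) (P * P * s)
    solve-inverse-square {k} k<p s y c =
      Cong-trans (Cong-reflexive (l₁ P (+ suc k) y))
      (Cong-trans (Cong-- Py c) (Cong-reflexive (l₂ (P * P * s))))
      where
      y≡0 : Cong (P ^ 2) y (+ 0)
      y≡0 = cancel-Unit₀ 2 (Unit-P- k<p) (Cong-trans (P³⇒P² c) (Cong-neg (PP s)))
      Py : Cong (P ^ 3) (P * y) (+ 0)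
      Py = Cong-trans (Cong-scale P y≡0) (Cong-reflexive (ℤP.*-zeroʳ P))
      l₁ : ∀ P k y → k * y ≡ P * y - (P - k) * y
      l₁ = solve-∀
      l₂ : ∀ x → + 0 - (- x) ≡ x
      l₂ = solve-∀

    -- Here n ± p is divisible by p, so the two sums are compared term by term. With n = m + 1 = p
    -- s, to leading order `t p k` is -p/k and the increment of `t` in n is -2 p s/k, which gives
    -- the differences 2 p² s/k²; the term k = 0 does not change.
    Y-step-multiple : ∀ m → Cong P (+ suc m) (+ 0) → Cong (P ^ 3) (Y (suc m)) (Y m)
    Y-step-multiple m d@(quot s e) = diff⇒Cong (Cong-trans (Cong-reflexive expand) (sum-of-inverse-squares (+ 2 * s) (λ k → t p (suc k) * Δ (suc k)) hyp))
      where
      open ≡-Reasoning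
      Δ : ℕ → ℤ
      Δ k = t (suc m) k - t m k
      l₀ : ∀ c x y → c * x - c * y ≡ c * (x - y)
      l₀ = solve-∀
      expand : Y (suc m) - Y m ≡ sumZ (3 ℕ.+ r) (λ k → t p (suc k) * Δ (suc k))
      expand = begin
        Y (suc m) - Y m
          ≡⟨ cong₂ _-_ (sym (ℤP.*-identityˡ (Y (suc m)))) (sym (ℤP.*-identityˡ (Y m))) ⟩
        + 1 * Y (suc m) - + 1 * Y m
          ≡⟨ sumZ-lincomb p (+ 1) (+ 1) (λ k → t p k * t (suc m) k) (λ k → t p k * t m k) ⟨
        sumZ p (λ k → + 1 * (t p k * t (suc m) k) - + 1 * (t p k * t m k))
          ≡⟨ sumZ-cong p (λ k _ → trans (cong₂ _-_ (ℤP.*-identityˡ (t p k * t (suc m) k)) (ℤP.*-identityˡ (t p k * t m k))) (l₀ (t p k) (t (suc m) k) (t m k))) ⟩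
        sumZ p (λ k → t p k * Δ k)
          ≡⟨ sumZ-head (3 ℕ.+ r) (λ k → t p k * Δ k) ⟩
        t p 0 * Δ 0 + sumZ (3 ℕ.+ r) (λ k → t p (suc k) * Δ (suc k))
          ≡⟨ cong (_+ sumZ (3 ℕ.+ r) (λ k → t p (suc k) * Δ (suc k))) (trans (cong (t p 0 *_) (cong₂ _-_ (t-zeroʳ (suc m)) (t-zeroʳ m))) (ℤP.*-zeroʳ (t p 0))) ⟩
        + 0 + sumZ (3 ℕ.+ r) (λ k → t p (suc k) * Δ (suc k))
          ≡⟨ ℤP.+-identityˡ (sumZ (3 ℕ.+ r) (λ k → t p (suc k) * Δ (suc k))) ⟩
        sumZ (3 ℕ.+ r) (λ k → t p (suc k) * Δ (suc k)) ∎
      hyp : ∀ k → suc k < p → Cong (P ^ 3) (+ suc k * + suc k * (t p (suc k) * Δ (suc k))) (P * P * (+ 2 * s))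
      hyp k k<p = Cong-trans (Cong-reflexive (l₁ k′ (t p (suc k) * Δ (suc k))))
        (solve-inverse-square k<p (+ 2 * s) (k′ * (t p (suc k) * Δ (suc k)))
        (Cong-trans (Cong-reflexive (begin
          (P - k′) * (k′ * (t p (suc k) * Δ (suc k)))          ≡⟨ l₂ (P - k′) k′ (t p (suc k)) (Δ (suc k)) ⟩
          (P - k′) * t p (suc k) * (k′ * Δ (suc k))            ≡⟨ cong ((P - k′) * t p (suc k) *_) (trans (t-diff m k) (cong (λ n → - + 2 * n * w m k) e)) ⟩
          (P - k′) * t p (suc k) * (- + 2 * (+ 0 + P * s) * w m k) ∎))
        (Cong-trans (Cong-*ʳ (- + 2 * (+ 0 + P * s) * w m k) (t-p (suc k) k<p))
        (Cong-trans (Cong-reflexive (l₃ P s (w m k)))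
        (Cong-trans (Cong-+ (Cong-refl {i = - (P * P * (+ 2 * s))}) (P²·P (PP (- (+ 2 * s))) (Cong⇒diff (P²⇒P (w-mod-P² m k d (ℕP.<-trans (ℕP.n<1+n k) k<p))))))
          (Cong-reflexive (ℤP.+-identityʳ (- (P * P * (+ 2 * s))))))))))
        where
        k′ : ℤ
        k′ = + suc k
        l₁ : ∀ k x → k * k * x ≡ k * (k * x)
        l₁ = solve-∀
        l₂ : ∀ a k c x → a * (k * (c * x)) ≡ a * c * (k * x)
        l₂ = solve-∀
        l₃ : ∀ P s w → P * (- + 2 * (+ 0 + P * s) * w) ≡ - (P * P * (+ 2 * s)) + P * P * (- (+ 2 * s)) * (w - + 1)
        l₃ = solve-∀

    Y-head : ∀ n → Y n ≡ + 1 + sumZ (3 ℕ.+ r) (λ k → t p (suc k) * t n (suc k))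
    Y-head n = trans (sumZ-head (3 ℕ.+ r) (λ k → t p k * t n k))
      (cong (_+ sumZ (3 ℕ.+ r) (λ k → t p (suc k) * t n (suc k))) (cong₂ _*_ (t-zeroʳ p) (t-zeroʳ n)))

    Y-zero : Y 0 ≡ + 1
    Y-zero = trans (Y-head 0) (cong (λ z → + 1 + z) (trans (sumZ-cong (3 ℕ.+ r) (λ k _ →
      trans (cong (t p (suc k) *_) (t-zeroˡ k)) (ℤP.*-zeroʳ (t p (suc k))))) (sumZ-zero (3 ℕ.+ r))))

    -- Starting value for the induction in `Y-choose`. For n = p s both `t p k` and `t n k` are
    -- divisible by p when 0 < k < p, with product ≡ p² s/k², so only the term k = 0 survives the
    -- summation.
    Y-multiple : ∀ n → Cong P (+ n) (+ 0) → Cong (P ^ 3) (Y n) (+ 1)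
    Y-multiple zero    d = Cong-reflexive Y-zero
    Y-multiple (suc m) d@(quot s e) = Cong-trans (Cong-reflexive (Y-head (suc m)))
      (Cong-+ (Cong-refl {i = + 1}) (sum-of-inverse-squares s (λ k → t p (suc k) * t (suc m) (suc k)) hyp))
      where
      open ≡-Reasoning
      hyp : ∀ k → suc k < p → Cong (P ^ 3) (+ suc k * + suc k * (t p (suc k) * t (suc m) (suc k))) (P * P * s)
      hyp k k<p = cancel-Unit 3 (Unit-suc k<p)
        (Cong-trans (solve-inverse-square k<p (s * k′) (k′ * k′ * (t p (suc k) * t (suc m) (suc k)))
        (Cong-trans (Cong-reflexive (begin
          (P - k′) * (k′ * k′ * (t p (suc k) * t (suc m) (suc k)))   ≡⟨ l₁ (P - k′) k′ (t p (suc k)) (t (suc m) (suc k)) ⟩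
          (P - k′) * t p (suc k) * (k′ * k′ * t (suc m) (suc k))     ≡⟨ cong ((P - k′) * t p (suc k) *_) (trans (t-square m k) (cong (λ n → - (n * (n + k′)) * w m k) e)) ⟩
          (P - k′) * t p (suc k) * x                                 ∎))
        (Cong-trans (Cong-*ʳ x (t-p (suc k) k<p))
        (Cong-trans (Cong-reflexive (l₂ P s k′ (w m k)))
        (Cong-trans (Cong-+ (Cong-+ (Cong-refl {i = - (P * P * (s * k′))})
            (P²·P (PP (- (s * k′))) (Cong⇒diff (P²⇒P (w-mod-P² m k d (ℕP.<-trans (ℕP.n<1+n k) k<p))))))
            (P²·P (PP (- (s * s * w m k))) P-Cong-0))
          (Cong-reflexive (l₃ (- (P * P * (s * k′)))))))))) (Cong-reflexive (l₄ P s k′)))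
        where
        k′ x : ℤ
        k′ = + suc k
        x = - ((+ 0 + P * s) * ((+ 0 + P * s) + k′)) * w m k
        l₁ : ∀ a k c x → a * (k * k * (c * x)) ≡ a * c * (k * k * x)
        l₁ = solve-∀
        l₂ : ∀ P s k w → P * (- ((+ 0 + P * s) * ((+ 0 + P * s) + k)) * w) ≡ - (P * P * (s * k)) + P * P * (- (s * k)) * (w - + 1) + P * P * (- (s * s * w)) * P
        l₂ = solve-∀
        l₃ : ∀ x → x + + 0 + + 0 ≡ x
        l₃ = solve-∀
        l₄ : ∀ P s k → P * P * (s * k) ≡ k * (P * P * s)
        l₄ = solve-∀

    -- Powers with exponent φ(p³), and the harmonic sums `H`.

    N : ℕ
    N = p ℕ.* p ℕ.* (3 ℕ.+ r)

    -- In a^p - 1 = (a - 1)(1 + a + ... + a^(p-1)) the first factor is divisible by `M` and the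
    -- second is ≡ p ≡ 0 modulo p. With `M` arbitrary, `euler` climbs from p to p² and from p² to p³
    -- by the same lemma.
    raise-p : ∀ M a → Cong P a (+ 1) → Cong M a (+ 1) → Cong (M * P) (a ^ p) (+ 1)
    raise-p M a c₁ c = diff⇒Cong (Cong-trans (Cong-reflexive (sym (geometric-sum a p)))
      (Cong-**0 (Cong⇒diff c) (Cong-trans (sumZ-Cong p (λ i _ → Cong-trans (Cong-^ i c₁) (Cong-reflexive (one-^ i))))
        (Cong-trans (Cong-reflexive (sumZ-one p)) p-Cong-0))))

    euler : ∀ n → Unit (+ n) → Cong (P ^ 3) ((+ n) ^ N) (+ 1)
    euler n un = Cong-mod (l₁ P) (Cong-trans (Cong-reflexive (sym pow)) (raise-p (P * P) (((+ n) ^ (3 ℕ.+ r)) ^ p) (Cong-weaken P P c₂) c₂))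
      where
      c₁ : Cong P ((+ n) ^ (3 ℕ.+ r)) (+ 1)
      c₁ = fermat-unit n un
      c₂ : Cong (P * P) (((+ n) ^ (3 ℕ.+ r)) ^ p) (+ 1)
      c₂ = raise-p P ((+ n) ^ (3 ℕ.+ r)) c₁ c₁
      l₁ : ∀ P → P * P * P ≡ P * (P * (P * + 1))
      l₁ = solve-∀
      pow : (((+ n) ^ (3 ℕ.+ r)) ^ p) ^ p ≡ (+ n) ^ N
      pow = trans (ℤP.^-*-assoc ((+ n) ^ (3 ℕ.+ r)) p p) (trans (ℤP.^-*-assoc (+ n) (3 ℕ.+ r) (p ℕ.* p)) (cong ((+ n) ^_) (ℕP.*-comm (3 ℕ.+ r) (p ℕ.* p))))

    H : ℕ → ℤ
    H n = sumZ (suc n) (λ j → (+ j) ^ ℕ.pred N)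

    quadratic : ℤ → ℤ
    quadratic x = + 1 + + 2 * P * x + + 2 * P * P * (x * x)

    multiple-of-p? : ∀ n → Dec (Cong P (+ n) (+ 0))
    multiple-of-p? n = Dec.map′ ∣⇒Cong0 Cong0⇒∣ (p ℕD.∣? n)

    Y-Cong-quadratic : ∀ n → Cong (P ^ 3) (Y n) (quadratic (H n))
    Y-Cong-quadratic zero    = Cong-reflexive (trans Y-zero (sym (lem P)))
      where
      lem : ∀ P → + 1 + + 2 * P * + 0 + + 2 * P * P * (+ 0 * + 0) ≡ + 1
      lem = solve-∀
    Y-Cong-quadratic (suc m) with multiple-of-p? (suc m)
    ... | yes d = Cong-trans (Y-step-multiple m d) (Cong-trans (Y-Cong-quadratic m) (Cong-sym (diff⇒Cong
          (Cong-trans (Cong-reflexive (lem P (H m) h)) (Cong-*0ˡ (+ 2 + + 2 * P * (+ 2 * H m + h)) (P²·P h≡0 P-Cong-0))))))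
      where
      h : ℤ
      h = (+ suc m) ^ ℕ.pred N
      -- As p = 4 + r, computation shows N - 1 ≥ 2, and `h` unfolds to n · n · n^rest. Divisibility
      -- by p² is enough, since `H` enters the quadratic only with a factor p.
      rest : ℕ
      rest = ℕ.pred (ℕ.pred (ℕ.pred N))
      h≡0 : Cong (P ^ 2) h (+ 0)
      h≡0 = Cong-mod (cong (P *_) (sym (ℤP.^-identityʳ P))) (Cong-trans (Cong-reflexive (sym (ℤP.*-assoc (+ suc m) (+ suc m) ((+ suc m) ^ rest))))
        (Cong-*0ʳ ((+ suc m) ^ rest) (Cong-**0 d d)))
      lem : ∀ P H h → + 1 + + 2 * P * (H + h) + + 2 * P * P * ((H + h) * (H + h)) - (+ 1 + + 2 * P * H + + 2 * P * P * (H * H)) ≡ (+ 2 + + 2 * P * (+ 2 * H + h)) * (h * P)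
      lem = solve-∀
    ... | no un = cancel-Unit 3 (Unit-resp (Cong-sym (Cong-trans (Cong-- (Cong-refl {i = n}) P-Cong-0) (Cong-reflexive (ℤP.+-identityʳ n)))) un)
          (Cong-trans (Y-step-unit m un) (Cong-trans (Cong-*ˡ (n + P) (Y-Cong-quadratic m)) (Cong-sym (diff⇒Cong
            -- The two sides of the recursion differ by a multiple of n h - 1, which is n^N - 1 and
            -- vanishes modulo p³ by `euler`, plus a multiple of p³.
            (Cong-trans (Cong-reflexive (lem n P (H m) h))
              (Cong-+ (Cong-*0ˡ (+ 2 * P + P * P * (+ 4 * H m + + 2 * h)) (Cong⇒diff (euler (suc m) un)))
                      (Cong-*0ʳ (- + 4 * H m * H m - + 4 * H m * h - + 2 * h * h) PPP)))))))
      where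
      n h : ℤ
      n = + suc m
      h = (+ suc m) ^ ℕ.pred N
      PPP : Cong (P ^ 3) (P * P * P) (+ 0)
      PPP = quot (+ 1) (l P)
        where
        l : ∀ P → P * P * P ≡ + 0 + P * (P * (P * + 1)) * + 1
        l = solve-∀
      lem : ∀ n P H h → (n - P) * (+ 1 + + 2 * P * (H + h) + + 2 * P * P * ((H + h) * (H + h))) - (n + P) * (+ 1 + + 2 * P * H + + 2 * P * P * (H * H))
        ≡ (+ 2 * P + P * P * (+ 4 * H + + 2 * h)) * (n * h - + 1) + P * P * P * (- + 4 * H * H - + 4 * H * h - + 2 * h * h)
      lem = solve-∀

    choose-2p : Cong (P ^ 3) (choose (p ℕ.+ p) p) (+ 2)
    choose-2p = Cong-trans (Cong-reflexive (cong (λ z → choose (p ℕ.+ z) p) (sym (ℕP.+-identityʳ p)))) (choose-sp-p 2)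

    t-pp : Cong (P ^ 3) (t p p) (sgn p * + 2)
    t-pp = Cong-*ˡ (sgn p) (Cong-trans (Cong-reflexive (trans (cong (_* choose (p ℕ.+ p) p) (choose-n-n p)) (ℤP.*-identityˡ (choose (p ℕ.+ p) p)))) choose-2p)

    -- Only the term k = p lies outside `Y`. Its two signs cancel, and the coefficient 2 comes from
    -- `t p p`, which is C(2p,p) up to sign.
    V-Cong : ∀ n → Cong (P ^ 3) (sumZ (suc p) (λ k → t p k * t n k))
      (+ 1 + + 2 * (choose n p * choose (n ℕ.+ p) p) + + 2 * P * H n + + 2 * P * P * (H n * H n))
    V-Cong n = Cong-trans (Cong-+ (Y-Cong-quadratic n) (Cong-*ʳ (t n p) t-pp))
      (Cong-reflexive (trans (l₁ P (H n) (sgn p) g) (trans (cong (λ z → quadratic (H n) + z * + 2 * g) (sgn² p)) (l₂ P (H n) g))))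
      where
      g : ℤ
      g = choose n p * choose (n ℕ.+ p) p
      l₁ : ∀ P H s g → + 1 + + 2 * P * H + + 2 * P * P * (H * H) + s * + 2 * (s * g) ≡ + 1 + + 2 * P * H + + 2 * P * P * (H * H) + s * s * + 2 * g
      l₁ = solve-∀
      l₂ : ∀ P H g → + 1 + + 2 * P * H + + 2 * P * P * (H * H) + + 1 * + 2 * g ≡ + 1 + + 2 * g + + 2 * P * H + + 2 * P * P * (H * H)
      l₂ = solve-∀

-- Integers inside the rationals, and finite sums of rationals.

module RationalFunctions where
  open IntegerCongruences
  open import Data.Rational using (mkℚ; _+_; _*_; _-_; -_; 0ℚ; 1ℚ; toℚᵘ; ↥_; ↧_; ↧ₙ_)
  import Data.Rational.Properties as ℚP
  open import Data.Rational.Unnormalised as ℚᵘ using (mkℚᵘ; *≡*)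
  import Data.Rational.Unnormalised.Properties as ℚᵘP
  open import Tactic.RingSolver using (solve-∀)
  import Tactic.RingSolver.Core.AlmostCommutativeRing as ACR

  ringℚ : ACR.AlmostCommutativeRing 0ℓ 0ℓ
  ringℚ = ACR.fromCommutativeRing ℚP.+-*-commutativeRing (λ x → Dec.dec⇒maybe (0ℚ ℚP.≟ x))

  opaque
    ι : ℤ → ℚ
    ι a = a ℚ./ 1

    ι-ℕ : ∀ n → ℕ→ℚ n ≡ ι (+ n)
    ι-ℕ n = refl

    ι-toℚᵘ : ∀ a → toℚᵘ (ι a) ℚᵘ.≃ mkℚᵘ a 0
    ι-toℚᵘ a = ℚP.toℚᵘ-fromℚᵘ (mkℚᵘ a 0)

    ι-0 : ι (+ 0) ≡ 0ℚ
    ι-0 = refl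

    ι-1 : ι (+ 1) ≡ 1ℚ
    ι-1 = refl

  ι-+ : ∀ a b → ι (a ℤ.+ b) ≡ ι a + ι b
  ι-+ a b = ℚP.toℚᵘ-injective (ℚᵘP.≃-trans (ι-toℚᵘ (a ℤ.+ b)) (ℚᵘP.≃-trans (*≡* (lem a b))
    (ℚᵘP.≃-sym (ℚᵘP.≃-trans (ℚP.toℚᵘ-homo-+ (ι a) (ι b)) (ℚᵘP.+-cong (ι-toℚᵘ a) (ι-toℚᵘ b))))))
    where
    lem : ∀ a b → (a ℤ.+ b) ℤ.* + 1 ≡ (a ℤ.* + 1 ℤ.+ b ℤ.* + 1) ℤ.* + 1
    lem = ℤSolver.solve-∀

  ι-* : ∀ a b → ι (a ℤ.* b) ≡ ι a * ι b
  ι-* a b = ℚP.toℚᵘ-injective (ℚᵘP.≃-trans (ι-toℚᵘ (a ℤ.* b)) (ℚᵘP.≃-trans (*≡* refl)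
    (ℚᵘP.≃-sym (ℚᵘP.≃-trans (ℚP.toℚᵘ-homo-* (ι a) (ι b)) (ℚᵘP.*-cong (ι-toℚᵘ a) (ι-toℚᵘ b))))))

  ι-neg : ∀ a → ι (ℤ.- a) ≡ - ι a
  ι-neg a = begin
    ι (ℤ.- a)                       ≡⟨ l₁ (ι (ℤ.- a)) (ι a) ⟩
    ι (ℤ.- a) + ι a - ι a           ≡⟨ cong (_- ι a) (ι-+ (ℤ.- a) a) ⟨
    ι (ℤ.- a ℤ.+ a) - ι a           ≡⟨ cong (λ z → ι z - ι a) (ℤP.+-inverseˡ a) ⟩
    ι (+ 0) - ι a                   ≡⟨ cong (_- ι a) ι-0 ⟩
    0ℚ - ι a                        ≡⟨ ℚP.+-identityˡ (- ι a) ⟩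
    - ι a                           ∎
    where
    open ≡-Reasoning
    l₁ : ∀ x y → x ≡ x + y - y
    l₁ = solve-∀ ringℚ

  ι-- : ∀ a b → ι (a ℤ.- b) ≡ ι a - ι b
  ι-- a b = trans (ι-+ a (ℤ.- b)) (cong (λ z → ι a + z) (ι-neg b))

  ι-injective : ∀ {a b} → ι a ≡ ι b → a ≡ b
  ι-injective {a} {b} e with ℚᵘP.≃-trans (ℚᵘP.≃-sym (ι-toℚᵘ a)) (ℚᵘP.≃-trans (ℚP.toℚᵘ-cong e) (ι-toℚᵘ b))
  ... | *≡* e′ = trans (sym (ℤP.*-identityʳ a)) (trans e′ (ℤP.*-identityʳ b))

  numerator-denominator : ∀ x → x * ι (↧ x) ≡ ι (↥ x)
  numerator-denominator x@(mkℚ n d c) = ℚP.toℚᵘ-injective (ℚᵘP.≃-trans (ℚP.toℚᵘ-homo-* x (ι (+ suc d)))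
    (ℚᵘP.≃-trans (ℚᵘP.*-cong {mkℚᵘ n d} {mkℚᵘ n d} (ℚᵘP.≃-refl {mkℚᵘ n d}) (ι-toℚᵘ (+ suc d)))
    (ℚᵘP.≃-trans (*≡* (trans (lem n (+ suc d)) (cong (λ z → n ℤ.* z) (lem′ d)))) (ℚᵘP.≃-sym (ι-toℚᵘ n)))))
    where
    lem : ∀ n d → n ℤ.* d ℤ.* + 1 ≡ n ℤ.* (d ℤ.* + 1)
    lem = ℤSolver.solve-∀
    lem′ : ∀ d → + suc d ℤ.* + 1 ≡ + (suc d ℕ.* 1)
    lem′ d = sym (ℤP.pos-* (suc d) 1)

  opaque
    unfolding ι

    recip-inverse : ∀ n → recipℕ (suc n) * ι (+ suc n) ≡ 1ℚ
    recip-inverse n = ℚP.toℚᵘ-injective (ℚᵘP.≃-trans (ℚP.toℚᵘ-homo-* (recipℕ (suc n)) (ι (+ suc n)))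
      (ℚᵘP.≃-trans (ℚᵘP.*-cong (ℚP.toℚᵘ-fromℚᵘ (mkℚᵘ (+ 1) n)) (ι-toℚᵘ (+ suc n)))
      (*≡* (trans (lem (+ suc n)) (cong (λ z → + 1 ℤ.* z) (sym (ℤP.pos-* (suc n) 1)))))))
      where
      lem : ∀ d → + 1 ℤ.* d ℤ.* + 1 ≡ + 1 ℤ.* (d ℤ.* + 1)
      lem = ℤSolver.solve-∀

  recip-inverse′ : ∀ n .{{_ : ℕ.NonZero n}} → recipℕ n * ι (+ n) ≡ 1ℚ
  recip-inverse′ (suc n) = recip-inverse n

  *-cancelʳ-ι : ∀ n .{{_ : ℕ.NonZero n}} {x y} → x * ι (+ n) ≡ y * ι (+ n) → x ≡ y
  *-cancelʳ-ι n {x} {y} e = trans (sym (undo x)) (trans (cong (_* recipℕ n) e) (undo y))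
    where
    lem : ∀ x a b → x * a * b ≡ x * (b * a)
    lem = solve-∀ ringℚ
    undo : ∀ x → x * ι (+ n) * recipℕ n ≡ x
    undo x = trans (lem x (ι (+ n)) (recipℕ n)) (trans (cong (x *_) (recip-inverse′ n)) (ℚP.*-identityʳ x))

  divide-ι : ∀ n .{{_ : ℕ.NonZero n}} {x y} → x ≡ y * ι (+ n) → x * recipℕ n ≡ y
  divide-ι n {x} {y} e = *-cancelʳ-ι n (trans (lem x (recipℕ n) (ι (+ n))) (trans (cong (x *_) (recip-inverse′ n)) (trans (ℚP.*-identityʳ x) e)))
    where
    lem : ∀ x a b → x * a * b ≡ x * (a * b)
    lem = solve-∀ ringℚ

  sumQ-cong : ∀ n {f g : ℕ → ℚ} → (∀ k → k < n → f k ≡ g k) → sumQ n f ≡ sumQ n g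
  sumQ-cong zero    e = refl
  sumQ-cong (suc n) e = cong₂ _+_ (sumQ-cong n (λ k k<n → e k (ℕP.m<n⇒m<1+n k<n))) (e n (ℕP.n<1+n n))

  sumQ-zero : ∀ n → sumQ n (λ _ → 0ℚ) ≡ 0ℚ
  sumQ-zero zero    = refl
  sumQ-zero (suc n) = trans (ℚP.+-identityʳ (sumQ n (λ _ → 0ℚ))) (sumQ-zero n)

  sumQ-+ : ∀ n (f g : ℕ → ℚ) → sumQ n (λ k → f k + g k) ≡ sumQ n f + sumQ n g
  sumQ-+ zero    f g = refl
  sumQ-+ (suc n) f g = trans (cong (λ z → z + (f n + g n)) (sumQ-+ n f g)) (lem (sumQ n f) (sumQ n g) (f n) (g n))
    where
    lem : ∀ a b c d → a + b + (c + d) ≡ a + c + (b + d)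
    lem = solve-∀ ringℚ

  sumQ-*ˡ : ∀ n c (f : ℕ → ℚ) → sumQ n (λ k → c * f k) ≡ c * sumQ n f
  sumQ-*ˡ zero    c f = sym (ℚP.*-zeroʳ c)
  sumQ-*ˡ (suc n) c f = trans (cong (_+ c * f n) (sumQ-*ˡ n c f)) (sym (ℚP.*-distribˡ-+ c (sumQ n f) (f n)))

  sumQ-swap : ∀ m n (f : ℕ → ℕ → ℚ) → sumQ m (λ i → sumQ n (f i)) ≡ sumQ n (λ j → sumQ m (λ i → f i j))
  sumQ-swap zero    n f = sym (sumQ-zero n)
  sumQ-swap (suc m) n f = trans (cong (_+ sumQ n (f m)) (sumQ-swap m n f)) (sym (sumQ-+ n (λ j → sumQ m (λ i → f i j)) (f m)))

  sumQ-head : ∀ n (f : ℕ → ℚ) → sumQ (suc n) f ≡ f 0 + sumQ n (f ∘ suc)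
  sumQ-head zero    f = ℚP.+-comm 0ℚ (f 0)
  sumQ-head (suc n) f = trans (cong (_+ f (suc n)) (sumQ-head n f)) (ℚP.+-assoc (f 0) (sumQ n (f ∘ suc)) (f (suc n)))

  sumQ-reverse : ∀ n (f : ℕ → ℚ) → sumQ (suc n) f ≡ sumQ (suc n) (λ k → f (n ∸ k))
  sumQ-reverse zero    f = refl
  sumQ-reverse (suc n) f = begin
    sumQ (suc (suc n)) f                                    ≡⟨ sumQ-head (suc n) f ⟩
    f 0 + sumQ (suc n) (f ∘ suc)                            ≡⟨ cong (λ z → f 0 + z) (sumQ-reverse n (f ∘ suc)) ⟩
    f 0 + sumQ (suc n) (λ k → f (suc (n ∸ k)))              ≡⟨ cong (λ z → f 0 + z) (sumQ-cong (suc n) (λ { k (s≤s k≤n) → cong f (sym (ℕP.+-∸-assoc 1 k≤n)) })) ⟩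
    f 0 + sumQ (suc n) (λ k → f (suc n ∸ k))                ≡⟨ ℚP.+-comm (f 0) (sumQ (suc n) (λ k → f (suc n ∸ k))) ⟩
    sumQ (suc n) (λ k → f (suc n ∸ k)) + f 0                ≡⟨ cong (λ z → sumQ (suc n) (λ k → f (suc n ∸ k)) + f z) (ℕP.n∸n≡0 (suc n)) ⟨
    sumQ (suc (suc n)) (λ k → f (suc n ∸ k))                ∎
    where open ≡-Reasoning

  sumQ-extend : ∀ d n (f : ℕ → ℚ) → (∀ k → n ≤ k → f k ≡ 0ℚ) → sumQ (d ℕ.+ n) f ≡ sumQ n f
  sumQ-extend zero    n f z = refl
  sumQ-extend (suc d) n f z = trans (cong₂ _+_ (sumQ-extend d n f z) (z (d ℕ.+ n) (ℕP.m≤n+m n d))) (ℚP.+-identityʳ (sumQ n f))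

  ι-sum : ∀ n (f : ℕ → ℤ) → ι (sumZ n f) ≡ sumQ n (λ k → ι (f k))
  ι-sum zero    f = ι-0
  ι-sum (suc n) f = trans (ι-+ (sumZ n f) (f n)) (cong (_+ ι (f n)) (ι-sum n f))

  ι-^ : ∀ a n → powQ (ι a) n ≡ ι (a ^ n)
  ι-^ a zero    = sym ι-1
  ι-^ a (suc n) = trans (cong (_* ι a) (ι-^ a n)) (trans (ℚP.*-comm (ι (a ^ n)) (ι a)) (sym (ι-* a (a ^ n))))

  -- Bernoulli numbers and Bernoulli polynomials.

  ≤ᵇ-true : ∀ {m n} → m ≤ n → (m ℕ.≤ᵇ n) ≡ true
  ≤ᵇ-true le = Equivalence.to T-≡ (ℕP.≤⇒≤ᵇ le)

  ≡ᵇ-true : ∀ n → (n ℕ.≡ᵇ n) ≡ true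
  ≡ᵇ-true n = Equivalence.to T-≡ (ℕP.≡⇒≡ᵇ n n refl)

  ≤ᵇ-false : ∀ n → (suc n ℕ.≤ᵇ n) ≡ false
  ≤ᵇ-false zero    = refl
  ≤ᵇ-false (suc n) = ≤ᵇ-false n

  bernUpTo-suc : ∀ n k → k ≤ n → bernUpTo (suc n) k ≡ bernUpTo n k
  bernUpTo-suc n k k≤n rewrite ≤ᵇ-true k≤n = refl

  bernUpTo-≤ : ∀ d k → bernUpTo (d ℕ.+ k) k ≡ bernoulli k
  bernUpTo-≤ zero    k = refl
  bernUpTo-≤ (suc d) k = trans (bernUpTo-suc (d ℕ.+ k) k (ℕP.m≤n+m k d)) (bernUpTo-≤ d k)

  bernUpTo-bernoulli : ∀ {n k} → k ≤ n → bernUpTo n k ≡ bernoulli k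
  bernUpTo-bernoulli {n} {k} k≤n = trans (cong (λ m → bernUpTo m k) (sym (ℕP.m∸n+n≡m k≤n))) (bernUpTo-≤ (n ∸ k) k)

  bernoulli-suc : ∀ n → bernoulli (suc n) ≡ - (recipℕ (suc (suc n)) * sumQ (suc n) (λ j → ℕ→ℚ (suc (suc n) C j) * bernUpTo n j))
  bernoulli-suc n rewrite ≤ᵇ-false n | ≡ᵇ-true n = refl

  ι-C : ∀ n k → ℕ→ℚ (n C k) ≡ ι (choose n k)
  ι-C n k = trans (ι-ℕ (n C k)) (cong ι (sym (choose-C n k)))

  bernoulli-recurrence : ∀ n → sumQ (suc (suc n)) (λ j → ι (choose (suc (suc n)) j) * bernoulli j) ≡ 0ℚ
  bernoulli-recurrence n = begin
    S + ι (choose (suc (suc n)) (suc n)) * bernoulli (suc n)   ≡⟨ cong₂ (λ x y → S + ι x * y) (choose-suc-n (suc n)) (bernoulli-suc n) ⟩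
    S + ι (+ suc (suc n)) * - (recipℕ (suc (suc n)) * S′)      ≡⟨ cong (λ z → S + ι (+ suc (suc n)) * - (recipℕ (suc (suc n)) * z)) (sym S≡S′) ⟩
    S + ι (+ suc (suc n)) * - (recipℕ (suc (suc n)) * S)       ≡⟨ l₁ S (ι (+ suc (suc n))) (recipℕ (suc (suc n))) ⟩
    S - recipℕ (suc (suc n)) * ι (+ suc (suc n)) * S           ≡⟨ cong (λ z → S - z * S) (recip-inverse (suc n)) ⟩
    S - 1ℚ * S                                                 ≡⟨ l₂ S ⟩
    0ℚ                                                         ∎
    where
    open ≡-Reasoning
    S S′ : ℚ
    S  = sumQ (suc n) (λ j → ι (choose (suc (suc n)) j) * bernoulli j)
    S′ = sumQ (suc n) (λ j → ℕ→ℚ (suc (suc n) C j) * bernUpTo n j)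
    S≡S′ : S ≡ S′
    S≡S′ = sumQ-cong (suc n) (λ { j (s≤s j≤n) → cong₂ _*_ (sym (ι-C (suc (suc n)) j)) (sym (bernUpTo-bernoulli j≤n)) })
    l₁ : ∀ S a b → S + a * - (b * S) ≡ S - b * a * S
    l₁ = solve-∀ ringℚ
    l₂ : ∀ S → S - 1ℚ * S ≡ 0ℚ
    l₂ = solve-∀ ringℚ

  -- The indicator of 1, by which Σ_{k ≤ m} C(m,k) B_k exceeds B_m.
  δ₁ : ℕ → ℚ
  δ₁ 1 = 1ℚ
  δ₁ _ = 0ℚ

  bernoulli-row-sum′ : ∀ m → sumQ (suc m) (λ k → ι (choose m k) * bernoulli k) ≡ δ₁ m + bernoulli m
  bernoulli-row-sum′ zero          = trans (cong (λ z → 0ℚ + ι z * bernoulli 0) (choose-zeroʳ 0)) (trans (cong (λ z → 0ℚ + z * bernoulli 0) ι-1) (lem (bernoulli 0)))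
    where
    lem : ∀ x → 0ℚ + 1ℚ * x ≡ 0ℚ + x
    lem = solve-∀ ringℚ
  bernoulli-row-sum′ (suc zero)    = trans (cong₂ (λ x y → 0ℚ + ι x * 1ℚ + ι y * bernoulli 1) (choose-zeroʳ 1) (choose-n-n 1))
    (trans (cong (λ z → 0ℚ + z * 1ℚ + z * bernoulli 1) ι-1) (lem (bernoulli 1)))
    where
    lem : ∀ x → 0ℚ + 1ℚ * 1ℚ + 1ℚ * x ≡ 1ℚ + x
    lem = solve-∀ ringℚ
  bernoulli-row-sum′ m@(suc (suc n)) = cong₂ _+_ (bernoulli-recurrence n)
    (trans (cong (λ z → ι z * bernoulli m) (choose-n-n m)) (trans (cong (_* bernoulli m) ι-1) (ℚP.*-identityˡ (bernoulli m))))

  bernoulli-row-sum : ∀ m L → m < L → sumQ L (λ k → ι (choose m k) * bernoulli k) ≡ δ₁ m + bernoulli m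
  bernoulli-row-sum m L m<L = trans (cong (λ l → sumQ l f) (sym (ℕP.m∸n+n≡m m<L)))
    (trans (sumQ-extend (L ∸ suc m) (suc m) f (λ k m<k → trans (cong (λ z → ι z * bernoulli k) (choose-> m<k)) (trans (cong (_* bernoulli k) ι-0) (ℚP.*-zeroˡ (bernoulli k)))))
    (bernoulli-row-sum′ m))
    where
    f : ℕ → ℚ
    f k = ι (choose m k) * bernoulli k

  bernoulliPoly-reversed : ∀ n a → bernoulliPoly n (ι a) ≡ sumQ (suc n) (λ i → ι (a ^ i) * ι (choose n i) * bernoulli (n ∸ i))
  bernoulliPoly-reversed n a = trans (sumQ-reverse n (λ k → ℕ→ℚ (n C k) * bernoulli k * powQ (ι a) (n ∸ k)))
    (sumQ-cong (suc n) (λ { i (s≤s i≤n) → step i i≤n }))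
    where
    open ≡-Reasoning
    l₁ : ∀ x y z → x * y * z ≡ z * x * y
    l₁ = solve-∀ ringℚ
    step : ∀ i → i ≤ n → ℕ→ℚ (n C (n ∸ i)) * bernoulli (n ∸ i) * powQ (ι a) (n ∸ (n ∸ i)) ≡ ι (a ^ i) * ι (choose n i) * bernoulli (n ∸ i)
    step i i≤n = begin
      ℕ→ℚ (n C (n ∸ i)) * bernoulli (n ∸ i) * powQ (ι a) (n ∸ (n ∸ i))
        ≡⟨ cong₂ (λ x y → x * bernoulli (n ∸ i) * y) (trans (ι-C n (n ∸ i)) (cong ι (choose-sym i≤n))) (trans (cong (powQ (ι a)) (ℕP.m∸[m∸n]≡n i≤n)) (ι-^ a i)) ⟩
      ι (choose n i) * bernoulli (n ∸ i) * ι (a ^ i)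
        ≡⟨ l₁ (ι (choose n i)) (bernoulli (n ∸ i)) (ι (a ^ i)) ⟩
      ι (a ^ i) * ι (choose n i) * bernoulli (n ∸ i) ∎

  -- After expanding (a + 1)^(n-k), the symmetry of trinomial coefficients frees C(n,i) from k, so
  -- the sum over k can be taken first and is a row sum of the Bernoulli recurrence.
  bernoulliPoly-translate : ∀ n a → bernoulliPoly n (ι (a ℤ.+ + 1)) ≡ sumQ (suc n) (λ i → ι (a ^ i) * ι (choose n i) * (δ₁ (n ∸ i) + bernoulli (n ∸ i)))
  bernoulliPoly-translate n a = begin
    bernoulliPoly n (ι (a ℤ.+ + 1))
      ≡⟨ sumQ-cong (suc n) expand ⟩
    sumQ (suc n) (λ k → sumQ (suc n) (λ i → ι (a ^ i) * ι (choose n i) * (ι (choose (n ∸ i) k) * bernoulli k)))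
      ≡⟨ sumQ-swap (suc n) (suc n) (λ k i → ι (a ^ i) * ι (choose n i) * (ι (choose (n ∸ i) k) * bernoulli k)) ⟩
    sumQ (suc n) (λ i → sumQ (suc n) (λ k → ι (a ^ i) * ι (choose n i) * (ι (choose (n ∸ i) k) * bernoulli k)))
      ≡⟨ sumQ-cong (suc n) (λ i _ → trans (sumQ-*ˡ (suc n) (ι (a ^ i) * ι (choose n i)) (λ k → ι (choose (n ∸ i) k) * bernoulli k))
           (cong (ι (a ^ i) * ι (choose n i) *_) (bernoulli-row-sum (n ∸ i) (suc n) (s≤s (ℕP.m∸n≤m n i))))) ⟩
    sumQ (suc n) (λ i → ι (a ^ i) * ι (choose n i) * (δ₁ (n ∸ i) + bernoulli (n ∸ i))) ∎
    where
    open ≡-Reasoning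
    expand : ∀ k → k < suc n → ℕ→ℚ (n C k) * bernoulli k * powQ (ι (a ℤ.+ + 1)) (n ∸ k)
      ≡ sumQ (suc n) (λ i → ι (a ^ i) * ι (choose n i) * (ι (choose (n ∸ i) k) * bernoulli k))
    expand k (s≤s k≤n) = begin
      ℕ→ℚ (n C k) * bernoulli k * powQ (ι (a ℤ.+ + 1)) (n ∸ k)
        -- The expansion runs up to i = n for every k, beyond its last nonzero term i = n - k, so
        -- that the double sum is over a square and can be interchanged.
        ≡⟨ cong₂ (λ x y → x * bernoulli k * y) (ι-C n k) (trans (ι-^ (a ℤ.+ + 1) (n ∸ k))
             (trans (cong ι (binomial-theorem (n ∸ k) (suc n) a (s≤s (ℕP.m∸n≤m n k)))) (ι-sum (suc n) (λ i → choose (n ∸ k) i ℤ.* a ^ i)))) ⟩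
      ι (choose n k) * bernoulli k * sumQ (suc n) (λ i → ι (choose (n ∸ k) i ℤ.* a ^ i))
        ≡⟨ sumQ-*ˡ (suc n) (ι (choose n k) * bernoulli k) (λ i → ι (choose (n ∸ k) i ℤ.* a ^ i)) ⟨
      sumQ (suc n) (λ i → ι (choose n k) * bernoulli k * ι (choose (n ∸ k) i ℤ.* a ^ i))
        ≡⟨ sumQ-cong (suc n) (λ { i (s≤s i≤n) → term i i≤n }) ⟩
      sumQ (suc n) (λ i → ι (a ^ i) * ι (choose n i) * (ι (choose (n ∸ i) k) * bernoulli k)) ∎
      where
      l₁ : ∀ x b y z → x * b * (y * z) ≡ z * (x * y) * b
      l₁ = solve-∀ ringℚ
      l₂ : ∀ x y z b → z * (x * y) * b ≡ z * x * (y * b)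
      l₂ = solve-∀ ringℚ
      term : ∀ i → i ≤ n → ι (choose n k) * bernoulli k * ι (choose (n ∸ k) i ℤ.* a ^ i) ≡ ι (a ^ i) * ι (choose n i) * (ι (choose (n ∸ i) k) * bernoulli k)
      term i i≤n = begin
        ι (choose n k) * bernoulli k * ι (choose (n ∸ k) i ℤ.* a ^ i)
          ≡⟨ cong (ι (choose n k) * bernoulli k *_) (ι-* (choose (n ∸ k) i) (a ^ i)) ⟩
        ι (choose n k) * bernoulli k * (ι (choose (n ∸ k) i) * ι (a ^ i))
          ≡⟨ l₁ (ι (choose n k)) (bernoulli k) (ι (choose (n ∸ k) i)) (ι (a ^ i)) ⟩
        ι (a ^ i) * (ι (choose n k) * ι (choose (n ∸ k) i)) * bernoulli k
          ≡⟨ cong (λ z → ι (a ^ i) * z * bernoulli k) (trans (sym (ι-* (choose n k) (choose (n ∸ k) i)))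
               (trans (cong ι (choose-swap n k i k≤n i≤n)) (ι-* (choose n i) (choose (n ∸ i) k)))) ⟩
        ι (a ^ i) * (ι (choose n i) * ι (choose (n ∸ i) k)) * bernoulli k
          ≡⟨ l₂ (ι (choose n i)) (ι (choose (n ∸ i) k)) (ι (a ^ i)) (bernoulli k) ⟩
        ι (a ^ i) * ι (choose n i) * (ι (choose (n ∸ i) k) * bernoulli k) ∎

  δ₁-zero : ∀ n i → i < n → δ₁ (suc n ∸ i) ≡ 0ℚ
  δ₁-zero (suc n) i (s≤s i≤n) = cong δ₁ (ℕP.+-∸-assoc 2 i≤n)

  δ₁-sum : ∀ n (f : ℕ → ℚ) → sumQ (suc (suc n)) (λ i → f i * δ₁ (suc n ∸ i)) ≡ f n
  δ₁-sum n f = begin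
    sumQ n (λ i → f i * δ₁ (suc n ∸ i)) + f n * δ₁ (suc n ∸ n) + f (suc n) * δ₁ (suc n ∸ suc n)
      ≡⟨ cong₂ _+_ (cong₂ _+_
           (trans (sumQ-cong n (λ i i<n → trans (cong (f i *_) (δ₁-zero n i i<n)) (ℚP.*-zeroʳ (f i)))) (sumQ-zero n))
           (cong (λ z → f n * δ₁ z) (ℕP.m+n∸n≡m 1 n)))
           (cong (λ z → f (suc n) * δ₁ z) (ℕP.n∸n≡0 (suc n))) ⟩
    0ℚ + f n * 1ℚ + f (suc n) * 0ℚ
      ≡⟨ lem (f n) (f (suc n)) ⟩
    f n ∎
    where
    open ≡-Reasoning
    lem : ∀ x y → 0ℚ + x * 1ℚ + y * 0ℚ ≡ x
    lem = solve-∀ ringℚ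

  -- Compared with `bernoulliPoly-reversed`, the translated sum has the extra terms with
  -- `δ₁ (suc n ∸ i)`. Only i = n survives, with coefficient C(n+1,n) = n + 1.
  bernoulliPoly-difference : ∀ n a → bernoulliPoly (suc n) (ι (a ℤ.+ + 1)) ≡ bernoulliPoly (suc n) (ι a) + ι (a ^ n) * ι (+ suc n)
  bernoulliPoly-difference n a = begin
    bernoulliPoly (suc n) (ι (a ℤ.+ + 1))
      ≡⟨ bernoulliPoly-translate (suc n) a ⟩
    sumQ (suc (suc n)) (λ i → c i * (δ₁ (suc n ∸ i) + bernoulli (suc n ∸ i)))
      ≡⟨ sumQ-cong (suc (suc n)) (λ i _ → l₁ (c i) (δ₁ (suc n ∸ i)) (bernoulli (suc n ∸ i))) ⟩
    sumQ (suc (suc n)) (λ i → c i * bernoulli (suc n ∸ i) + c i * δ₁ (suc n ∸ i))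
      ≡⟨ sumQ-+ (suc (suc n)) (λ i → c i * bernoulli (suc n ∸ i)) (λ i → c i * δ₁ (suc n ∸ i)) ⟩
    sumQ (suc (suc n)) (λ i → c i * bernoulli (suc n ∸ i)) + sumQ (suc (suc n)) (λ i → c i * δ₁ (suc n ∸ i))
      ≡⟨ cong₂ _+_ (sym (bernoulliPoly-reversed (suc n) a)) (trans (δ₁-sum n c) (cong (λ z → ι (a ^ n) * ι z) (choose-suc-n n))) ⟩
    bernoulliPoly (suc n) (ι a) + ι (a ^ n) * ι (+ suc n) ∎
    where
    open ≡-Reasoning
    c : ℕ → ℚ
    c i = ι (a ^ i) * ι (choose (suc n) i)
    l₁ : ∀ c x y → c * (x + y) ≡ c * y + c * x
    l₁ = solve-∀ ringℚ

  bernoulliPoly-0 : ∀ n → bernoulliPoly n (ι (+ 0)) ≡ bernoulli n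
  bernoulliPoly-0 n = begin
    sumQ n (λ k → ℕ→ℚ (n C k) * bernoulli k * powQ (ι (+ 0)) (n ∸ k)) + ℕ→ℚ (n C n) * bernoulli n * powQ (ι (+ 0)) (n ∸ n)
      ≡⟨ cong₂ _+_ (trans (sumQ-cong n (λ k k<n → trans (cong (ℕ→ℚ (n C k) * bernoulli k *_) (pow0 k k<n)) (ℚP.*-zeroʳ (ℕ→ℚ (n C k) * bernoulli k)))) (sumQ-zero n))
           (cong₂ (λ x y → x * bernoulli n * powQ (ι (+ 0)) y) (trans (ι-C n n) (trans (cong ι (choose-n-n n)) ι-1)) (ℕP.n∸n≡0 n)) ⟩
    0ℚ + 1ℚ * bernoulli n * 1ℚ
      ≡⟨ lem (bernoulli n) ⟩
    bernoulli n ∎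
    where
    open ≡-Reasoning
    lem : ∀ x → 0ℚ + 1ℚ * x * 1ℚ ≡ x
    lem = solve-∀ ringℚ
    pow0 : ∀ k → k < n → powQ (ι (+ 0)) (n ∸ k) ≡ 0ℚ
    pow0 k k<n = trans (cong (powQ (ι (+ 0))) (sym (ℕP.suc-pred (n ∸ k) {{ℕ.≢-nonZero (ℕP.m>n⇒m∸n≢0 k<n)}})))
      (trans (cong (powQ (ι (+ 0)) (ℕ.pred (n ∸ k)) *_) ι-0) (ℚP.*-zeroʳ (powQ (ι (+ 0)) (ℕ.pred (n ∸ k)))))

  bernoulliPoly-power-sum : ∀ n m → bernoulliPoly (suc n) (ι (+ m)) ≡ bernoulli (suc n) + ι (sumZ m (λ j → (+ j) ^ n)) * ι (+ suc n)
  bernoulliPoly-power-sum n zero    = trans (bernoulliPoly-0 (suc n)) (sym (trans (cong (λ z → bernoulli (suc n) + z * ι (+ suc n)) ι-0)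
    (lem (bernoulli (suc n)) (ι (+ suc n)))))
    where
    lem : ∀ x y → x + 0ℚ * y ≡ x
    lem = solve-∀ ringℚ
  bernoulliPoly-power-sum n (suc m) = begin
    bernoulliPoly (suc n) (ι (+ suc m))
      ≡⟨ cong (λ z → bernoulliPoly (suc n) (ι z)) (ℤP.+-comm (+ 1) (+ m)) ⟩
    bernoulliPoly (suc n) (ι (+ m ℤ.+ + 1))
      ≡⟨ bernoulliPoly-difference n (+ m) ⟩
    bernoulliPoly (suc n) (ι (+ m)) + ι ((+ m) ^ n) * ι (+ suc n)
      ≡⟨ cong (_+ ι ((+ m) ^ n) * ι (+ suc n)) (bernoulliPoly-power-sum n m) ⟩
    bernoulli (suc n) + ι S * ι (+ suc n) + ι ((+ m) ^ n) * ι (+ suc n)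
      ≡⟨ lem (bernoulli (suc n)) (ι S) (ι ((+ m) ^ n)) (ι (+ suc n)) ⟩
    bernoulli (suc n) + (ι S + ι ((+ m) ^ n)) * ι (+ suc n)
      ≡⟨ cong (λ z → bernoulli (suc n) + z * ι (+ suc n)) (ι-+ S ((+ m) ^ n)) ⟨
    bernoulli (suc n) + ι (S ℤ.+ (+ m) ^ n) * ι (+ suc n) ∎
    where
    open ≡-Reasoning
    S : ℤ
    S = sumZ m (λ j → (+ j) ^ n)
    lem : ∀ b s x y → b + s * y + x * y ≡ b + (s + x) * y
    lem = solve-∀ ringℚ

  -- Binomial coefficients and `Vpoly` at the integers n and -1 - n.

  fallQ-ℕ : ∀ n k → fallQ (ι (+ n)) k ≡ ι (choose n k) * ι (factorial k)
  fallQ-ℕ n zero    = sym (trans (cong (λ z → ι z * ι (+ 1)) (choose-zeroʳ n)) (cong (λ z → z * z) ι-1))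
  fallQ-ℕ n (suc k) = begin
    fallQ (ι (+ n)) k * (ι (+ n) - ℕ→ℚ k)               ≡⟨ cong₂ (λ x y → x * (ι (+ n) - y)) (fallQ-ℕ n k) (ι-ℕ k) ⟩
    ι c * ι f * (ι (+ n) - ι (+ k))                     ≡⟨ cong₂ _*_ (ι-* c f) (ι-- (+ n) (+ k)) ⟨
    ι (c ℤ.* f) * ι (+ n ℤ.- + k)                       ≡⟨ ι-* (c ℤ.* f) (+ n ℤ.- + k) ⟨
    ι (c ℤ.* f ℤ.* (+ n ℤ.- + k))                       ≡⟨ cong ι eq ⟩
    ι (choose n (suc k) ℤ.* factorial (suc k))          ≡⟨ ι-* (choose n (suc k)) (factorial (suc k)) ⟩
    ι (choose n (suc k)) * ι (factorial (suc k))        ∎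
    where
    open ≡-Reasoning
    c f : ℤ
    c = choose n k
    f = factorial k
    l₁ : ∀ c f x → c ℤ.* f ℤ.* x ≡ x ℤ.* c ℤ.* f
    l₁ = ℤSolver.solve-∀
    l₂ : ∀ k c f → k ℤ.* c ℤ.* f ≡ c ℤ.* (k ℤ.* f)
    l₂ = ℤSolver.solve-∀
    eq : c ℤ.* f ℤ.* (+ n ℤ.- + k) ≡ choose n (suc k) ℤ.* factorial (suc k)
    eq = trans (l₁ c f (+ n ℤ.- + k)) (trans (cong (ℤ._* f) (sym (choose-raise n k))) (trans (l₂ (+ suc k) (choose n (suc k)) f) (cong (choose n (suc k) ℤ.*_) (sym (factorial-suc k)))))

  fallQ-neg : ∀ n k → fallQ (- ι (+ suc n)) k ≡ ι (sgn k ℤ.* choose (n ℕ.+ k) k) * ι (factorial k)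
  fallQ-neg n zero    = sym (trans (cong (λ z → ι (+ 1 ℤ.* z) * ι (+ 1)) (choose-zeroʳ (n ℕ.+ 0))) (cong (λ z → z * z) ι-1))
  fallQ-neg n (suc k) = begin
    fallQ (- ι (+ suc n)) k * (- ι (+ suc n) - ℕ→ℚ k)   ≡⟨ cong₂ (λ x y → x * (- ι (+ suc n) - y)) (fallQ-neg n k) (ι-ℕ k) ⟩
    ι c * ι f * (- ι (+ suc n) - ι (+ k))               ≡⟨ cong₂ _*_ (sym (ι-* c f)) (trans (cong (_- ι (+ k)) (sym (ι-neg (+ suc n)))) (sym (ι-- (ℤ.- + suc n) (+ k)))) ⟩
    ι (c ℤ.* f) * ι (ℤ.- + suc n ℤ.- + k)               ≡⟨ ι-* (c ℤ.* f) (ℤ.- + suc n ℤ.- + k) ⟨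
    ι (c ℤ.* f ℤ.* (ℤ.- + suc n ℤ.- + k))               ≡⟨ cong ι eq ⟩
    ι (c′ ℤ.* factorial (suc k))                        ≡⟨ ι-* c′ (factorial (suc k)) ⟩
    ι c′ * ι (factorial (suc k))                        ∎
    where
    open ≡-Reasoning
    c f c′ : ℤ
    c = sgn k ℤ.* choose (n ℕ.+ k) k
    c′ = sgn (suc k) ℤ.* choose (n ℕ.+ suc k) (suc k)
    f = factorial k
    l₁ : ∀ s c f n k → s ℤ.* c ℤ.* f ℤ.* (ℤ.- (+ 1 ℤ.+ n) ℤ.- k) ≡ (ℤ.- s) ℤ.* ((n ℤ.+ (+ 1 ℤ.+ k)) ℤ.* c) ℤ.* f
    l₁ = ℤSolver.solve-∀
    l₂ : ∀ s k c f → (ℤ.- s) ℤ.* (k ℤ.* c) ℤ.* f ≡ (ℤ.- s) ℤ.* c ℤ.* (k ℤ.* f)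
    l₂ = ℤSolver.solve-∀
    eq : c ℤ.* f ℤ.* (ℤ.- + suc n ℤ.- + k) ≡ c′ ℤ.* factorial (suc k)
    eq = trans (l₁ (sgn k) (choose (n ℕ.+ k) k) f (+ n) (+ k)) (trans (cong (λ z → (ℤ.- sgn k) ℤ.* z ℤ.* f) (sym (choose-absorb-+ n k)))
         (trans (l₂ (sgn k) (+ suc k) (choose (n ℕ.+ suc k) (suc k)) f) (cong (c′ ℤ.*_) (sym (factorial-suc k)))))

  binomQ-ℕ : ∀ n k → binomQ (ι (+ n)) k ≡ ι (choose n k)
  binomQ-ℕ n k = divide-ι (k !) {{k ℕP.!≢0}} (fallQ-ℕ n k)

  binomQ-neg : ∀ n k → binomQ (- ι (+ suc n)) k ≡ ι (sgn k ℤ.* choose (n ℕ.+ k) k)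
  binomQ-neg n k = divide-ι (k !) {{k ℕP.!≢0}} (fallQ-neg n k)

  signQ-sgn : ∀ k → signQ k ≡ ι (sgn k)
  signQ-sgn zero    = sym ι-1
  signQ-sgn (suc k) = trans (cong (_* - 1ℚ) (signQ-sgn k)) (trans (lem (ι (sgn k))) (sym (ι-neg (sgn k))))
    where
    lem : ∀ x → x * - 1ℚ ≡ - x
    lem = solve-∀ ringℚ

  -1-neg : ∀ n → - 1ℚ - (- ι (+ suc n)) ≡ ι (+ n)
  -1-neg n = trans (cong (λ z → - 1ℚ - (- z)) (ι-+ (+ 1) (+ n))) (trans (cong (λ z → - 1ℚ - (- (z + ι (+ n)))) ι-1) (lem (ι (+ n))))
    where
    lem : ∀ x → - 1ℚ - (- (1ℚ + x)) ≡ x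
    lem = solve-∀ ringℚ

  Vpoly-neg : ∀ m n → Vpoly m (- ι (+ suc n)) ≡ ι (sumZ (suc m) (λ k → t m k ℤ.* t n k))
  Vpoly-neg m n = trans (sumQ-cong (suc m) (λ k _ → step k)) (sym (ι-sum (suc m) (λ k → t m k ℤ.* t n k)))
    where
    open ≡-Reasoning
    l₁ : ∀ a b s c d → a ℤ.* b ℤ.* s ℤ.* (s ℤ.* c) ℤ.* d ≡ s ℤ.* (a ℤ.* b) ℤ.* (s ℤ.* (d ℤ.* c))
    l₁ = ℤSolver.solve-∀
    step : ∀ k → ℕ→ℚ (m C k) * ℕ→ℚ ((m ℕ.+ k) C k) * signQ k * binomQ (- ι (+ suc n)) k * binomQ (- 1ℚ - (- ι (+ suc n))) k ≡ ι (t m k ℤ.* t n k)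
    step k = begin
      ℕ→ℚ (m C k) * ℕ→ℚ ((m ℕ.+ k) C k) * signQ k * binomQ (- ι (+ suc n)) k * binomQ (- 1ℚ - (- ι (+ suc n))) k
        ≡⟨ cong₂ _*_ (cong₂ _*_ (cong₂ _*_ (cong₂ _*_ (ι-C m k) (ι-C (m ℕ.+ k) k)) (signQ-sgn k)) (binomQ-neg n k))
             (trans (cong (λ z → binomQ z k) (-1-neg n)) (binomQ-ℕ n k)) ⟩
      ι a * ι b * ι s * ι (s ℤ.* c) * ι d
        ≡⟨ cong (λ z → z * ι s * ι (s ℤ.* c) * ι d) (ι-* a b) ⟨
      ι (a ℤ.* b) * ι s * ι (s ℤ.* c) * ι d
        ≡⟨ cong (λ z → z * ι (s ℤ.* c) * ι d) (ι-* (a ℤ.* b) s) ⟨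
      ι (a ℤ.* b ℤ.* s) * ι (s ℤ.* c) * ι d
        ≡⟨ cong (_* ι d) (ι-* (a ℤ.* b ℤ.* s) (s ℤ.* c)) ⟨
      ι (a ℤ.* b ℤ.* s ℤ.* (s ℤ.* c)) * ι d
        ≡⟨ ι-* (a ℤ.* b ℤ.* s ℤ.* (s ℤ.* c)) d ⟨
      ι (a ℤ.* b ℤ.* s ℤ.* (s ℤ.* c) ℤ.* d)
        ≡⟨ cong ι (l₁ a b s c d) ⟩
      ι (t m k ℤ.* t n k) ∎
      where
      a b s c d : ℤ
      a = choose m k
      b = choose (m ℕ.+ k) k
      s = sgn k
      c = choose (n ℕ.+ k) k
      d = choose n k

  -- p-integral rationals and p-adic continuity.

  module RationalCongruence (r : ℕ) (pr : Prime (4 ℕ.+ r)) where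
    open PrimeModulus r pr
    open TruncatedSum r pr

    -- The fraction need not be in lowest terms, so sums and products are handled by multiplying
    -- denominators, without reducing. Reduced denominators return only in `Integral⇒InZp`.
    record Integral (x : ℚ) : Set where
      constructor fraction
      field
        den num : ℤ
        unit    : Unit den
        eq      : x * ι den ≡ ι num

    Integral-ι : ∀ a → Integral (ι a)
    Integral-ι a = fraction (+ 1) a Unit-1 (trans (cong (ι a *_) ι-1) (ℚP.*-identityʳ (ι a)))

    Integral-+ : ∀ {x y} → Integral x → Integral y → Integral (x + y)
    Integral-+ {x} {y} (fraction b a u e) (fraction b′ a′ u′ e′) = fraction (b ℤ.* b′) (a ℤ.* b′ ℤ.+ a′ ℤ.* b) (Unit-* u u′) (begin
      (x + y) * ι (b ℤ.* b′)                     ≡⟨ cong ((x + y) *_) (ι-* b b′) ⟩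
      (x + y) * (ι b * ι b′)                     ≡⟨ l₁ x y (ι b) (ι b′) ⟩
      x * ι b * ι b′ + y * ι b′ * ι b            ≡⟨ cong₂ (λ u v → u * ι b′ + v * ι b) e e′ ⟩
      ι a * ι b′ + ι a′ * ι b                    ≡⟨ cong₂ _+_ (ι-* a b′) (ι-* a′ b) ⟨
      ι (a ℤ.* b′) + ι (a′ ℤ.* b)                ≡⟨ ι-+ (a ℤ.* b′) (a′ ℤ.* b) ⟨
      ι (a ℤ.* b′ ℤ.+ a′ ℤ.* b)                  ∎)
      where
      open ≡-Reasoning
      l₁ : ∀ x y b c → (x + y) * (b * c) ≡ x * b * c + y * c * b
      l₁ = solve-∀ ringℚ

    Integral-* : ∀ {x y} → Integral x → Integral y → Integral (x * y)
    Integral-* {x} {y} (fraction b a u e) (fraction b′ a′ u′ e′) = fraction (b ℤ.* b′) (a ℤ.* a′) (Unit-* u u′) (begin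
      x * y * ι (b ℤ.* b′)           ≡⟨ cong (x * y *_) (ι-* b b′) ⟩
      x * y * (ι b * ι b′)           ≡⟨ l₁ x y (ι b) (ι b′) ⟩
      x * ι b * (y * ι b′)           ≡⟨ cong₂ _*_ e e′ ⟩
      ι a * ι a′                     ≡⟨ ι-* a a′ ⟨
      ι (a ℤ.* a′)                   ∎)
      where
      open ≡-Reasoning
      l₁ : ∀ x y b c → x * y * (b * c) ≡ x * b * (y * c)
      l₁ = solve-∀ ringℚ

    Integral-neg : ∀ {x} → Integral x → Integral (- x)
    Integral-neg {x} (fraction b a u e) = fraction b (ℤ.- a) u (trans (l₁ x (ι b)) (trans (cong -_ e) (sym (ι-neg a))))
      where
      l₁ : ∀ x b → - x * b ≡ - (x * b)
      l₁ = solve-∀ ringℚ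

    InZp⇒Unit : ∀ {x} → InZp p x → Unit (↧ x)
    InZp⇒Unit cop d with cop (Cong0⇒∣ d , ℕD.∣-refl)
    ... | ()

    InZp⇒Integral : ∀ {x} → InZp p x → Integral x
    InZp⇒Integral {x} cop = fraction (↧ x) (↥ x) (InZp⇒Unit {x} cop) (numerator-denominator x)

    coprime-p : ∀ {n} → ¬ p ℕD.∣ n → Coprime n p
    coprime-p ∤ (i∣n , i∣p) with prime⇒irreducible pr i∣p
    ... | inj₁ e    = e
    ... | inj₂ refl = ⊥-elim (∤ i∣n)

    Integral⇒InZp : ∀ {x} → Integral x → InZp p x
    Integral⇒InZp {x@(mkℚ n d cop)} (fraction b a u e) = coprime-p (λ p∣d →
      [ (λ c → contra (Cong0⇒∣ c) p∣d) , u ]′ (euclid n b (Cong-trans (Cong-reflexive cross) (Cong-*0ʳ a (∣⇒Cong0 {+ suc d} p∣d)))))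
      where
      open ≡-Reasoning
      contra : p ℕD.∣ ∣ n ∣ → ¬ p ℕD.∣ suc d
      -- The coprimality proof stored in a rational is irrelevant and has to be recomputed before it
      -- can be applied.
      contra p∣n p∣d with Coprimality.recompute cop (p∣n , p∣d)
      ... | ()
      l₁ : ∀ x b d → x * d * b ≡ d * (x * b)
      l₁ = solve-∀ ringℚ
      cross : n ℤ.* b ≡ + suc d ℤ.* a
      cross = ι-injective (begin
        ι (n ℤ.* b)              ≡⟨ ι-* n b ⟩
        ι n * ι b                ≡⟨ cong (_* ι b) (numerator-denominator x) ⟨
        x * ι (+ suc d) * ι b    ≡⟨ l₁ x (ι b) (ι (+ suc d)) ⟩
        ι (+ suc d) * (x * ι b)  ≡⟨ cong (ι (+ suc d) *_) e ⟩
        ι (+ suc d) * ι a        ≡⟨ ι-* (+ suc d) a ⟨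
        ι (+ suc d ℤ.* a)        ∎)

    -- `f` is a bound that decreases along the recursion, which passes from n to its proper divisor
    -- n / p.
    p-part : ∀ f n → n < f → .{{ℕ.NonZero n}} → Σ[ s ∈ ℕ ] Σ[ b ∈ ℕ ] n ≡ p ℕ.^ s ℕ.* b × ¬ p ℕD.∣ b
    p-part (suc f) n (s≤s n≤f) with p ℕD.∣? n
    ... | no  ∤ = 0 , n , sym (ℕP.+-identityʳ n) , ∤
    ... | yes (ℕD.divides q@(suc q′) refl) with p-part f q (ℕP.<-≤-trans (ℕP.m<m*n q p (s≤s (s≤s z≤n))) n≤f)
    ...   | s , b , e , ∤ = suc s , b , trans (cong (ℕ._* p) e) (trans (ℕP.*-comm (p ℕ.^ s ℕ.* b) p) (sym (ℕP.*-assoc p (p ℕ.^ s) b))) , ∤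

    -- After multiplication by p^M, `f` maps p-integral numbers to p-integral numbers and satisfies
    -- a Lipschitz estimate there. Clearing p^M lets arbitrary rational constants in, so all
    -- polynomial expressions qualify and no bound on the denominators of Bernoulli numbers is
    -- required. The field `integral` is what makes products work.
    record PolynomialLike (f : ℚ → ℚ) : Set where
      constructor polynomial-like
      field
        M         : ℕ
        integral  : ∀ x → Integral x → Integral (ι (P ^ M) * f x)
        lipschitz : ∀ x y → Integral x → Integral y → Σ[ z ∈ ℚ ] Integral z × ι (P ^ M) * (f x - f y) ≡ (x - y) * z

    PL-const : ∀ c → PolynomialLike (λ _ → c)
    PL-const c with p-part (suc (↧ₙ c)) (↧ₙ c) (ℕP.n<1+n (↧ₙ c))
    ... | s , b , e , ∤ = polynomial-like s (λ _ _ → fraction (+ b) (↥ c) (λ d → ∤ (Cong0⇒∣ d)) eq)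
          (λ x y _ _ → 0ℚ , subst Integral ι-0 (Integral-ι (+ 0)) , l₂ (ι (P ^ s)) c x y)
      where
      open ≡-Reasoning
      l₁ : ∀ x c b → x * c * b ≡ c * (x * b)
      l₁ = solve-∀ ringℚ
      l₂ : ∀ d c x y → d * (c - c) ≡ (x - y) * 0ℚ
      l₂ = solve-∀ ringℚ
      eq : ι (P ^ s) * c * ι (+ b) ≡ ι (↥ c)
      eq = begin
        ι (P ^ s) * c * ι (+ b)           ≡⟨ l₁ (ι (P ^ s)) c (ι (+ b)) ⟩
        c * (ι (P ^ s) * ι (+ b))         ≡⟨ cong (c *_) (ι-* (P ^ s) (+ b)) ⟨
        c * ι (P ^ s ℤ.* + b)             ≡⟨ cong (λ z → c * ι z) (trans (cong (ℤ._* + b) (P^ s)) (trans (sym (ℤP.pos-* (p ℕ.^ s) b)) (cong +_ (sym e)))) ⟩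
        c * ι (+ ↧ₙ c)                    ≡⟨ numerator-denominator c ⟩
        ι (↥ c)                           ∎

    PL-id : PolynomialLike (λ x → x)
    PL-id = polynomial-like 0 (λ x ix → Integral-* (Integral-ι (+ 1)) ix)
      (λ x y _ _ → ι (+ 1) , Integral-ι (+ 1) , ℚP.*-comm (ι (+ 1)) (x - y))

    PL-neg : ∀ {f} → PolynomialLike f → PolynomialLike (λ x → - f x)
    PL-neg {f} (polynomial-like M int lip) = polynomial-like M
      (λ x ix → subst Integral (l₁ (ι (P ^ M)) (f x)) (Integral-neg (int x ix)))
      (λ x y ix iy → let (z , iz , e) = lip x y ix iy in - z , Integral-neg iz ,
        trans (l₂ (ι (P ^ M)) (f x) (f y)) (trans (cong -_ e) (l₃ (x - y) z)))
      where
      l₁ : ∀ d x → - (d * x) ≡ d * - x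
      l₁ = solve-∀ ringℚ
      l₂ : ∀ d x y → d * (- x - - y) ≡ - (d * (x - y))
      l₂ = solve-∀ ringℚ
      l₃ : ∀ x z → - (x * z) ≡ x * - z
      l₃ = solve-∀ ringℚ

    ι-P^-+ : ∀ M M′ → ι (P ^ (M ℕ.+ M′)) ≡ ι (P ^ M) * ι (P ^ M′)
    ι-P^-+ M M′ = trans (cong ι (ℤP.^-distribˡ-+-* P M M′)) (ι-* (P ^ M) (P ^ M′))

    PL-+ : ∀ {f g} → PolynomialLike f → PolynomialLike g → PolynomialLike (λ x → f x + g x)
    PL-+ {f} {g} (polynomial-like M int lip) (polynomial-like M′ int′ lip′) = polynomial-like (M ℕ.+ M′)
      (λ x ix → subst Integral (trans (l₁ d d′ (f x) (g x)) (cong (_* (f x + g x)) (sym (ι-P^-+ M M′))))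
        (Integral-+ (Integral-* (Integral-ι (P ^ M′)) (int x ix)) (Integral-* (Integral-ι (P ^ M)) (int′ x ix))))
      (λ x y ix iy → let (z , iz , e) = lip x y ix iy ; (z′ , iz′ , e′) = lip′ x y ix iy in
        d′ * z + d * z′ , Integral-+ (Integral-* (Integral-ι (P ^ M′)) iz) (Integral-* (Integral-ι (P ^ M)) iz′) ,
        trans (cong (_* (f x + g x - (f y + g y))) (ι-P^-+ M M′)) (trans (l₂ d d′ (f x) (g x) (f y) (g y))
          (trans (cong₂ (λ u v → d′ * u + d * v) e e′) (l₃ d d′ (x - y) z z′))))
      where
      d d′ : ℚ
      d = ι (P ^ M)
      d′ = ι (P ^ M′)
      l₁ : ∀ d e x y → e * (d * x) + d * (e * y) ≡ d * e * (x + y)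
      l₁ = solve-∀ ringℚ
      l₂ : ∀ d e x x′ y y′ → d * e * (x + x′ - (y + y′)) ≡ e * (d * (x - y)) + d * (e * (x′ - y′))
      l₂ = solve-∀ ringℚ
      l₃ : ∀ d e h z z′ → e * (h * z) + d * (h * z′) ≡ h * (e * z + d * z′)
      l₃ = solve-∀ ringℚ

    PL-* : ∀ {f g} → PolynomialLike f → PolynomialLike g → PolynomialLike (λ x → f x * g x)
    PL-* {f} {g} (polynomial-like M int lip) (polynomial-like M′ int′ lip′) = polynomial-like (M ℕ.+ M′)
      (λ x ix → subst Integral (trans (l₁ d d′ (f x) (g x)) (cong (_* (f x * g x)) (sym (ι-P^-+ M M′)))) (Integral-* (int x ix) (int′ x ix)))
      (λ x y ix iy → let (z , iz , e) = lip x y ix iy ; (z′ , iz′ , e′) = lip′ x y ix iy in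
        z * (d′ * g x) + d * f y * z′ , Integral-+ (Integral-* iz (int′ x ix)) (Integral-* (int y iy) iz′) ,
        trans (cong (_* (f x * g x - f y * g y)) (ι-P^-+ M M′)) (trans (l₂ d d′ (f x) (g x) (f y) (g y))
          (trans (cong₂ (λ u v → u * (d′ * g x) + d * f y * v) e e′) (l₃ (d′ * g x) (d * f y) (x - y) z z′))))
      where
      d d′ : ℚ
      d = ι (P ^ M)
      d′ = ι (P ^ M′)
      l₁ : ∀ d e x y → d * x * (e * y) ≡ d * e * (x * y)
      l₁ = solve-∀ ringℚ
      l₂ : ∀ d e x x′ y y′ → d * e * (x * x′ - y * y′) ≡ d * (x - y) * (e * x′) + d * y * (e * (x′ - y′))
      l₂ = solve-∀ ringℚ
      l₃ : ∀ a b h z z′ → h * z * a + b * (h * z′) ≡ h * (z * a + b * z′)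
      l₃ = solve-∀ ringℚ

    PL-sum : ∀ n {f : ℕ → ℚ → ℚ} → (∀ k → PolynomialLike (f k)) → PolynomialLike (λ x → sumQ n (λ k → f k x))
    PL-sum zero    pl = PL-const 0ℚ
    PL-sum (suc n) pl = PL-+ (PL-sum n pl) (pl n)

    PL-pow : ∀ {f} n → PolynomialLike f → PolynomialLike (λ x → powQ (f x) n)
    PL-pow zero    pl = PL-const 1ℚ
    PL-pow (suc n) pl = PL-* (PL-pow n pl) pl

    PL-fall : ∀ {f} n → PolynomialLike f → PolynomialLike (λ x → fallQ (f x) n)
    PL-fall zero    pl = PL-const 1ℚ
    PL-fall (suc n) pl = PL-* (PL-fall n pl) (PL-+ pl (PL-const (- ℕ→ℚ n)))

    PL-binom : ∀ {f} k → PolynomialLike f → PolynomialLike (λ x → binomQ (f x) k)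
    PL-binom k pl = PL-* (PL-fall k pl) (PL-const (recipℕ (k !)))

    PL-reflect : PolynomialLike (λ x → - 1ℚ - x)
    PL-reflect = PL-+ (PL-const (- 1ℚ)) (PL-neg PL-id)

    PL-Vpoly : ∀ n → PolynomialLike (Vpoly n)
    PL-Vpoly n = PL-sum (suc n) (λ k → PL-* (PL-* (PL-const (ℕ→ℚ (n C k) * ℕ→ℚ ((n ℕ.+ k) C k) * signQ k)) (PL-binom k PL-id)) (PL-binom k PL-reflect))

    PL-bernoulliPoly : ∀ {f} n → PolynomialLike f → PolynomialLike (λ x → bernoulliPoly n (f x))
    PL-bernoulliPoly n pl = PL-sum (suc n) (λ k → PL-* (PL-const (ℕ→ℚ (n C k) * bernoulli k)) (PL-pow (n ∸ k) pl))

    PL-Tfun : PolynomialLike (Tfun p)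
    PL-Tfun = PL-* (PL-+ (PL-bernoulliPoly N (PL-neg PL-id)) (PL-const (- bernoulli N))) (PL-const (recipℕ N))

    -- The right side at x = -1 - n, and the passage to all p-integral x.

    target : ℚ → ℚ
    target x = 1ℚ - ℕ→ℚ 2 * binomQ x p * binomQ (- 1ℚ - x) p + ℕ→ℚ (2 ℕ.* p) * Tfun p x + ℕ→ℚ (2 ℕ.* p ℕ.* p) * (Tfun p x * Tfun p x)

    PL-target : PolynomialLike target
    PL-target = PL-+ (PL-+ (PL-+ (PL-const 1ℚ) (PL-neg (PL-* (PL-* (PL-const (ℕ→ℚ 2)) (PL-binom p PL-id)) (PL-binom p PL-reflect))))
      (PL-* (PL-const (ℕ→ℚ (2 ℕ.* p))) PL-Tfun)) (PL-* (PL-const (ℕ→ℚ (2 ℕ.* p ℕ.* p))) (PL-* PL-Tfun PL-Tfun))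

    Tfun-neg : ∀ n → Tfun p (- ι (+ suc n)) ≡ ι (H n)
    Tfun-neg n = divide-ι N (trans (cong (λ z → bernoulliPoly N z - bernoulli N) (l₀ (ι (+ suc n))))
      (trans (cong (_- bernoulli N) (bernoulliPoly-power-sum (ℕ.pred N) (suc n))) (l₁ (bernoulli N) (ι (H n) * ι (+ N)))))
      where
      l₀ : ∀ x → - - x ≡ x
      l₀ = solve-∀ ringℚ
      l₁ : ∀ b x → b + x - b ≡ x
      l₁ = solve-∀ ringℚ

    target-neg : ∀ n → target (- ι (+ suc n)) ≡
      ι (+ 1 ℤ.+ + 2 ℤ.* (choose n p ℤ.* choose (n ℕ.+ p) p) ℤ.+ + 2 ℤ.* P ℤ.* H n ℤ.+ + 2 ℤ.* P ℤ.* P ℤ.* (H n ℤ.* H n))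
    target-neg n = begin
      1ℚ - ℕ→ℚ 2 * binomQ y p * binomQ (- 1ℚ - y) p + ℕ→ℚ (2 ℕ.* p) * Tfun p y + ℕ→ℚ (2 ℕ.* p ℕ.* p) * (Tfun p y * Tfun p y)
        ≡⟨ cong₂ _+_ (cong₂ _+_ (cong₂ (λ u v → u - v) (sym ι-1) e₁) e₂) e₃ ⟩
      ι (+ 1) - ι a + ι b + ι c
        ≡⟨ cong (λ z → z + ι b + ι c) (ι-- (+ 1) a) ⟨
      ι (+ 1 ℤ.- a) + ι b + ι c
        ≡⟨ cong (_+ ι c) (ι-+ (+ 1 ℤ.- a) b) ⟨
      ι (+ 1 ℤ.- a ℤ.+ b) + ι c
        ≡⟨ ι-+ (+ 1 ℤ.- a ℤ.+ b) c ⟨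
      ι (+ 1 ℤ.- a ℤ.+ b ℤ.+ c)
        -- C(-1-n,p) carries the sign (-1)^p = -1, which turns the coefficient -2 into the +2 of
        -- `V-Cong`.
        ≡⟨ cong (λ z → ι (z ℤ.+ b ℤ.+ c)) (trans (cong (λ s → + 1 ℤ.- + 2 ℤ.* (s ℤ.* choose (n ℕ.+ p) p) ℤ.* choose n p) (cong ℤ.-_ sgn-p-1)) (l₁ (choose n p) (choose (n ℕ.+ p) p))) ⟩
      ι (+ 1 ℤ.+ + 2 ℤ.* (choose n p ℤ.* choose (n ℕ.+ p) p) ℤ.+ b ℤ.+ c) ∎
      where
      open ≡-Reasoning
      y : ℚ
      y = - ι (+ suc n)
      a b c : ℤ
      a = + 2 ℤ.* (sgn p ℤ.* choose (n ℕ.+ p) p) ℤ.* choose n p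
      b = + 2 ℤ.* P ℤ.* H n
      c = + 2 ℤ.* P ℤ.* P ℤ.* (H n ℤ.* H n)
      l₁ : ∀ x z → + 1 ℤ.- + 2 ℤ.* (ℤ.- + 1 ℤ.* z) ℤ.* x ≡ + 1 ℤ.+ + 2 ℤ.* (x ℤ.* z)
      l₁ = ℤSolver.solve-∀
      2P : + (2 ℕ.* p) ≡ + 2 ℤ.* P
      2P = trans (ℤP.pos-* 2 p) (cong (+ 2 ℤ.*_) (sym P≡+p))
      2PP : + (2 ℕ.* p ℕ.* p) ≡ + 2 ℤ.* P ℤ.* P
      2PP = trans (ℤP.pos-* (2 ℕ.* p) p) (cong₂ ℤ._*_ 2P (sym P≡+p))
      e₁ : ℕ→ℚ 2 * binomQ y p * binomQ (- 1ℚ - y) p ≡ ι a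
      e₁ = trans (cong₂ _*_ (cong₂ _*_ (ι-ℕ 2) (binomQ-neg n p)) (trans (cong (λ z → binomQ z p) (-1-neg n)) (binomQ-ℕ n p)))
        (trans (cong (_* ι (choose n p)) (sym (ι-* (+ 2) (sgn p ℤ.* choose (n ℕ.+ p) p)))) (sym (ι-* (+ 2 ℤ.* (sgn p ℤ.* choose (n ℕ.+ p) p)) (choose n p))))
      e₂ : ℕ→ℚ (2 ℕ.* p) * Tfun p y ≡ ι b
      e₂ = trans (cong₂ _*_ (trans (ι-ℕ (2 ℕ.* p)) (cong ι 2P)) (Tfun-neg n)) (sym (ι-* (+ 2 ℤ.* P) (H n)))
      e₃ : ℕ→ℚ (2 ℕ.* p ℕ.* p) * (Tfun p y * Tfun p y) ≡ ι c
      e₃ = trans (cong₂ _*_ (trans (ι-ℕ (2 ℕ.* p ℕ.* p)) (cong ι 2PP)) (trans (cong (λ z → z * z) (Tfun-neg n)) (sym (ι-* (H n) (H n))))) (sym (ι-* (+ 2 ℤ.* P ℤ.* P) (H n ℤ.* H n)))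

    -- For x = a/b take c with b c ≡ 1 and n ≡ -a c - 1 modulo p^K. Then a + b (n + 1) ≡ a (1 - b c)
    -- ≡ 0, and this is b times the difference of x and -1 - n.
    approximate : ∀ x → InZp p x → ∀ K → Σ[ n ∈ ℕ ] Σ[ z ∈ ℚ ] Integral z × x - (- ι (+ suc n)) ≡ ι (P ^ K) * z
    approximate x cop K with inverse-mod-P^ (↧ₙ x) (InZp⇒Unit {x} cop) K
    ... | c , ce with natural-residue K (ℤ.- (↥ x ℤ.* c) ℤ.- + 1)
    ...   | n , ne with Cong-trans (Cong-+ (Cong-refl {i = ↥ x}) (Cong-*ˡ (↧ x) (Cong-+ (Cong-refl {i = + 1}) ne)))
                         (Cong-trans (Cong-reflexive (lem (↥ x) (↧ x) c)) (Cong-*0ˡ (↥ x) ce))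
      where
      lem : ∀ a b c → a ℤ.+ b ℤ.* (+ 1 ℤ.+ (ℤ.- (a ℤ.* c) ℤ.- + 1)) ≡ a ℤ.* (+ 1 ℤ.- b ℤ.* c)
      lem = ℤSolver.solve-∀
    ...     | quot q qe = n , ζ , fraction (↧ x) q (InZp⇒Unit {x} cop) ζ-eq , sym ζ-def
      where
      open ≡-Reasoning
      instance
        _ = ℕP.m^n≢0 p K
      d ζ : ℚ
      d = ι (P ^ K)
      ζ = (x + ι (+ suc n)) * recipℕ (p ℕ.^ K)
      d≡ : d ≡ ι (+ (p ℕ.^ K))
      d≡ = cong ι (P^ K)
      inv : recipℕ (p ℕ.^ K) * d ≡ 1ℚ
      inv = trans (cong (recipℕ (p ℕ.^ K) *_) d≡) (recip-inverse′ (p ℕ.^ K))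
      l₁ : ∀ d x r → d * (x * r) ≡ x * (r * d)
      l₁ = solve-∀ ringℚ
      l₂ : ∀ x y → x + y ≡ x - (- y)
      l₂ = solve-∀ ringℚ
      ζ-def : d * ζ ≡ x - (- ι (+ suc n))
      ζ-def = trans (l₁ d (x + ι (+ suc n)) (recipℕ (p ℕ.^ K))) (trans (cong ((x + ι (+ suc n)) *_) inv) (trans (ℚP.*-identityʳ (x + ι (+ suc n))) (l₂ x (ι (+ suc n)))))
      l₃ : ∀ x y r b → (x + y) * r * b ≡ (x * b + b * y) * r
      l₃ = solve-∀ ringℚ
      l₄ : ∀ d q r → d * q * r ≡ q * (r * d)
      l₄ = solve-∀ ringℚ
      ζ-eq : ζ * ι (↧ x) ≡ ι q
      ζ-eq = begin
        (x + ι (+ suc n)) * recipℕ (p ℕ.^ K) * ι (↧ x)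
          ≡⟨ l₃ x (ι (+ suc n)) (recipℕ (p ℕ.^ K)) (ι (↧ x)) ⟩
        (x * ι (↧ x) + ι (↧ x) * ι (+ suc n)) * recipℕ (p ℕ.^ K)
          ≡⟨ cong₂ (λ u v → (u + v) * recipℕ (p ℕ.^ K)) (numerator-denominator x) (sym (ι-* (↧ x) (+ suc n))) ⟩
        (ι (↥ x) + ι (↧ x ℤ.* + suc n)) * recipℕ (p ℕ.^ K)
          ≡⟨ cong (_* recipℕ (p ℕ.^ K)) (trans (sym (ι-+ (↥ x) (↧ x ℤ.* + suc n))) (trans (cong ι (trans qe (ℤP.+-identityˡ (P ^ K ℤ.* q)))) (ι-* (P ^ K) q))) ⟩
        d * ι q * recipℕ (p ℕ.^ K)
          ≡⟨ l₄ d (ι q) (recipℕ (p ℕ.^ K)) ⟩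
        ι q * (recipℕ (p ℕ.^ K) * d)
          ≡⟨ trans (cong (ι q *_) inv) (ℚP.*-identityʳ (ι q)) ⟩
        ι q ∎

    -- The points have to agree modulo p^(M+e): the clearing factor p^M uses up M powers, and e
    -- remain for the values.
    approximate-value : ∀ M e h a b z v q → h ≡ ι (P ^ (M ℕ.+ e)) * z → ι (P ^ M) * (a - b) ≡ h * v →
      b ≡ ι (P ^ e) * q → a ≡ ι (P ^ e) * (z * v + q)
    approximate-value M e h a b z v q hz ab bq = begin
      a                                               ≡⟨ l₁ a b ⟩
      (a - b) + b                                     ≡⟨ cong₂ _+_ a-b bq ⟩
      ι (P ^ e) * (z * v) + ι (P ^ e) * q             ≡⟨ ℚP.*-distribˡ-+ (ι (P ^ e)) (z * v) q ⟨
      ι (P ^ e) * (z * v + q)                         ∎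
      where
      open ≡-Reasoning
      l₁ : ∀ a b → a ≡ a - b + b
      l₁ = solve-∀ ringℚ
      l₂ : ∀ a b z v → a * b * z * v ≡ b * (z * v) * a
      l₂ = solve-∀ ringℚ
      a-b : a - b ≡ ι (P ^ e) * (z * v)
      a-b = *-cancelʳ-ι (p ℕ.^ M) {{ℕP.m^n≢0 p M}} (begin
        (a - b) * ι (+ (p ℕ.^ M))                      ≡⟨ cong (λ u → (a - b) * ι u) (P^ M) ⟨
        (a - b) * ι (P ^ M)                            ≡⟨ ℚP.*-comm (a - b) (ι (P ^ M)) ⟩
        ι (P ^ M) * (a - b)                            ≡⟨ ab ⟩
        h * v                                          ≡⟨ cong (_* v) (trans hz (cong (_* z) (ι-P^-+ M e))) ⟩
        ι (P ^ M) * ι (P ^ e) * z * v                  ≡⟨ l₂ (ι (P ^ M)) (ι (P ^ e)) z v ⟩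
        ι (P ^ e) * (z * v) * ι (P ^ M)                ≡⟨ cong (λ u → ι (P ^ e) * (z * v) * ι u) (P^ M) ⟩
        ι (P ^ e) * (z * v) * ι (+ (p ℕ.^ M))          ∎)

    -- By density of the negative integers in Z_p.
    divisible-by-density : ∀ e {f} → PolynomialLike f → (∀ n → Σ[ q ∈ ℤ ] f (- ι (+ suc n)) ≡ ι (P ^ e) * ι q) →
      ∀ x → InZp p x → Σ[ z ∈ ℚ ] InZp p z × f x ≡ ι (P ^ e) * z
    divisible-by-density e {f} pl values x cop = z * v + ι q , Integral⇒InZp (Integral-+ (Integral-* iz iv) (Integral-ι q)) ,
        approximate-value M e (x - y) (f x) (f y) z v (ι q) xy fx-fy fy
      where
      open PolynomialLike pl using (M; lipschitz)
      near : Σ[ n ∈ ℕ ] Σ[ z ∈ ℚ ] Integral z × x - (- ι (+ suc n)) ≡ ι (P ^ (M ℕ.+ e)) * z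
      near = approximate x cop (M ℕ.+ e)
      n : ℕ
      n = proj₁ near
      z y : ℚ
      z = proj₁ (proj₂ near)
      y = - ι (+ suc n)
      iz : Integral z
      iz = proj₁ (proj₂ (proj₂ near))
      xy : x - y ≡ ι (P ^ (M ℕ.+ e)) * z
      xy = proj₂ (proj₂ (proj₂ near))
      close : Σ[ v ∈ ℚ ] Integral v × ι (P ^ M) * (f x - f y) ≡ (x - y) * v
      close = lipschitz x y (InZp⇒Integral cop) (Integral-neg (Integral-ι (+ suc n)))
      v : ℚ
      v = proj₁ close
      iv : Integral v
      iv = proj₁ (proj₂ close)
      fx-fy : ι (P ^ M) * (f x - f y) ≡ (x - y) * v
      fx-fy = proj₂ (proj₂ close)
      q : ℤ
      q = proj₁ (values n)
      fy : f y ≡ ι (P ^ e) * ι q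
      fy = proj₂ (values n)

    Cong⇒ι : ∀ {e a b} → Cong (P ^ e) a b → Σ[ q ∈ ℤ ] ι a - ι b ≡ ι (P ^ e) * ι q
    Cong⇒ι {e} {a} {b} (quot q eq) = q , (begin
      ι a - ι b                             ≡⟨ cong (λ u → ι u - ι b) eq ⟩
      ι (b ℤ.+ P ^ e ℤ.* q) - ι b           ≡⟨ cong (_- ι b) (ι-+ b (P ^ e ℤ.* q)) ⟩
      ι b + ι (P ^ e ℤ.* q) - ι b           ≡⟨ l₁ (ι b) (ι (P ^ e ℤ.* q)) ⟩
      ι (P ^ e ℤ.* q)                       ≡⟨ ι-* (P ^ e) q ⟩
      ι (P ^ e) * ι q                       ∎)
      where
      open ≡-Reasoning
      l₁ : ∀ a q → a + q - a ≡ q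
      l₁ = solve-∀ ringℚ

    Vpoly-values : ∀ n → Σ[ q ∈ ℤ ] Vpoly p (- ι (+ suc n)) - target (- ι (+ suc n)) ≡ ι (P ^ 3) * ι q
    Vpoly-values n = subst₂ (λ u v → Σ[ q ∈ ℤ ] u - v ≡ ι (P ^ 3) * ι q) (sym (Vpoly-neg p n)) (sym (target-neg n)) (Cong⇒ι {3} (V-Cong n))

    CongQ-intro : ∀ m e a b {z} → InZp m z → a - b ≡ ι (+ (m ℕ.^ e)) * z → CongQ m e a b
    CongQ-intro m e a b {z} iz eq = z , iz , trans eq (cong (_* z) (sym (ι-ℕ (m ℕ.^ e))))

    Vpoly-CongQ : ∀ x → InZp p x → CongQ p 3 (Vpoly p x) (target x)
    Vpoly-CongQ x cop = CongQ-intro p 3 (Vpoly p x) (target x) {proj₁ D} (proj₁ (proj₂ D)) (trans (proj₂ (proj₂ D)) (cong (λ u → ι u * proj₁ D) (P^ 3)))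
      where
      D : Σ[ z ∈ ℚ ] InZp p z × Vpoly p x - target x ≡ ι (P ^ 3) * z
      D = divisible-by-density 3 {λ x → Vpoly p x - target x} (PL-+ (PL-Vpoly p) (PL-neg PL-target)) Vpoly-values x cop

-- Integer sequences of hypergeometric type.

module IntegerSequences where
  open IntegerCongruences
  open import Data.Integer using (_+_; _*_; _-_; -_)
  open import Data.Integer.Tactic.RingSolver using (solve-∀)

  t-step : ∀ n k → + suc k * + suc k * t n (suc k) ≡ - ((+ n - + k) * (+ n + + suc k)) * t n k
  t-step n k = begin
    k′ * k′ * ((- s) * (choose n (suc k) * choose (n ℕ.+ suc k) (suc k)))
      ≡⟨ l₁ k′ s (choose n (suc k)) (choose (n ℕ.+ suc k) (suc k)) ⟩
    (- s) * ((k′ * choose n (suc k)) * (k′ * choose (n ℕ.+ suc k) (suc k)))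
      ≡⟨ cong₂ (λ x y → (- s) * (x * y)) (choose-raise n k) (choose-absorb-+ n k) ⟩
    (- s) * (((+ n - + k) * choose n k) * ((+ n + k′) * choose (n ℕ.+ k) k))
      ≡⟨ l₂ (+ n - + k) (+ n + k′) s (choose n k) (choose (n ℕ.+ k) k) ⟩
    - ((+ n - + k) * (+ n + k′)) * t n k ∎
    where
    open ≡-Reasoning
    k′ s : ℤ
    k′ = + suc k
    s = sgn k
    l₁ : ∀ k s x y → k * k * ((- s) * (x * y)) ≡ (- s) * ((k * x) * (k * y))
    l₁ = solve-∀
    l₂ : ∀ a b s x y → (- s) * ((a * x) * (b * y)) ≡ - (a * b) * (s * (x * y))
    l₂ = solve-∀

  -- This describes X k = (e d²)^k (1/d)_k (1 - 1/d)_k / k!², with rising factorials, which is (e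
  -- d²)^k `t n k` at the formal value n = -1/d. The constant e makes e d² equal to 27, 64 and 432.
  record Hypergeometric (d e : ℤ) (X : ℕ → ℤ) : Set where
    field
      start : X 0 ≡ + 1
      step  : ∀ k → + suc k * + suc k * X (suc k) ≡ e * ((d * + k + + 1) * (d * + k + d - + 1)) * X k

  module TruncatedHypergeometric (r : ℕ) (pr : Prime (4 ℕ.+ r)) where
    open PrimeModulus r pr
    open TruncatedSum r pr

    -- p!² C(n,p) C(n+p,p) = (n−p+1)⋯(n+p) has the two multiples sp and (s+1)p of p; the other factors multiply to (p−1)!² Y n.
    Y-choose : ∀ s a → a < p → Cong (P ^ 3) (+ s * + suc s * Y (a ℕ.+ s ℕ.* p)) (- t (a ℕ.+ s ℕ.* p) p)
    Y-choose s zero    a<p = Cong-trans (Cong-*ˡ (+ s * + suc s) (Y-multiple (s ℕ.* p) (multiple-of-p s)))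
      (Cong-sym (Cong-trans (Cong-reflexive (trans (cong (λ z → - (z * (choose (s ℕ.* p) p * choose (s ℕ.* p ℕ.+ p) p))) (cong -_ sgn-p-1)) (l₁ (choose (s ℕ.* p) p) (choose (s ℕ.* p ℕ.+ p) p))))
      (Cong-* (Cong-* (choose-sp-p s) (Cong-trans (Cong-reflexive (cong (λ z → choose z p) (ℕP.+-comm (s ℕ.* p) p))) (choose-sp-p (suc s)))) (Cong-refl {i = + 1}))))
      where
      l₁ : ∀ x y → - (- + 1 * (x * y)) ≡ x * y * + 1
      l₁ = solve-∀
    Y-choose s (suc a) a<p = cancel-Unit 3 {k = n - P} u-P
      (Cong-trans (Cong-reflexive (l₁ (n - P) σ (Y (suc m))))
      (Cong-trans (Cong-*ˡ σ (Y-step-unit m un))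
      (Cong-trans (Cong-reflexive (l₁ σ (n + P) (Y m)))
      (Cong-trans (Cong-*ˡ (n + P) (Y-choose s a (ℕP.<-trans (ℕP.n<1+n a) a<p)))
      (Cong-reflexive (sym eq))))))
      where
      m : ℕ
      m = a ℕ.+ s ℕ.* p
      n σ : ℤ
      n = + suc m
      σ = + s * + suc s
      un : Unit n
      un d = Unit-suc a<p (Cong-trans (Cong-reflexive (l₀ (+ suc a) (+ (s ℕ.* p)))) (Cong-- d (multiple-of-p s)))
        where
        l₀ : ∀ a b → a ≡ a + b - b
        l₀ = solve-∀
      u-P : Unit (n - P)
      u-P = Unit-resp (Cong-sym (Cong-trans (Cong-- (Cong-refl {i = n}) P-Cong-0) (Cong-reflexive (ℤP.+-identityʳ n)))) un
      l₁ : ∀ a s y → a * (s * y) ≡ s * (a * y)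
      l₁ = solve-∀
      l₂ : ∀ P u → + 2 * (P - P) * u ≡ + 0
      l₂ = solve-∀
      l₃ : ∀ a b x y → a * - x ≡ b * - y - (a * x - b * y)
      l₃ = solve-∀
      eq : (n - P) * - t (suc m) p ≡ (n + P) * - t m p
      eq = trans (l₃ (n - P) (n + P) (t (suc m) p) (t m p)) (trans (cong (λ z → (n + P) * - t m p - z)
        (trans (t-rec P m p) (trans (cong (λ z → + 2 * (z - P) * u m p) (sym P≡+p)) (l₂ P (u m p))))) (ℤP.+-identityʳ ((n + P) * - t m p)))

    module Approximation (d e : ℤ) (X : ℕ → ℤ) (hyp : Hypergeometric d e X) (n : ℕ) (dn : Cong (P ^ 6) (d * + n + + 1) (+ 0)) where
      open Hypergeometric hyp

      A : ℤ
      A = e * (d * d)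

      -- The recursions of `t n` and `X` coincide once d n + 1 is replaced by 0. The factor (k + 1)²
      -- is kept on both sides because for k + 1 = p it cannot be cancelled as a unit.
      scaled-step : ∀ k → Cong (P ^ 6) (A ^ k * t n k) (X k) →
        Cong (P ^ 6) (+ suc k * + suc k * (A ^ suc k * t n (suc k))) (+ suc k * + suc k * X (suc k))
      scaled-step k ih = Cong-trans (Cong-reflexive (trans (l₁ (+ suc k) A (A ^ k) (t n (suc k))) (trans (cong (λ z → A * A ^ k * z) (t-step n k)) (l₂ e d (A ^ k) (+ n) (+ k) (t n k)))))
        (Cong-trans (Cong-* (Cong-*ˡ e (Cong-* (Cong-- (Cong-refl {i = d * + k + + 1}) dn) (Cong-+ dn (Cong-refl {i = d * + k + d - + 1})))) ih)
        (Cong-reflexive (trans (l₃ e (d * + k + + 1) (d * + k + d - + 1) (X k)) (sym (step k)))))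
        where
        l₁ : ∀ k A B t → k * k * (A * B * t) ≡ A * B * (k * k * t)
        l₁ = solve-∀
        l₂ : ∀ e d B n k t → e * (d * d) * B * (- ((n - k) * (n + (+ 1 + k))) * t) ≡ e * ((d * k + + 1 - (d * n + + 1)) * (d * n + + 1 + (d * k + d - + 1))) * (B * t)
        l₂ = solve-∀
        l₃ : ∀ e x y z → e * ((x - + 0) * (+ 0 + y)) * z ≡ e * (x * y) * z
        l₃ = solve-∀

      t-X : ∀ k → k < p → Cong (P ^ 6) (A ^ k * t n k) (X k)
      t-X zero    k<p = Cong-reflexive (trans (ℤP.*-identityˡ (t n 0)) (trans (t-zeroʳ n) (sym start)))
      t-X (suc k) k<p = cancel-Unit 6 (Unit-* (Unit-suc k<p) (Unit-suc k<p)) (scaled-step k (t-X k (ℕP.<-trans (ℕP.n<1+n k) k<p)))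

      -- Dividing the last step by p² costs two powers of p, so working modulo p³ throughout would
      -- not suffice; from p⁶ there remains p⁴, more than enough.
      t-X-p : Cong (P ^ 3) (A ^ p * t n p) (X p)
      t-X-p = Cong-weaken (P ^ 3) P (Cong-mod (l₂ P) (Cong-unscale {μ = P ^ 4} P {{P-nonZero}} (Cong-unscale {μ = P * P ^ 4} P {{P-nonZero}}
        (Cong-trans (Cong-reflexive (eq (A ^ p * t n p))) (Cong-trans (scaled-step (3 ℕ.+ r) (t-X (3 ℕ.+ r) (ℕP.n<1+n (3 ℕ.+ r)))) (Cong-reflexive (sym (eq (X p)))))))))
        where
        l₁ : ∀ P x → P * (P * x) ≡ P * P * x
        l₁ = solve-∀
        l₂ : ∀ P → P * (P * (P * (P * + 1))) ≡ P * (P * (P * + 1)) * P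
        l₂ = solve-∀
        eq : ∀ x → P * (P * x) ≡ + p * + p * x
        eq x = trans (l₁ P x) (cong (λ z → z * z * x) P≡+p)

      truncated : Cong (P ^ 3) (sumZ p (λ k → t p k * (X k * A ^ (p ∸ k)))) (A ^ p * Y n)
      truncated = Cong-trans (sumZ-Cong p (λ k k<p → Cong-trans (Cong-*ˡ (t p k) (Cong-*ʳ (A ^ (p ∸ k)) (Cong-sym (Cong-weaken (P ^ 3) (P ^ 3) (Cong-mod (ℤP.^-distribˡ-+-* P 3 3) (t-X k k<p))))))
          (Cong-reflexive (step′ k (ℕP.<⇒≤ k<p)))))
        (Cong-reflexive (sumZ-*ˡ p (A ^ p) (λ k → t p k * t n k)))
        where
        open ≡-Reasoning
        l₁ : ∀ a b c x → c * (b * x * a) ≡ b * a * (c * x)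
        l₁ = solve-∀
        step′ : ∀ k → k ≤ p → t p k * (A ^ k * t n k * A ^ (p ∸ k)) ≡ A ^ p * (t p k * t n k)
        step′ k k≤p = begin
          t p k * (A ^ k * t n k * A ^ (p ∸ k))     ≡⟨ l₁ (A ^ (p ∸ k)) (A ^ k) (t p k) (t n k) ⟩
          A ^ k * A ^ (p ∸ k) * (t p k * t n k)     ≡⟨ cong (_* (t p k * t n k)) (ℤP.^-distribˡ-+-* A k (p ∸ k)) ⟨
          A ^ (k ℕ.+ (p ∸ k)) * (t p k * t n k)     ≡⟨ cong (λ z → A ^ z * (t p k * t n k)) (ℕP.m+[n∸m]≡n k≤p) ⟩
          A ^ p * (t p k * t n k)                   ∎

    -- With n ≡ −1/d (mod p⁶) and s = ⌊n/p⌋ one has d s ≡ −R, so d² s (s + 1) ≡ − R (d − R) = −(d − 1).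
    truncated-hypergeometric : ∀ d e X → Hypergeometric (+ d) e X → Unit (+ d) → ∀ a R → a < p → + d * + a + + 1 ≡ R * P → R * (+ d - R) ≡ + d - + 1 →
      Cong (P ^ 3) ((+ d - + 1) * sumZ p (λ k → t p k * (X k * (e * (+ d * + d)) ^ (p ∸ k)))) (+ d * + d * X p)
    truncated-hypergeometric d e X hyp ud a R a<p aR RR = Cong-trans (Cong-*ˡ (+ d - + 1) truncated)
            (Cong-trans (Cong-*ʳ (A ^ p * Y n) (Cong-sym d²s))
            (Cong-trans (Cong-reflexive (l₁ (+ d * + d) (+ s * + suc s) (A ^ p) (Y n)))
            (Cong-trans (Cong-*ˡ (- (+ d * + d) * A ^ p) (Y-choose s a a<p))
            (Cong-trans (Cong-reflexive (l₂ (+ d * + d) (A ^ p) (t n p)))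
            (Cong-*ˡ (+ d * + d) t-X-p)))))
      where
      c : ℤ
      c = proj₁ (inverse-mod-P^ d ud 5)
      dc : Cong (P ^ 5) (+ 1 - + d * c) (+ 0)
      dc = proj₂ (inverse-mod-P^ d ud 5)
      s n : ℕ
      s = proj₁ (natural-residue 5 (- (R * c)))
      n = a ℕ.+ s ℕ.* p
      -- Precision p⁵ for `s` gives p⁶ for `n`, since `s` enters `n` multiplied by p.
      sc : Cong (P ^ 5) (+ s) (- (R * c))
      sc = proj₂ (natural-residue 5 (- (R * c)))
      l₁ : ∀ D S A Y → - (D * S) * (A * Y) ≡ - D * A * (S * Y)
      l₁ = solve-∀
      l₂ : ∀ D A t → - D * A * - t ≡ D * (A * t)
      l₂ = solve-∀
      ds : Cong (P ^ 5) (+ d * + s) (- R)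
      ds = Cong-trans (Cong-*ˡ (+ d) sc) (diff⇒Cong (Cong-trans (Cong-reflexive (lem (+ d) R c)) (Cong-*0ˡ R dc)))
        where
        lem : ∀ d R c → d * - (R * c) - - R ≡ R * (+ 1 - d * c)
        lem = solve-∀
      dn : Cong (P ^ 6) (+ d * + n + + 1) (+ 0)
      dn = Cong-trans (Cong-reflexive eq) (Cong-trans (Cong-scale P (Cong-+ (Cong-refl {i = R}) ds)) (Cong-reflexive (lem′ P R)))
        where
        lem : ∀ d a s P → d * (a + s * P) + + 1 ≡ d * a + + 1 + d * s * P
        lem = solve-∀
        lem′ : ∀ P R → P * (R + - R) ≡ + 0
        lem′ = solve-∀
        lem″ : ∀ P R x → R * P + x * P ≡ P * (R + x)
        lem″ = solve-∀
        eq : + d * + n + + 1 ≡ P * (R + + d * + s)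
        eq = trans (cong (λ z → + d * (+ a + z) + + 1) (trans (ℤP.pos-* s p) (cong (+ s *_) (sym P≡+p))))
          (trans (lem (+ d) (+ a) (+ s) P) (trans (cong (_+ + d * + s * P) aR) (lem″ P R (+ d * + s))))
      d²s : Cong (P ^ 3) (- (+ d * + d * (+ s * + suc s))) (+ d - + 1)
      d²s = Cong-trans (Cong-reflexive (lem (+ d) (+ s))) (Cong-trans (Cong-neg (Cong-* ds₃ (Cong-+ ds₃ (Cong-refl {i = + d})))) (Cong-reflexive (trans (lem′ (+ d) R) RR)))
        where
        ds₃ : Cong (P ^ 3) (+ d * + s) (- R)
        ds₃ = Cong-weaken (P ^ 3) (P ^ 2) (Cong-mod (ℤP.^-distribˡ-+-* P 3 2) ds)
        lem : ∀ d s → - (d * d * (s * (+ 1 + s))) ≡ - (d * s * (d * s + d))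
        lem = solve-∀
        lem′ : ∀ d R → - (- R * (- R + d)) ≡ R * (d - R)
        lem′ = solve-∀
      open Approximation (+ d) e X hyp n dn

  -- Recursions of quotients of factorials.

  rising : ℕ → ℤ → ℤ
  rising zero    x = + 1
  rising (suc j) x = (+ suc j + x) * rising j x

  factorial-+ : ∀ j n → factorial (j ℕ.+ n) ≡ rising j (+ n) * factorial n
  factorial-+ zero    n = sym (ℤP.*-identityˡ (factorial n))
  factorial-+ (suc j) n = trans (factorial-suc (j ℕ.+ n)) (trans (cong (+ suc (j ℕ.+ n) *_) (factorial-+ j n))
    (sym (ℤP.*-assoc (+ suc (j ℕ.+ n)) (rising j (+ n)) (factorial n))))

  factorial-* : ∀ j k → factorial (j ℕ.* suc k) ≡ rising j (+ j * + k) * factorial (j ℕ.* k)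
  factorial-* j k = trans (cong factorial (ℕP.*-suc j k)) (trans (factorial-+ j (j ℕ.* k)) (cong (λ z → rising j z * factorial (j ℕ.* k)) (ℤP.pos-* j k)))

  -- For X = F / G with factorial products F and G, whose step factors are φ and δ, the recursion of
  -- X comes down to one polynomial identity in k.
  hypergeometric-quotient : ∀ {d e X} (F G φ δ : ℕ → ℤ) → (∀ k → ℤ.NonZero (G k)) → X 0 ≡ + 1 →
    (∀ k → X k * G k ≡ F k) → (∀ k → F (suc k) ≡ φ k * F k) → (∀ k → G (suc k) ≡ δ k * G k) →
    (∀ k → + suc k * + suc k * φ k ≡ e * ((d * + k + + 1) * (d * + k + d - + 1)) * δ k) → Hypergeometric d e X
  hypergeometric-quotient {d} {e} {X} F G φ δ nz X0 XG Fs Gs φδ = record { start = X0 ; step = λ k →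
    ℤP.*-cancelʳ-≡ _ _ (G (suc k)) {{nz (suc k)}} (begin
      + suc k * + suc k * X (suc k) * G (suc k)              ≡⟨ ℤP.*-assoc (+ suc k * + suc k) (X (suc k)) (G (suc k)) ⟩
      + suc k * + suc k * (X (suc k) * G (suc k))            ≡⟨ cong (+ suc k * + suc k *_) (trans (XG (suc k)) (trans (Fs k) (cong (φ k *_) (sym (XG k))))) ⟩
      + suc k * + suc k * (φ k * (X k * G k))                ≡⟨ l₁ (+ suc k * + suc k) (φ k) (X k) (G k) ⟩
      + suc k * + suc k * φ k * (X k * G k)                  ≡⟨ cong (_* (X k * G k)) (φδ k) ⟩
      c k * δ k * (X k * G k)                                ≡⟨ l₂ (c k) (δ k) (X k) (G k) ⟩
      c k * X k * (δ k * G k)                                ≡⟨ cong (c k * X k *_) (Gs k) ⟨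
      c k * X k * G (suc k)                                  ∎) }
    where
    open ≡-Reasoning
    c : ℕ → ℤ
    c k = e * ((d * + k + + 1) * (d * + k + d - + 1))
    l₁ : ∀ a b x g → a * (b * (x * g)) ≡ a * b * (x * g)
    l₁ = solve-∀
    l₂ : ∀ c d x g → c * d * (x * g) ≡ c * x * (d * g)
    l₂ = solve-∀

  -- These are the multinomial coefficients (3k)!/k!³, (4k)!/((2k)! k!²) and (6k)!/((3k)! (2k)! k!).
  X₃ X₄ X₆ : ℕ → ℤ
  X₃ k = choose (2 ℕ.* k) k * choose (3 ℕ.* k) k
  X₄ k = choose (2 ℕ.* k) k * choose (4 ℕ.* k) (2 ℕ.* k)
  X₆ k = choose (3 ℕ.* k) k * choose (6 ℕ.* k) (3 ℕ.* k)

  factorial-product-nonZero : ∀ a b c → ℤ.NonZero (factorial a * factorial b * factorial c)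
  factorial-product-nonZero a b c = ℤP.i*j≢0 (factorial a * factorial b) (factorial c)
    {{ℤP.i*j≢0 (factorial a) (factorial b) {{factorial-nonZero a}} {{factorial-nonZero b}}}} {{factorial-nonZero c}}

  k+k : ∀ k → k ℕ.+ k ≡ 2 ℕ.* k
  k+k = ℕSolver.solve-∀

  k+[k+k] : ∀ k → k ℕ.+ (k ℕ.+ k) ≡ 3 ℕ.* k
  k+[k+k] = ℕSolver.solve-∀

  k+2k : ∀ k → k ℕ.+ 2 ℕ.* k ≡ 3 ℕ.* k
  k+2k = ℕSolver.solve-∀

  2k+[k+k] : ∀ k → 2 ℕ.* k ℕ.+ (k ℕ.+ k) ≡ 4 ℕ.* k
  2k+[k+k] = ℕSolver.solve-∀

  3k+[k+2k] : ∀ k → 3 ℕ.* k ℕ.+ (k ℕ.+ 2 ℕ.* k) ≡ 6 ℕ.* k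
  3k+[k+2k] = ℕSolver.solve-∀

  hypergeometric₃ : Hypergeometric (+ 3) (+ 3) X₃
  hypergeometric₃ = hypergeometric-quotient (λ k → factorial (3 ℕ.* k)) (λ k → factorial k * factorial k * factorial k)
    (λ k → rising 3 (+ 3 * + k)) (λ k → + suc k * + suc k * + suc k)
    (λ k → factorial-product-nonZero k k k)
    (cong₂ _*_ (choose-zeroʳ 0) (choose-zeroʳ 0))
    (λ k → trans (cong (_* (factorial k * factorial k * factorial k)) (trans (ℤP.*-comm (choose (2 ℕ.* k) k) (choose (3 ℕ.* k) k))
        (cong₂ (λ a b → choose a k * choose b k) (sym (k+[k+k] k)) (sym (k+k k))))) (trans (multinomial k k k) (cong factorial (k+[k+k] k))))
    (factorial-* 3)
    (λ k → trans (cong (λ f → f * f * f) (factorial-suc k)) (l₁ (+ suc k) (factorial k)))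
    (λ k → l₂ (+ k))
    where
    l₁ : ∀ k f → k * f * (k * f) * (k * f) ≡ k * k * k * (f * f * f)
    l₁ = solve-∀
    l₂ : ∀ k → (+ 1 + k) * (+ 1 + k) * ((+ 3 + + 3 * k) * ((+ 2 + + 3 * k) * ((+ 1 + + 3 * k) * + 1))) ≡ + 3 * ((+ 3 * k + + 1) * (+ 3 * k + + 3 - + 1)) * ((+ 1 + k) * (+ 1 + k) * (+ 1 + k))
    l₂ = solve-∀

  hypergeometric₄ : Hypergeometric (+ 4) (+ 4) X₄
  hypergeometric₄ = hypergeometric-quotient (λ k → factorial (4 ℕ.* k)) (λ k → factorial (2 ℕ.* k) * factorial k * factorial k)
    (λ k → rising 4 (+ 4 * + k)) (λ k → rising 2 (+ 2 * + k) * + suc k * + suc k)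
    (λ k → factorial-product-nonZero (2 ℕ.* k) k k)
    (cong₂ _*_ (choose-zeroʳ 0) (choose-zeroʳ 0))
    (λ k → trans (cong (_* (factorial (2 ℕ.* k) * factorial k * factorial k)) (trans (ℤP.*-comm (choose (2 ℕ.* k) k) (choose (4 ℕ.* k) (2 ℕ.* k)))
        (cong₂ (λ a b → choose a (2 ℕ.* k) * choose b k) (sym (2k+[k+k] k)) (sym (k+k k))))) (trans (multinomial (2 ℕ.* k) k k) (cong factorial (2k+[k+k] k))))
    (factorial-* 4)
    (λ k → trans (cong₂ (λ g f → g * f * f) (factorial-* 2 k) (factorial-suc k)) (l₁ (+ suc k) (factorial k) (rising 2 (+ 2 * + k)) (factorial (2 ℕ.* k))))
    (λ k → l₂ (+ k))
    where
    l₁ : ∀ k f ρ g → ρ * g * (k * f) * (k * f) ≡ ρ * k * k * (g * f * f)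
    l₁ = solve-∀
    l₂ : ∀ k → (+ 1 + k) * (+ 1 + k) * ((+ 4 + + 4 * k) * ((+ 3 + + 4 * k) * ((+ 2 + + 4 * k) * ((+ 1 + + 4 * k) * + 1))))
      ≡ + 4 * ((+ 4 * k + + 1) * (+ 4 * k + + 4 - + 1)) * ((+ 2 + + 2 * k) * ((+ 1 + + 2 * k) * + 1) * (+ 1 + k) * (+ 1 + k))
    l₂ = solve-∀

  hypergeometric₆ : Hypergeometric (+ 6) (+ 12) X₆
  hypergeometric₆ = hypergeometric-quotient (λ k → factorial (6 ℕ.* k)) (λ k → factorial (3 ℕ.* k) * factorial k * factorial (2 ℕ.* k))
    (λ k → rising 6 (+ 6 * + k)) (λ k → rising 3 (+ 3 * + k) * + suc k * rising 2 (+ 2 * + k))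
    (λ k → factorial-product-nonZero (3 ℕ.* k) k (2 ℕ.* k))
    (cong₂ _*_ (choose-zeroʳ 0) (choose-zeroʳ 0))
    (λ k → trans (cong (_* (factorial (3 ℕ.* k) * factorial k * factorial (2 ℕ.* k))) (trans (ℤP.*-comm (choose (3 ℕ.* k) k) (choose (6 ℕ.* k) (3 ℕ.* k)))
        (cong₂ (λ a b → choose a (3 ℕ.* k) * choose b k) (sym (3k+[k+2k] k)) (sym (k+2k k))))) (trans (multinomial (3 ℕ.* k) k (2 ℕ.* k)) (cong factorial (3k+[k+2k] k))))
    (factorial-* 6)
    (λ k → trans (cong₂ _*_ (cong₂ _*_ (factorial-* 3 k) (factorial-suc k)) (factorial-* 2 k))
      (l₁ (+ suc k) (factorial k) (rising 2 (+ 2 * + k)) (factorial (2 ℕ.* k)) (rising 3 (+ 3 * + k)) (factorial (3 ℕ.* k))))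
    (λ k → l₂ (+ k))
    where
    l₁ : ∀ k f ρ g σ h → σ * h * (k * f) * (ρ * g) ≡ σ * k * ρ * (h * f * g)
    l₁ = solve-∀
    l₂ : ∀ k → (+ 1 + k) * (+ 1 + k) * ((+ 6 + + 6 * k) * ((+ 5 + + 6 * k) * ((+ 4 + + 6 * k) * ((+ 3 + + 6 * k) * ((+ 2 + + 6 * k) * ((+ 1 + + 6 * k) * + 1))))))
      ≡ + 12 * ((+ 6 * k + + 1) * (+ 6 * k + + 6 - + 1)) * ((+ 3 + + 3 * k) * ((+ 2 + + 3 * k) * ((+ 1 + + 3 * k) * + 1)) * (+ 1 + k) * ((+ 2 + + 2 * k) * ((+ 1 + + 2 * k) * + 1)))
    l₂ = solve-∀

  signZ-sgn : ∀ k → signZ k ≡ sgn k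
  signZ-sgn zero          = refl
  signZ-sgn (suc zero)    = refl
  signZ-sgn (suc (suc k)) = trans (signZ-sgn k) (sym (ℤP.neg-involutive (sgn k)))

  pos-^ : ∀ a m → + (a ℕ.^ m) ≡ (+ a) ^ m
  pos-^ a zero    = refl
  pos-^ a (suc m) = trans (ℤP.pos-* a (a ℕ.^ m)) (cong (+ a *_) (pos-^ a m))

  summand : ∀ n k A (a b c d : ℕ) → + ((n C k) ℕ.* ((n ℕ.+ k) C k)) * signZ k * + ((a C b) ℕ.* (c C d) ℕ.* (A ℕ.^ (n ∸ k)))
    ≡ t n k * (choose a b * choose c d * (+ A) ^ (n ∸ k))
  summand n k A a b c d = begin
    + ((n C k) ℕ.* ((n ℕ.+ k) C k)) * signZ k * + ((a C b) ℕ.* (c C d) ℕ.* (A ℕ.^ (n ∸ k)))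
      ≡⟨ cong₂ _*_ (cong₂ _*_ (pos (n C k) ((n ℕ.+ k) C k) (choose-C n k) (choose-C (n ℕ.+ k) k)) (signZ-sgn k))
           (trans (ℤP.pos-* ((a C b) ℕ.* (c C d)) (A ℕ.^ (n ∸ k))) (cong₂ _*_ (pos (a C b) (c C d) (choose-C a b) (choose-C c d)) (pos-^ A (n ∸ k)))) ⟩
    choose n k * choose (n ℕ.+ k) k * sgn k * (choose a b * choose c d * (+ A) ^ (n ∸ k))
      ≡⟨ cong (_* (choose a b * choose c d * (+ A) ^ (n ∸ k))) (ℤP.*-comm (choose n k * choose (n ℕ.+ k) k) (sgn k)) ⟩
    t n k * (choose a b * choose c d * (+ A) ^ (n ∸ k)) ∎
    where
    open ≡-Reasoning
    pos : ∀ x y {u v} → u ≡ + x → v ≡ + y → + (x ℕ.* y) ≡ u * v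
    pos x y e f = trans (ℤP.pos-* x y) (sym (cong₂ _*_ e f))

  V3seq-sum : ∀ n → V3seq n ≡ sumZ (suc n) (λ k → t n k * (X₃ k * (+ 27) ^ (n ∸ k)))
  V3seq-sum n = sumZ-cong (suc n) (λ k _ → summand n k 27 (2 ℕ.* k) k (3 ℕ.* k) k)

  V4seq-sum : ∀ n → V4seq n ≡ sumZ (suc n) (λ k → t n k * (X₄ k * (+ 64) ^ (n ∸ k)))
  V4seq-sum n = sumZ-cong (suc n) (λ k _ → summand n k 64 (2 ℕ.* k) k (4 ℕ.* k) (2 ℕ.* k))

  V6seq-sum : ∀ n → V6seq n ≡ sumZ (suc n) (λ k → t n k * (X₆ k * (+ 432) ^ (n ∸ k)))
  V6seq-sum n = sumZ-cong (suc n) (λ k _ → summand n k 432 (3 ℕ.* k) k (6 ℕ.* k) (3 ℕ.* k))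

  -- For d = 6 the general argument divides by d - 1 = 5, so the prime 5 is settled by evaluating
  -- the sum; 125 is 5³.
  V6seq-5 : CongZ 5 3 (V6seq 5) (+ 312)
  V6seq-5 = ℕD.divides (∣ V6seq 5 - + 312 ∣ ℕ./ 125) refl

  -- The values modulo p³ for d = 3, 4, 6.

  module SequenceCongruences (r : ℕ) (pr : Prime (4 ℕ.+ r)) where
    open PrimeModulus r pr
    open TruncatedSum r pr
    open TruncatedHypergeometric r pr

    Cong⇒CongZ : ∀ {e a b} → Cong (P ^ e) a b → CongZ p e a b
    Cong⇒CongZ {e} {a} {b} c with Cong⇒diff c
    ... | quot q eq = ℤS.∣⇒∣ᵤ (ℤS.divides q (trans eq (trans (lem (P ^ e) q) (cong (q *_) (P^ e)))))
      where
      lem : ∀ m q → + 0 + m * q ≡ q * m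
      lem = solve-∀

    sgn-p : sgn p ≡ - + 1
    sgn-p = cong -_ sgn-p-1

    -- a is the residue of −1/d modulo p.
    Residue : ℕ → Set
    Residue d = Σ[ a ∈ ℕ ] Σ[ R ∈ ℤ ] a < p × + d * + a + + 1 ≡ R * P × R * (+ d - R) ≡ + d - + 1

    -- The numbers 3, 4, 6 are the moduli d > 2 whose only units are ±1. Hence R is 1 or d - 1, and
    -- R (d - R) = d - 1 in either case. For p ≡ 1 the residue is (p - 1)/d with R = 1.
    residue-1 : ∀ d b → p ≡ 1 ℕ.+ b ℕ.* suc d → Residue (suc d)
    residue-1 d b e = b , + 1 , subst (b <_) (sym e) (s≤s (ℕP.m≤m*n b (suc d))) ,
      trans (cong (λ z → z + + 1) (sym (ℤP.pos-* (suc d) b))) (trans (cong +_ (trans (lem d b) (sym e))) (trans (sym P≡+p) (sym (ℤP.*-identityˡ P)))) ,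
      lem′ (+ suc d)
      where
      lem : ∀ d b → suc d ℕ.* b ℕ.+ 1 ≡ 1 ℕ.+ b ℕ.* suc d
      lem = ℕSolver.solve-∀
      lem′ : ∀ d → + 1 * (d - + 1) ≡ d - + 1
      lem′ = solve-∀

    -- The modulus is D = d + 2 and p = (b + 1) D - 1. The residue is ((D - 1) p - 1)/D, with R = D
    -- - 1.
    residue-−1 : ∀ d b → p ≡ suc d ℕ.+ b ℕ.* suc (suc d) → Residue (suc (suc d))
    residue-−1 d b e = d ℕ.+ b ℕ.* suc d , + suc d , subst (d ℕ.+ b ℕ.* suc d <_) (sym e) (s≤s (ℕP.+-monoʳ-≤ d (ℕP.*-monoʳ-≤ b (ℕP.n≤1+n (suc d))))) ,
      trans (cong (_+ + 1) (sym (ℤP.pos-* (suc (suc d)) (d ℕ.+ b ℕ.* suc d)))) (trans (cong +_ (trans (lem d b) (cong (suc d ℕ.*_) (sym e)))) (trans (ℤP.pos-* (suc d) p) (cong (+ suc d *_) (sym P≡+p)))) ,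
      lem′ (+ d)
      where
      lem : ∀ d b → (2 ℕ.+ d) ℕ.* (d ℕ.+ b ℕ.* (1 ℕ.+ d)) ℕ.+ 1 ≡ (1 ℕ.+ d) ℕ.* ((1 ℕ.+ d) ℕ.+ b ℕ.* (2 ℕ.+ d))
      lem = ℕSolver.solve-∀
      lem′ : ∀ d → (+ 1 + d) * ((+ 2 + d) - (+ 1 + d)) ≡ (+ 2 + d) - + 1
      lem′ = solve-∀

    no-divisor : ∀ {j} k → suc (suc j) < 4 → p ≢ suc (suc j) ℕ.* k
    no-divisor {j} k j<4 e with prime⇒irreducible pr {suc (suc j)} (ℕD.divides k (trans e (ℕP.*-comm (suc (suc j)) k)))
    ... | inj₂ q = ℕP.<-irrefl q (ℕP.<-≤-trans j<4 (ℕP.m≤m+n 4 r))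

    2∤ : ∀ k → p ≢ 2 ℕ.* k
    2∤ k = no-divisor k (s≤s (s≤s (s≤s z≤n)))

    3∤ : ∀ k → p ≢ 3 ℕ.* k
    3∤ k = no-divisor k (s≤s (s≤s (s≤s (s≤s z≤n))))

    residue₃ : Residue 3
    residue₃ = go (p ℕDM.% 3) (p ℕDM./ 3) (ℕDM.m%n<n p 3) (ℕDM.m≡m%n+[m/n]*n p 3)
      where
      go : ∀ j b → j < 3 → p ≡ j ℕ.+ b ℕ.* 3 → Residue 3
      go 0 b _ e = ⊥-elim (3∤ b (trans e (ℕP.*-comm b 3)))
      go 1 b _ e = residue-1 2 b e
      go 2 b _ e = residue-−1 1 b e
      go (suc (suc (suc j))) b (s≤s (s≤s (s≤s ()))) e

    residue₄ : Residue 4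
    residue₄ = go (p ℕDM.% 4) (p ℕDM./ 4) (ℕDM.m%n<n p 4) (ℕDM.m≡m%n+[m/n]*n p 4)
      where
      go : ∀ j b → j < 4 → p ≡ j ℕ.+ b ℕ.* 4 → Residue 4
      go 0 b _ e = ⊥-elim (2∤ (2 ℕ.* b) (trans e (lem b)))
        where
        lem : ∀ b → b ℕ.* 4 ≡ 2 ℕ.* (2 ℕ.* b)
        lem = ℕSolver.solve-∀
      go 1 b _ e = residue-1 3 b e
      go 2 b _ e = ⊥-elim (2∤ (1 ℕ.+ 2 ℕ.* b) (trans e (lem b)))
        where
        lem : ∀ b → 2 ℕ.+ b ℕ.* 4 ≡ 2 ℕ.* (1 ℕ.+ 2 ℕ.* b)
        lem = ℕSolver.solve-∀
      go 3 b _ e = residue-−1 2 b e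
      go (suc (suc (suc (suc j)))) b (s≤s (s≤s (s≤s (s≤s ())))) e

    residue₆ : Residue 6
    residue₆ = go (p ℕDM.% 6) (p ℕDM./ 6) (ℕDM.m%n<n p 6) (ℕDM.m≡m%n+[m/n]*n p 6)
      where
      go : ∀ j b → j < 6 → p ≡ j ℕ.+ b ℕ.* 6 → Residue 6
      go 0 b _ e = ⊥-elim (2∤ (3 ℕ.* b) (trans e (lem b)))
        where
        lem : ∀ b → b ℕ.* 6 ≡ 2 ℕ.* (3 ℕ.* b)
        lem = ℕSolver.solve-∀
      go 1 b _ e = residue-1 5 b e
      go 2 b _ e = ⊥-elim (2∤ (1 ℕ.+ 3 ℕ.* b) (trans e (lem b)))
        where
        lem : ∀ b → 2 ℕ.+ b ℕ.* 6 ≡ 2 ℕ.* (1 ℕ.+ 3 ℕ.* b)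
        lem = ℕSolver.solve-∀
      go 3 b _ e = ⊥-elim (3∤ (1 ℕ.+ 2 ℕ.* b) (trans e (lem b)))
        where
        lem : ∀ b → 3 ℕ.+ b ℕ.* 6 ≡ 3 ℕ.* (1 ℕ.+ 2 ℕ.* b)
        lem = ℕSolver.solve-∀
      go 4 b _ e = ⊥-elim (2∤ (2 ℕ.+ 3 ℕ.* b) (trans e (lem b)))
        where
        lem : ∀ b → 4 ℕ.+ b ℕ.* 6 ≡ 2 ℕ.* (2 ℕ.+ 3 ℕ.* b)
        lem = ℕSolver.solve-∀
      go 5 b _ e = residue-−1 4 b e
      go (suc (suc (suc (suc (suc (suc j)))))) b (s≤s (s≤s (s≤s (s≤s (s≤s (s≤s ())))))) e

    -- The truncated sum contributes v = d² x/(d - 1), and the term k = p contributes -2x because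
    -- `t p p` is ≡ -2. In the applications x = X 1 = e (d - 1), so v is e d² itself.
    sequence-Cong : ∀ d e X x v → Hypergeometric (+ d) e X → Unit (+ d) → Unit (+ d - + 1) → Residue d → Cong (P ^ 3) (X p) x →
      + d * + d * x ≡ (+ d - + 1) * v → Cong (P ^ 3) (sumZ (suc p) (λ k → t p k * (X k * (e * (+ d * + d)) ^ (p ∸ k)))) (v - + 2 * x)
    sequence-Cong d e X x v hyp ud ud-1 (a , R , a<p , aR , RR) Xp dx =
      Cong-trans (Cong-+ (cancel-Unit 3 ud-1 (Cong-trans (truncated-hypergeometric d e X hyp ud a R a<p aR RR) (Cong-trans (Cong-*ˡ (+ d * + d) Xp) (Cong-reflexive dx))))
        (Cong-* t-pp (Cong-trans (Cong-reflexive (trans (cong (λ z → X p * (e * (+ d * + d)) ^ z) (ℕP.n∸n≡0 p)) (ℤP.*-identityʳ (X p)))) Xp)))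
      (Cong-reflexive (trans (cong (λ z → v + z * + 2 * x) sgn-p) (lem v x)))
      where
      lem : ∀ v x → v + - + 1 * + 2 * x ≡ v - + 2 * x
      lem = solve-∀

    X₃-p : Cong (P ^ 3) (X₃ p) (+ 6)
    X₃-p = Cong-* (choose-sp-p 2) (choose-sp-p 3)

    choose-sp-p′ : ∀ s m → m ≡ s ℕ.* p → Cong (P ^ 3) (choose m p) (+ s)
    choose-sp-p′ s m refl = choose-sp-p s

    choose-complement : ∀ s m k → m ≡ s ℕ.* p → k ℕ.+ p ≡ m → Cong (P ^ 3) (choose m k) (+ s)
    choose-complement s m k e kp = Cong-trans (Cong-reflexive (trans (cong (choose m) (sym (trans (cong (_∸ p) (sym kp)) (ℕP.m+n∸n≡m k p))))
      (choose-sym (subst (p ≤_) kp (ℕP.m≤n+m p k))))) (choose-sp-p′ s m e)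

    -- C(4p,2p) is not of the form C(sp,p); choosing in a different order, C(4p,2p) C(2p,p) =
    -- C(4p,p) C(3p,2p), which gives 4 · 3.
    X₄-p : Cong (P ^ 3) (X₄ p) (+ 12)
    X₄-p = Cong-trans (Cong-reflexive eq) (Cong-* (choose-sp-p′ 4 (p ℕ.+ (2 ℕ.* p ℕ.+ p)) (l₁ p)) (choose-complement 3 (2 ℕ.* p ℕ.+ p) (2 ℕ.* p) (l₂ p) refl))
      where
      l₁ : ∀ p → p ℕ.+ (2 ℕ.* p ℕ.+ p) ≡ 4 ℕ.* p
      l₁ = ℕSolver.solve-∀
      l₂ : ∀ p → 2 ℕ.* p ℕ.+ p ≡ 3 ℕ.* p
      l₂ = ℕSolver.solve-∀
      eq : X₄ p ≡ choose (p ℕ.+ (2 ℕ.* p ℕ.+ p)) p * choose (2 ℕ.* p ℕ.+ p) (2 ℕ.* p)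
      eq = trans (ℤP.*-comm (choose (2 ℕ.* p) p) (choose (4 ℕ.* p) (2 ℕ.* p))) (trans (cong₂ (λ a b → choose a (2 ℕ.* p) * choose b p) (sym (2k+[k+k] p)) (sym (k+k p)))
        (trinomial-symmetric (2 ℕ.* p) p p))

    Unit-2 : Unit (+ 2)
    Unit-2 = Unit-suc (s≤s (s≤s (s≤s z≤n)))

    Unit-3 : Unit (+ 3)
    Unit-3 = Unit-suc (s≤s (s≤s (s≤s (s≤s z≤n))))

    -- A further factor C(2p,p) ≡ 2 splits one more block of size p off, and the product becomes
    -- C(6p,p) C(5p,p) C(4p,3p) ≡ 6 · 5 · 4. Then 2 is cancelled.
    X₆-p : Cong (P ^ 3) (X₆ p) (+ 60)
    X₆-p = cancel-Unit 3 Unit-2 (Cong-trans (Cong-*ʳ (X₆ p) (Cong-sym (choose-sp-p 2))) (Cong-trans (Cong-reflexive eq)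
      (Cong-* (choose-sp-p′ 6 (p ℕ.+ (3 ℕ.* p ℕ.+ 2 ℕ.* p)) (l₁ p)) (Cong-* (choose-sp-p′ 5 (p ℕ.+ (3 ℕ.* p ℕ.+ p)) (l₂ p)) (choose-complement 4 (3 ℕ.* p ℕ.+ p) (3 ℕ.* p) (l₃ p) refl)))))
      where
      open ≡-Reasoning
      l₁ : ∀ p → p ℕ.+ (3 ℕ.* p ℕ.+ 2 ℕ.* p) ≡ 6 ℕ.* p
      l₁ = ℕSolver.solve-∀
      l₂ : ∀ p → p ℕ.+ (3 ℕ.* p ℕ.+ p) ≡ 5 ℕ.* p
      l₂ = ℕSolver.solve-∀
      l₃ : ∀ p → 3 ℕ.* p ℕ.+ p ≡ 4 ℕ.* p
      l₃ = ℕSolver.solve-∀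
      l₄ : ∀ a b c → a * (b * c) ≡ c * b * a
      l₄ = solve-∀
      l₅ : ∀ a b c → a * b * c ≡ a * (b * c)
      l₅ = solve-∀
      eq : choose (2 ℕ.* p) p * X₆ p ≡ choose (p ℕ.+ (3 ℕ.* p ℕ.+ 2 ℕ.* p)) p * (choose (p ℕ.+ (3 ℕ.* p ℕ.+ p)) p * choose (3 ℕ.* p ℕ.+ p) (3 ℕ.* p))
      eq = begin
        choose (2 ℕ.* p) p * (choose (3 ℕ.* p) p * choose (6 ℕ.* p) (3 ℕ.* p))
          ≡⟨ l₄ (choose (2 ℕ.* p) p) (choose (3 ℕ.* p) p) (choose (6 ℕ.* p) (3 ℕ.* p)) ⟩
        choose (6 ℕ.* p) (3 ℕ.* p) * choose (3 ℕ.* p) p * choose (2 ℕ.* p) p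
          ≡⟨ cong₂ (λ a b → choose a (3 ℕ.* p) * choose b p * choose (2 ℕ.* p) p) (sym (3k+[k+2k] p)) (sym (k+2k p)) ⟩
        choose (3 ℕ.* p ℕ.+ (p ℕ.+ 2 ℕ.* p)) (3 ℕ.* p) * choose (p ℕ.+ 2 ℕ.* p) p * choose (2 ℕ.* p) p
          ≡⟨ cong (_* choose (2 ℕ.* p) p) (trinomial-symmetric (3 ℕ.* p) p (2 ℕ.* p)) ⟩
        choose (p ℕ.+ (3 ℕ.* p ℕ.+ 2 ℕ.* p)) p * choose (3 ℕ.* p ℕ.+ 2 ℕ.* p) (3 ℕ.* p) * choose (2 ℕ.* p) p
          ≡⟨ l₅ (choose (p ℕ.+ (3 ℕ.* p ℕ.+ 2 ℕ.* p)) p) (choose (3 ℕ.* p ℕ.+ 2 ℕ.* p) (3 ℕ.* p)) (choose (2 ℕ.* p) p) ⟩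
        choose (p ℕ.+ (3 ℕ.* p ℕ.+ 2 ℕ.* p)) p * (choose (3 ℕ.* p ℕ.+ 2 ℕ.* p) (3 ℕ.* p) * choose (2 ℕ.* p) p)
          ≡⟨ cong (λ z → choose (p ℕ.+ (3 ℕ.* p ℕ.+ 2 ℕ.* p)) p * z) (trans (cong (λ z → choose (3 ℕ.* p ℕ.+ z) (3 ℕ.* p) * choose z p) (sym (k+k p))) (trinomial-symmetric (3 ℕ.* p) p p)) ⟩
        choose (p ℕ.+ (3 ℕ.* p ℕ.+ 2 ℕ.* p)) p * (choose (p ℕ.+ (3 ℕ.* p ℕ.+ p)) p * choose (3 ℕ.* p ℕ.+ p) (3 ℕ.* p)) ∎

    V3seq-CongZ : CongZ p 3 (V3seq p) (+ 15)
    V3seq-CongZ = Cong⇒CongZ {3} (Cong-trans (Cong-reflexive (V3seq-sum p)) (sequence-Cong 3 (+ 3) X₃ (+ 6) (+ 27) hypergeometric₃ Unit-3 Unit-2 residue₃ X₃-p refl))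

    V4seq-CongZ : CongZ p 3 (V4seq p) (+ 40)
    V4seq-CongZ = Cong⇒CongZ {3} (Cong-trans (Cong-reflexive (V4seq-sum p)) (sequence-Cong 4 (+ 4) X₄ (+ 12) (+ 64) hypergeometric₄ (Unit-* Unit-2 Unit-2) Unit-3 residue₄ X₄-p refl))

    V6seq-CongZ : Unit (+ 5) → CongZ p 3 (V6seq p) (+ 312)
    V6seq-CongZ u5 = Cong⇒CongZ {3} (Cong-trans (Cong-reflexive (V6seq-sum p)) (sequence-Cong 6 (+ 12) X₆ (+ 60) (+ 432) hypergeometric₆ (Unit-* Unit-2 Unit-3) u5 residue₆ X₆-p refl))

  -- Both sides, multiplied by (k! j!)², equal (2k + 2j)!.
  central-product : ∀ k j → choose (2 ℕ.* k) k * choose (2 ℕ.* j) j * choose (2 ℕ.* k ℕ.+ 2 ℕ.* j) (2 ℕ.* k)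
    ≡ choose (2 ℕ.* (k ℕ.+ j)) (k ℕ.+ j) * (choose (k ℕ.+ j) k * choose (k ℕ.+ j) k)
  central-product k j = ℤP.*-cancelʳ-≡ _ _ (f * f * (g * g)) {{nz}} (begin
    a * b * c * (f * f * (g * g))                 ≡⟨ l₁ a b c f g ⟩
    c * (a * (f * f) * (b * (g * g)))             ≡⟨ cong₂ (λ x y → c * (x * y)) (central k) (central j) ⟩
    c * (factorial (2 ℕ.* k) * factorial (2 ℕ.* j)) ≡⟨ choose-factorial (2 ℕ.* k) (2 ℕ.* j) ⟩
    factorial (2 ℕ.* k ℕ.+ 2 ℕ.* j)               ≡⟨ cong factorial (ℕP.*-distribˡ-+ 2 k j) ⟨
    factorial (2 ℕ.* (k ℕ.+ j))                   ≡⟨ central (k ℕ.+ j) ⟨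
    x * (h * h)                                   ≡⟨ cong (λ z → x * (z * z)) (choose-factorial k j) ⟨
    x * (y * (f * g) * (y * (f * g)))             ≡⟨ l₂ x y f g ⟩
    x * (y * y) * (f * f * (g * g))               ∎)
    where
    open ≡-Reasoning
    a b c x y f g h : ℤ
    a = choose (2 ℕ.* k) k
    b = choose (2 ℕ.* j) j
    c = choose (2 ℕ.* k ℕ.+ 2 ℕ.* j) (2 ℕ.* k)
    x = choose (2 ℕ.* (k ℕ.+ j)) (k ℕ.+ j)
    y = choose (k ℕ.+ j) k
    f = factorial k
    g = factorial j
    h = factorial (k ℕ.+ j)
    nz : ℤ.NonZero (f * f * (g * g))
    nz = ℤP.i*j≢0 (f * f) (g * g) {{ℤP.i*j≢0 f f {{factorial-nonZero k}} {{factorial-nonZero k}}}} {{ℤP.i*j≢0 g g {{factorial-nonZero j}} {{factorial-nonZero j}}}}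
    central : ∀ m → choose (2 ℕ.* m) m * (factorial m * factorial m) ≡ factorial (2 ℕ.* m)
    central m = trans (cong (λ z → choose z m * (factorial m * factorial m)) (sym (k+k m))) (trans (choose-factorial m m) (cong factorial (k+k m)))
    l₁ : ∀ a b c f g → a * b * c * (f * f * (g * g)) ≡ c * (a * (f * f) * (b * (g * g)))
    l₁ = solve-∀
    l₂ : ∀ x y f g → x * (y * (f * g) * (y * (f * g))) ≡ x * (y * y) * (f * f * (g * g))
    l₂ = solve-∀

  centralPair : ℕ → ℕ → ℤ
  centralPair n k = choose (2 ℕ.* k) k * choose (2 ℕ.* n ∸ 2 ℕ.* k) (n ∸ k)

  Vseq-sum : ∀ n → Vseq n ≡ sumZ (suc n) (λ k → centralPair n k * centralPair n k)
  Vseq-sum n = sumZ-cong (suc n) (λ k _ → step ((2 ℕ.* k) C k) ((2 ℕ.* n ∸ 2 ℕ.* k) C (n ∸ k)) (choose-C (2 ℕ.* k) k) (choose-C (2 ℕ.* n ∸ 2 ℕ.* k) (n ∸ k)))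
    where
    lem : ∀ a b → a * a * b * b ≡ a * b * (a * b)
    lem = solve-∀
    step : ∀ a b {x y} → x ≡ + a → y ≡ + b → + (a ℕ.* a ℕ.* b ℕ.* b) ≡ x * y * (x * y)
    step a b refl refl = trans (ℤP.pos-* (a ℕ.* a ℕ.* b) b) (trans (cong (_* + b) (trans (ℤP.pos-* (a ℕ.* a) b) (cong (_* + b) (ℤP.pos-* a a)))) (lem (+ a) (+ b)))

  -- Squares of products of central binomial coefficients.

  module CentralSquares (r : ℕ) (pr : Prime (4 ℕ.+ r)) where
    open PrimeModulus r pr
    open TruncatedSum r pr
    open SequenceCongruences r pr

    Unit-∤ : ∀ {n} → ¬ p ℕD.∣ n → Unit (+ n)
    Unit-∤ ∤ d = ∤ (Cong0⇒∣ d)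

    -- Consecutive entries of the row sp − 1 add up to an entry of the row sp.
    row-step : ∀ M j → Cong P (+ suc M) (+ 0) → Unit (+ suc j) → Cong P (choose M (suc j) * choose M (suc j)) (choose M j * choose M j)
    row-step M j d u = diff⇒Cong (Cong-trans (Cong-reflexive (trans (lem (choose M j) (choose M (suc j))) (cong (_* (choose M (suc j) - choose M j)) (sym (pascal M j)))))
      (Cong-*0ʳ (choose M (suc j) - choose M j) (cancel-Unit¹ u (Cong-trans (Cong-reflexive (choose-absorb M j))
        (Cong-trans (Cong-*0ʳ (choose M j) d) (Cong-reflexive (sym (ℤP.*-zeroʳ (+ suc j)))))))))
      where
      lem : ∀ x y → y * y - x * x ≡ (x + y) * (y - x)
      lem = solve-∀

    row-zero : ∀ M → choose M 0 * choose M 0 ≡ + 1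
    row-zero M = cong (λ z → z * z) (choose-zeroʳ M)

    row-p : ∀ j → j < p → Cong P (choose (3 ℕ.+ r) j * choose (3 ℕ.+ r) j) (+ 1)
    row-p zero    j<p = Cong-reflexive (row-zero (3 ℕ.+ r))
    row-p (suc j) j<p = Cong-trans (row-step (3 ℕ.+ r) j p-Cong-0 (Unit-suc j<p)) (row-p j (ℕP.<-trans (ℕP.n<1+n j) j<p))

    -- Spelled so that its successor is `2 ℕ.* p` by computation.
    2p-1 : ℕ
    2p-1 = 3 ℕ.+ r ℕ.+ (p ℕ.+ 0)

    -- Squares are used because the entries are ±1 modulo p. The passage from index p - 1 to p
    -- cannot go through `row-step`, as p is no unit; there the two entries are the middle ones of
    -- the row and coincide by symmetry.
    row-2p : ∀ j → j < 2 ℕ.* p → Cong P (choose 2p-1 j * choose 2p-1 j) (+ 1)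
    row-2p zero    j<2p = Cong-reflexive (row-zero 2p-1)
    row-2p (suc j) j<2p with p ℕD.∣? suc j
    ... | no  ∤ = Cong-trans (row-step 2p-1 j (multiple-of-p 2) (Unit-∤ ∤)) (row-2p j (ℕP.<-trans (ℕP.n<1+n j) j<2p))
    ... | yes (ℕD.divides 1 e) = Cong-trans (Cong-reflexive (cong (λ z → z * z) (trans (cong (choose 2p-1) suc-j) (choose-sym j≤)))) (row-2p j (ℕP.<-trans (ℕP.n<1+n j) j<2p))
      where
      j≡ : j ≡ 3 ℕ.+ r
      j≡ = ℕP.suc-injective (trans e (ℕP.+-identityʳ p))
      j≤ : j ≤ 2p-1
      j≤ = subst (_≤ 2p-1) (sym j≡) (ℕP.m≤m+n (3 ℕ.+ r) (p ℕ.+ 0))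
      suc-j : suc j ≡ 2p-1 ∸ j
      suc-j = trans e (sym (trans (cong (2p-1 ∸_) j≡) (ℕP.m+n∸m≡n (3 ℕ.+ r) (p ℕ.+ 0))))
    ... | yes (ℕD.divides (suc (suc q)) e) = ⊥-elim (ℕP.<⇒≱ j<2p (subst (2 ℕ.* p ≤_) (sym e) (ℕP.*-monoˡ-≤ p {2} {suc (suc q)} (s≤s (s≤s z≤n)))))

    -- Write k′ = k + 1. By `central-product`, D C(2p,2k′) = C(2p,p) C(p,k′)², and absorption turns
    -- this into k′ D E = p C(2p,p) c² with entries E and c of the rows 2p - 1 and p - 1. Squaring
    -- removes the sign of E. As p² ∣ D², the values E² ≡ 1, c² ≡ 1 and C(2p,p) ≡ 2 are needed only
    -- modulo p.
    centralPair-square : ∀ k → suc k < p → Cong (P ^ 3) (+ suc k * + suc k * (centralPair p (suc k) * centralPair p (suc k))) (P * P * + 4)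
    centralPair-square k k<p = Cong-trans (Cong-sym E-removed) (Cong-trans (Cong-reflexive squared) right)
      where
      open ≡-Reasoning
      k′ D E c C₂ : ℤ
      k′ = + suc k
      D = centralPair p (suc k)
      E = choose 2p-1 (k ℕ.+ suc (k ℕ.+ 0))
      c = choose (3 ℕ.+ r) k
      C₂ = choose (2 ℕ.* p) p
      D-product : D * choose (2 ℕ.* p) (2 ℕ.* suc k) ≡ C₂ * (choose p (suc k) * choose p (suc k))
      D-product = begin
        choose (2 ℕ.* suc k) (suc k) * choose (2 ℕ.* p ∸ 2 ℕ.* suc k) j * choose (2 ℕ.* p) (2 ℕ.* suc k)
          ≡⟨ cong₂ (λ x y → choose (2 ℕ.* suc k) (suc k) * choose x j * choose y (2 ℕ.* suc k)) (sym (ℕP.*-distribˡ-∸ 2 p (suc k)))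
               (trans (cong (2 ℕ.*_) (sym kj)) (ℕP.*-distribˡ-+ 2 (suc k) j)) ⟩
        choose (2 ℕ.* suc k) (suc k) * choose (2 ℕ.* j) j * choose (2 ℕ.* suc k ℕ.+ 2 ℕ.* j) (2 ℕ.* suc k)
          ≡⟨ central-product (suc k) j ⟩
        choose (2 ℕ.* (suc k ℕ.+ j)) (suc k ℕ.+ j) * (choose (suc k ℕ.+ j) (suc k) * choose (suc k ℕ.+ j) (suc k))
          ≡⟨ cong (λ m → choose (2 ℕ.* m) m * (choose m (suc k) * choose m (suc k))) kj ⟩
        C₂ * (choose p (suc k) * choose p (suc k)) ∎
        where
        j : ℕ
        j = p ∸ suc k
        kj : suc k ℕ.+ j ≡ p
        kj = ℕP.m+[n∸m]≡n (ℕP.<⇒≤ k<p)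
      l₁ : ∀ k D E p → + 2 * p * (k * D * E) ≡ k * D * (+ 2 * p * E)
      l₁ = solve-∀
      l₂ : ∀ k D B → k * D * (+ 2 * k * B) ≡ + 2 * k * k * (D * B)
      l₂ = solve-∀
      l₃ : ∀ k C x → + 2 * k * k * (C * (x * x)) ≡ + 2 * C * ((k * x) * (k * x))
      l₃ = solve-∀
      l₄ : ∀ p C c → + 2 * C * ((p * c) * (p * c)) ≡ + 2 * p * (p * (C * (c * c)))
      l₄ = solve-∀
      linear : k′ * D * E ≡ P * (C₂ * (c * c))
      linear = ℤP.*-cancelˡ-≡ (+ 2 * + p) (k′ * D * E) (P * (C₂ * (c * c))) {{ℤP.i*j≢0 (+ 2) (+ p)}} (begin
        + 2 * + p * (k′ * D * E)
          ≡⟨ l₁ k′ D E (+ p) ⟩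
        k′ * D * (+ 2 * + p * E)
          ≡⟨ cong (k′ * D *_) (trans (cong (_* E) (sym (ℤP.pos-* 2 p))) (trans (sym (choose-absorb 2p-1 (k ℕ.+ suc (k ℕ.+ 0)))) (cong (_* choose (2 ℕ.* p) (2 ℕ.* suc k)) (ℤP.pos-* 2 (suc k))))) ⟩
        k′ * D * (+ 2 * k′ * choose (2 ℕ.* p) (2 ℕ.* suc k))
          ≡⟨ l₂ k′ D (choose (2 ℕ.* p) (2 ℕ.* suc k)) ⟩
        + 2 * k′ * k′ * (D * choose (2 ℕ.* p) (2 ℕ.* suc k))
          ≡⟨ cong (+ 2 * k′ * k′ *_) D-product ⟩
        + 2 * k′ * k′ * (C₂ * (choose p (suc k) * choose p (suc k)))
          ≡⟨ l₃ k′ C₂ (choose p (suc k)) ⟩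
        + 2 * C₂ * ((k′ * choose p (suc k)) * (k′ * choose p (suc k)))
          ≡⟨ cong (λ z → + 2 * C₂ * (z * z)) (choose-absorb (3 ℕ.+ r) k) ⟩
        + 2 * C₂ * ((+ p * c) * (+ p * c))
          ≡⟨ l₄ (+ p) C₂ c ⟩
        + 2 * + p * (+ p * (C₂ * (c * c)))
          ≡⟨ cong (λ z → + 2 * + p * (z * (C₂ * (c * c)))) P≡+p ⟨
        + 2 * + p * (P * (C₂ * (c * c))) ∎)
      l₅ : ∀ k D E → k * k * (D * D) * (E * E) ≡ (k * D * E) * (k * D * E)
      l₅ = solve-∀
      squared : k′ * k′ * (D * D) * (E * E) ≡ P * (C₂ * (c * c)) * (P * (C₂ * (c * c)))
      squared = trans (l₅ k′ D E) (cong (λ z → z * z) linear)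
      E² : Cong P (E * E) (+ 1)
      E² = row-2p (k ℕ.+ suc (k ℕ.+ 0)) (ℕP.<-trans (ℕP.n<1+n (k ℕ.+ suc (k ℕ.+ 0))) (ℕP.*-monoʳ-< 2 k<p))
      Unit-E² : Unit (E * E)
      Unit-E² d = Unit-suc {0} (s≤s (s≤s z≤n)) (Cong-trans (Cong-sym E²) d)
      D≡0 : Cong P D (+ 0)
      D≡0 = cancel-Unit¹ {k = k′ * (E * E)} (Unit-* (Unit-suc k<p) Unit-E²)
        (Cong-trans (Cong-reflexive (trans (l₆ k′ E D) (cong (_* E) linear)))
        (Cong-trans (Cong-*0ʳ E (Cong-multiple P (C₂ * (c * c)))) (Cong-reflexive (sym (ℤP.*-zeroʳ (k′ * (E * E)))))))
        where
        l₆ : ∀ k E D → k * (E * E) * D ≡ k * D * E * E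
        l₆ = solve-∀
      D²≡0 : Cong (P ^ 2) (D * D) (+ 0)
      D²≡0 = Cong-mod (cong (P *_) (sym (ℤP.^-identityʳ P))) (Cong-**0 D≡0 D≡0)
      E-removed : Cong (P ^ 3) (k′ * k′ * (D * D) * (E * E)) (k′ * k′ * (D * D))
      E-removed = diff⇒Cong (Cong-trans (Cong-reflexive (l₇ (k′ * k′ * (D * D)) (E * E))) (P²·P (Cong-*0ˡ (k′ * k′) D²≡0) (Cong⇒diff E²)))
        where
        l₇ : ∀ x e → x * e - x ≡ x * (e - + 1)
        l₇ = solve-∀
      C₂≡2 : Cong P C₂ (+ 2)
      C₂≡2 = P²⇒P (P³⇒P² (choose-sp-p 2))
      C₂c² : Cong P (C₂ * (c * c)) (+ 2)
      C₂c² = Cong-trans (Cong-* C₂≡2 (row-p k (ℕP.<-trans (ℕP.n<1+n k) k<p))) (Cong-refl {i = + 2})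
      right : Cong (P ^ 3) (P * (C₂ * (c * c)) * (P * (C₂ * (c * c)))) (P * P * + 4)
      right = diff⇒Cong (Cong-trans (Cong-reflexive (l₈ P (C₂ * (c * c)))) (P²·P (PP (+ 1)) (Cong⇒diff (Cong-* C₂c² C₂c²))))
        where
        l₈ : ∀ P x → P * x * (P * x) - P * P * + 4 ≡ P * P * + 1 * (x * x - + 4)
        l₈ = solve-∀

    -- The two end terms are C(2p,p)² ≡ 4 each, and the inner terms cancel as a sum of inverse
    -- squares.
    Vseq-CongZ : CongZ p 3 (Vseq p) (+ 8)
    Vseq-CongZ = Cong⇒CongZ {3} (Cong-trans (Cong-reflexive (Vseq-sum p))
      (Cong-+ (Cong-trans (Cong-reflexive (sumZ-head (3 ℕ.+ r) (λ k → centralPair p k * centralPair p k)))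
                 (Cong-+ (Cong-* first first) (sum-of-inverse-squares (+ 4) (λ k → centralPair p (suc k) * centralPair p (suc k)) centralPair-square)))
              (Cong-* last last)))
      where
      first : Cong (P ^ 3) (centralPair p 0) (+ 2)
      first = Cong-trans (Cong-reflexive (trans (cong (_* choose (2 ℕ.* p) p) (choose-zeroʳ 0)) (ℤP.*-identityˡ (choose (2 ℕ.* p) p)))) (choose-sp-p 2)
      last : Cong (P ^ 3) (centralPair p p) (+ 2)
      last = Cong-trans (Cong-reflexive (trans (cong₂ (λ x y → choose (2 ℕ.* p) p * choose x y) (ℕP.n∸n≡0 (2 ℕ.* p)) (ℕP.n∸n≡0 p))
        (trans (cong (choose (2 ℕ.* p) p *_) (choose-zeroʳ 0)) (ℤP.*-identityʳ (choose (2 ℕ.* p) p))))) (choose-sp-p 2)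

-- The exceptional prime 5 and the conclusion.

open IntegerCongruences
open RationalFunctions
open IntegerSequences
open import Data.Rational using (_+_; _*_; _-_; -_; 1ℚ)

V6seq-Cong-312 : ∀ r → Prime (4 ℕ.+ r) → CongZ (4 ℕ.+ r) 3 (V6seq (4 ℕ.+ r)) (+ 312)
V6seq-Cong-312 0 pr with prime⇒irreducible pr {2} (ℕD.divides 2 refl)
... | inj₁ ()
... | inj₂ ()
V6seq-Cong-312 1 pr = V6seq-5
V6seq-Cong-312 (suc (suc r)) pr = SequenceCongruences.V6seq-CongZ (suc (suc r)) pr
  (PrimeModulus.Unit-suc (suc (suc r)) pr (s≤s (s≤s (s≤s (s≤s (s≤s (s≤s z≤n)))))))

theorem4p2 : (p : ℕ) → Prime p → 3 < p →
    ((x : ℚ) → InZp p x →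
    CongQ p 3 (Vpoly p x)
    (1ℚ - ℕ→ℚ 2 * binomQ x p * binomQ (- 1ℚ - x) p
    + ℕ→ℚ (2 ℕ.* p) * Tfun p x
    + ℕ→ℚ (2 ℕ.* p ℕ.* p) * (Tfun p x * Tfun p x)))
    × CongZ p 3 (Vseq p) (+ 8)
    × CongZ p 3 (V3seq p) (+ 15)
    × CongZ p 3 (V4seq p) (+ 40)
    × CongZ p 3 (V6seq p) (+ 312)
theorem4p2 2 pr (s≤s (s≤s ()))
theorem4p2 3 pr (s≤s (s≤s (s≤s ())))
theorem4p2 (suc (suc (suc (suc r)))) pr 3<p =
  RationalCongruence.Vpoly-CongQ r pr ,
  CentralSquares.Vseq-CongZ r pr ,
  SequenceCongruences.V3seq-CongZ r pr ,
  SequenceCongruences.V4seq-CongZ r pr ,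
  V6seq-Cong-312 r pr
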